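{- For every $d \in \mathbb{N}_0$, let $\mathfrak{N}_d^{\mathrm{VT}}$ (resp. $\mathfrak{N}_d^{\mathrm{Cay}}$) denote the set of all $n \in \mathbb{N}$ for which there exists a $d$-regular vertex-transitive (resp. Cayley) nut graph of order $n$. Then \[ \mathfrak{N}_d^{\mathrm{VT}} = \mathfrak{N}_d^{\mathrm{Cay}} = \begin{cases} \varnothing, & \text{if $d$ is odd or $d < 4$},\\ \{ n \in \mathbb{N} : n \text{ even},\ n \ge d+4\}, & \text{if } 4 \mid d \text{ and } d \ge 4,\\ \{ n \in \mathbb{N} : 4 \mid n,\ n \ge d+6\}, & \text{if } d \equiv 2 \pmod 4 \text{ and } d \ge 6. \end{cases} \]
   Context: All graphs are finite, simple and undirected. A nut graph is a graph with at least two vertices whose adjacency matrix has eigenvalue $0$ with multiplicity exactly one, such that the corresponding eigenvector (spanning the kernel) has no zero entries. A graph is vertex-transitive if its automorphism group acts transitively on its vertices. For a finite group $\Gamma$ with identity $e$ and a subset $C \subseteq \Gamma\setminus\{e\}$ closed under inversion, $\mathrm{Cay}(\Gamma, C)$ is the graph with vertex set $\Gamma$ in which $u,v$ are adjacent iff $vu^{ -1} \in C$; a Cayley graph is a graph isomorphic to some $\mathrm{Cay}(\Gamma,C)$. -}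

module Defs where

open import Level using (0ℓ)
open import Algebra.Bundles using (Group)
open import Algebra.Structures using (IsGroup)
import Algebra.Definitions.RawMonoid as RawMonoidDefs
import Algebra.Properties.Group as GroupProperties
open import Data.Bool.Base using (Bool; true; false; if_then_else_)
open import Data.Empty using (⊥-elim)
open import Data.Fin.Base using (Fin)
open import Data.Fin.Permutation using (Permutation; Permutation′; _⟨$⟩ʳ_)
open import Data.Fin.Subset using (Subset; _∈_; _∉_; ∣_∣)
open import Data.Nat.Base using (ℕ; _≤_)
open import Data.Product.Base using (∃; ∃-syntax; Σ-syntax; _×_; _,_)
open import Data.Rational.Base using (ℚ; 0ℚ; 1ℚ; _*_; +-0-rawMonoid)
open import Data.Vec.Base using (lookup; tabulate)
open import Data.Vec.Functional using (Vector)
open import Data.Vec.Properties using ([]=⇒lookup; lookup⇒[]=)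
open import Relation.Binary.PropositionalEquality
  using (_≡_; _≢_; refl; sym; trans; cong; subst)
open import Relation.Unary using (Pred)

private
  variable
    m n : ℕ

-- Vertices are taken to be Fin n, which covers all graphs of order n up to
-- isomorphism.
record Graph (n : ℕ) : Set where
  field
    adj       : Fin n → Fin n → Bool
    adj-sym   : ∀ u v → adj u v ≡ adj v u
    adj-irrefl : ∀ v → adj v v ≡ false

open Graph public

neighbourhood : Graph n → Fin n → Subset n
neighbourhood G v = tabulate (adj G v)

degree : Graph n → Fin n → ℕ
degree G v = ∣ neighbourhood G v ∣

Regular : ℕ → Graph n → Set
Regular d G = ∀ v → degree G v ≡ d

IsIsomorphism : Graph m → Graph n → Permutation m n → Set
IsIsomorphism G H π = ∀ u v → adj H (π ⟨$⟩ʳ u) (π ⟨$⟩ʳ v) ≡ adj G u v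

infix 4 _≅_

_≅_ : Graph m → Graph n → Set
_≅_ {m} {n} G H = Σ[ π ∈ Permutation m n ] IsIsomorphism G H π

IsAutomorphism : Graph n → Permutation′ n → Set
IsAutomorphism G = IsIsomorphism G G

VertexTransitive : Graph n → Set
VertexTransitive {n} G =
  ∀ u v → Σ[ π ∈ Permutation′ n ] IsAutomorphism G π × π ⟨$⟩ʳ u ≡ v

Matrix : ℕ → Set
Matrix n = Fin n → Fin n → ℚ

∑ : Vector ℚ n → ℚ
∑ = RawMonoidDefs.sum +-0-rawMonoid

infixr 7 _*ᵥ_

_*ᵥ_ : Matrix n → Vector ℚ n → Vector ℚ n
(A *ᵥ x) i = ∑ (λ j → A i j * x j)

adjacencyMatrix : Graph n → Matrix n
adjacencyMatrix G u v = if adj G u v then 1ℚ else 0ℚ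

InEigenspace : Matrix n → ℚ → Vector ℚ n → Set
InEigenspace A μ x = ∀ i → (A *ᵥ x) i ≡ μ * x i

IsEigenvector : Matrix n → ℚ → Vector ℚ n → Set
IsEigenvector A μ x = InEigenspace A μ x × (∃[ i ] x i ≢ 0ℚ)

SpansEigenspace : Matrix n → ℚ → Vector ℚ n → Set
SpansEigenspace A μ x =
  ∀ y → InEigenspace A μ y → ∃[ c ] (∀ i → y i ≡ c * x i)

-- The adjacency matrix is symmetric, so the multiplicity of an eigenvalue is
-- the dimension of its eigenspace.  Multiplicity one thus means that some
-- eigenvector spans the eigenspace.  Since the matrix and the eigenvalue 0 are
-- rational, the dimension of the kernel, and whether a spanning vector has a
-- zero entry, are the same over ℚ as over ℝ.
Nut : Graph n → Set
Nut {n} G = 2 ≤ n × Σ[ x ∈ Vector ℚ n ]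
    ( IsEigenvector A 0ℚ x
    × SpansEigenspace A 0ℚ x
    × (∀ i → x i ≢ 0ℚ) )
  where
  A : Matrix n
  A = adjacencyMatrix G

-- As for graphs, the carrier Fin m is no restriction up to isomorphism.
record FiniteGroup (m : ℕ) : Set where
  infixl 7 _∙_
  infix  8 _⁻¹
  field
    _∙_     : Fin m → Fin m → Fin m
    ε       : Fin m
    _⁻¹     : Fin m → Fin m
    isGroup : IsGroup _≡_ _∙_ ε _⁻¹

  group : Group 0ℓ 0ℓ
  group = record { isGroup = isGroup }

record ConnectionSet (Γ : FiniteGroup m) : Set where
  open FiniteGroup Γ
  field
    C        : Subset m
    ε∉C      : ε ∉ C
    C-inv    : ∀ {g} → g ∈ C → g ⁻¹ ∈ C

module _ (Γ : FiniteGroup m) (S : ConnectionSet Γ) where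
  open FiniteGroup Γ
  open ConnectionSet S
  private
    open module G = Group group using (inverseʳ)
    open GroupProperties group using (⁻¹-anti-homo-∙; ⁻¹-involutive)

    bool-ext : ∀ {a b} → (a ≡ true → b ≡ true) → (b ≡ true → a ≡ true) → a ≡ b
    bool-ext {true}  {b}     f g = sym (f refl)
    bool-ext {false} {true}  f g = g refl
    bool-ext {false} {false} f g = refl

    lookup-⁻¹ : ∀ g → lookup C g ≡ true → lookup C (g ⁻¹) ≡ true
    lookup-⁻¹ g p = []=⇒lookup (C-inv (lookup⇒[]= g C p))

    swap-⁻¹ : ∀ u v → (v ∙ u ⁻¹) ⁻¹ ≡ u ∙ v ⁻¹
    swap-⁻¹ u v =
      trans (⁻¹-anti-homo-∙ v (u ⁻¹)) (cong (_∙ v ⁻¹) (⁻¹-involutive u))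

    flip : ∀ u v → lookup C (v ∙ u ⁻¹) ≡ true → lookup C (u ∙ v ⁻¹) ≡ true
    flip u v p =
      subst (λ g → lookup C g ≡ true) (swap-⁻¹ u v) (lookup-⁻¹ (v ∙ u ⁻¹) p)

    irrefl : ∀ v → lookup C (v ∙ v ⁻¹) ≡ false
    irrefl v with lookup C (v ∙ v ⁻¹) in eq
    ... | false = refl
    ... | true  = ⊥-elim (ε∉C (subst (_∈ C) (inverseʳ v) (lookup⇒[]= _ C eq)))

  Cay : Graph m
  Cay = record
    { adj        = λ u v → lookup C (v ∙ u ⁻¹)
    ; adj-sym    = λ u v → bool-ext (flip u v) (flip v u)
    ; adj-irrefl = irrefl
    }

IsCayley : Graph n → Set
IsCayley G =
  ∃[ m ] Σ[ Γ ∈ FiniteGroup m ] Σ[ S ∈ ConnectionSet Γ ] G ≅ Cay Γ S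

-- 0 is included in the ambient type of orders, but belongs to neither set,
-- since nut graphs have at least two vertices.
𝔑-VT : ℕ → Pred ℕ 0ℓ
𝔑-VT d n = Σ[ G ∈ Graph n ] Regular d G × VertexTransitive G × Nut G

𝔑-Cay : ℕ → Pred ℕ 0ℓ
𝔑-Cay d n = Σ[ G ∈ Graph n ] Regular d G × IsCayley G × Nut G

{-# OPTIONS --safe #-}

-- Necessity.  An automorphism maps the kernel vector x to a multiple of itself, and
-- comparing sums of squares shows that the factor is ±1; by transitivity x may be
-- taken with entries ±1.  Each vertex then has equally many neighbours of both
-- signs, so d = 2M, and the entries of x sum to zero, so n = 2B; counting the edges
-- among the B negative vertices shows that MB is even.  If n = d + 2, then
-- non-adjacent vertices are twins, and if d = 2, then x restricted to every second
-- vertex of a cycle is again a kernel vector.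
--
-- Existence.  All examples are Cayley graphs of the dihedral group of order 2m, given
-- by a symmetric set R of rotations and a set T of reflections, both subsets of ℤ/m.
-- With R, T and the adjoint T* acting by convolution on sequences of period m, the
-- kernel equations are R g + T k = 0 and R k + T* g = 0.
--   If 4 ∤ m, then T is symmetric and R, T share a large common part W, so that
-- (R + T)(g + k) = 0 and (T - R)(g - k) = 0.  The operator T - R is explicit, and
-- R + T = 2 W + (four terms) is injective by a parity argument on a cycle of odd
-- length (two such arguments if m is even).
--   If 4 ∣ m, then R is a union of cosets of {0, m/2} and T arises from R by adding or
-- removing two elements, in such a way that p = g + k, up to a shift by m/4 and a
-- twist by (-1)^x, satisfies p ± R p = const.  Then p has period m/2, which makes
-- R p even, and infinite descent shows that p is constant.
--   The pair d = 6, n = 12 escapes these constructions and is verified directly.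
module Submission where

open import Defs
open import Data.Bool.Base using (Bool; true; false; if_then_else_; _∧_; _∨_; not)
open import Data.Fin.Base as Fin using (Fin; zero; suc; toℕ; _↑ˡ_; _↑ʳ_; splitAt; join)
open import Data.Fin.Permutation using (Permutation; Permutation′; _⟨$⟩ʳ_; _⟨$⟩ˡ_; permutation; _∘ₚ_; flip; inverseˡ; inverseʳ) renaming (id to idₚ)
import Data.Fin.Properties as Fin
import Data.Fin.Subset as Subset
open import Data.Integer.Base as ℤ using (ℤ; 0ℤ; 1ℤ; _+_; _*_; -_; _-_) renaming (+_ to pos)
import Data.Integer.Properties as ℤ
open import Data.Integer.Tactic.RingSolver using (solve-∀)
open import Data.Nat.Base as ℕ using (ℕ; zero; suc; _≤_; s≤s; z≤n; _<_)
open import Data.Empty using (⊥)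
open import Data.Product.Base using (_×_; _,_; proj₁; proj₂; ∃-syntax)
open import Data.Vec.Base using (tabulate; lookup)
open import Function.Base using (_∘_; _$_)
open import Relation.Nullary using (yes; no; does; contradiction)
open import Relation.Nullary.Decidable using (dec-true; dec-false; toWitness)
open import Relation.Binary.PropositionalEquality hiding ([_])
open import Algebra.Properties.Semiring.Sum ℤ.+-*-semiring using (sum; sum-cong-≗; ∑-distrib-+; ∑-comm; sum-permute; *-distribˡ-sum; sum-replicate-zero)
import Data.Nat.Coprimality as Coprimality
open import Data.Rational.Base as ℚ using (ℚ; 0ℚ; 1ℚ; mkℚ; ↥_; ↧_)
import Data.Rational.Properties as ℚ
open import Data.Rational.Unnormalised.Base using (*≡*)
import Data.Rational.Unnormalised.Properties as ℚᵘ
import Data.Rational.Solver as ℚ-Solver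
import Data.Bool.Properties as Bool
open import Data.Fin.Subset.Properties using (∣p∣≤n)
open import Data.Nat.Divisibility using (_∣_; divides; ∣-trans; n∣m⇒m%n≡0)
import Data.Nat.Properties as ℕ
open import Data.Nat.DivMod using (_%_; [m+kn]%n≡m%n; _mod_; [m+n]%n≡m%n; m<n⇒m%n≡m; %-distribˡ-+; _/_; m≡m%n+[m/n]*n; m%n<n; m∣n⇒o%n%m≡o%m)
import Data.Nat.Tactic.RingSolver as ℕ-Solver
open import Data.Sum.Base using (_⊎_; inj₁; inj₂; [_,_]′)
open import Algebra.Bundles using (Group; AbelianGroup)
open import Algebra.Structures using (IsAbelianGroup)
open import Data.Vec.Properties using ([]=⇒lookup; lookup⇒[]=; lookup∘tabulate)
import Algebra.Properties.Group as GroupProperties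
import Algebra.Properties.AbelianGroup as AbelianGroupProperties
open import Level using (0ℓ)
open import Data.Vec.Functional using () renaming (_∷_ to _∷ᶠ_)
open import Data.List.Base using (List; []; _∷_; foldr; length)
open import Data.List.Membership.Propositional using () renaming (_∈_ to _∈ₗ_)
open import Data.List.Relation.Unary.Any using (here; there)
import Data.Vec.Base as Vec
open import Data.Unit.Base using (tt)
open import Relation.Unary using (∅; _≐_)

-- The common part of R and T must have any prescribed size, so nothing is known about its Fourier
-- coefficients and the injectivity proofs must not depend on them. Parity achieves this: the common
-- part enters with a factor 2 and disappears modulo 2, while its total or alternating total only
-- has to avoid one value, which its size ensures. A solution shown to be even can be halved and
-- solves the same equation; being periodic, hence bounded, it vanishes. Therefore everything runs
-- over ℤ, although nut graphs are defined over ℚ. With S the shift, the pairs ±3 and ±1 in R and T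
-- are chosen because S³ + S⁻³ ± (S + S⁻¹) = S⁻³ (1 ± S²)(1 ± S⁴). On an odd cycle S is a power of
-- S⁴, so a sequence killed by this product is constant, exactly for the minus sign and modulo 2 for
-- the plus sign. If 4 ∣ m, no such conclusion is possible even on period m/2: modulo 2 the operator
-- 1 + S is nilpotent on sequences whose period is a power of 2. There the factor 2 comes from the
-- invariance of R under translation by m/2.

private variable m n : ℕ

-- Sums over decidable subsets

on : Bool → ℤ → ℤ
on b z = if b then z else 0ℤ

∑[_] : (Fin n → Bool) → (Fin n → ℤ) → ℤ
∑[ W ] f = sum (λ i → on (W i) (f i))

on-0 : ∀ b → on b 0ℤ ≡ 0ℤ
on-0 true  = refl
on-0 false = refl

on-+ : ∀ b x y → on b (x + y) ≡ on b x + on b y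
on-+ true  x y = refl
on-+ false x y = refl

on-*ˡ : ∀ b c x → on b (c * x) ≡ c * on b x
on-*ˡ true  c x = refl
on-*ˡ false c x = sym (ℤ.*-zeroʳ c)

on-* : ∀ b x → on b x ≡ on b 1ℤ * x
on-* true  x = sym (ℤ.*-identityˡ x)
on-* false x = refl

∑-cong : ∀ {V W : Fin n → Bool} {f g} → V ≗ W → f ≗ g → ∑[ V ] f ≡ ∑[ W ] g
∑-cong V≗W f≗g = sum-cong-≗ λ i → cong₂ on (V≗W i) (f≗g i)

∑-congʳ : ∀ (W : Fin n → Bool) {f g} → f ≗ g → ∑[ W ] f ≡ ∑[ W ] g
∑-congʳ W = ∑-cong {V = W} λ _ → refl

∑-+ : ∀ (W : Fin n → Bool) f g → ∑[ W ] (λ i → f i + g i) ≡ ∑[ W ] f + ∑[ W ] g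
∑-+ W f g = trans (sum-cong-≗ λ i → on-+ (W i) (f i) (g i))
  (∑-distrib-+ (λ i → on (W i) (f i)) (λ i → on (W i) (g i)))

∑-*ˡ : ∀ (W : Fin n → Bool) c f → ∑[ W ] (λ i → c * f i) ≡ c * ∑[ W ] f
∑-*ˡ W c f = trans (sum-cong-≗ λ i → on-*ˡ (W i) c (f i))
  (sym (*-distribˡ-sum c (λ i → on (W i) (f i))))

∑-neg : ∀ (W : Fin n → Bool) f → ∑[ W ] (λ i → - f i) ≡ - ∑[ W ] f
∑-neg W f = begin
  ∑[ W ] (λ i → - f i) ≡⟨ ∑-congʳ W (λ i → sym (ℤ.-1*i≡-i (f i))) ⟩
  ∑[ W ] (λ i → ℤ.-1ℤ * f i) ≡⟨ ∑-*ˡ W ℤ.-1ℤ f ⟩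
  ℤ.-1ℤ * ∑[ W ] f ≡⟨ ℤ.-1*i≡-i _ ⟩
  - ∑[ W ] f ∎
  where open ≡-Reasoning

sum-0 : ∀ {f : Fin n → ℤ} → (∀ i → f i ≡ 0ℤ) → sum f ≡ 0ℤ
sum-0 {n} f≗0 = trans (sum-cong-≗ f≗0) (sum-replicate-zero n)

sum-↑ : ∀ m (f : Fin (m ℕ.+ n) → ℤ) → sum f ≡ sum (λ i → f (i ↑ˡ n)) + sum (λ j → f (m ↑ʳ j))
sum-↑ zero    f = sym (ℤ.+-identityˡ _)
sum-↑ (suc m) f = trans (cong (f zero +_) (sum-↑ m (f ∘ suc))) (sym (ℤ.+-assoc (f zero) _ _))

-- Goes through `tabulate` so that `count (adj G v)` is `degree G v` by definition.
count : (Fin n → Bool) → ℕ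
count W = Subset.∣ tabulate W ∣

+count : ∀ (W : Fin n → Bool) → pos (count W) ≡ ∑[ W ] (λ _ → 1ℤ)
+count {zero}  W = refl
+count {suc n} W with W zero
... | true  = cong (1ℤ +_) (+count (W ∘ suc))
... | false = trans (+count (W ∘ suc)) (sym (ℤ.+-identityˡ _))

∑-const : ∀ (W : Fin n → Bool) c → ∑[ W ] (λ _ → c) ≡ pos (count W) * c
∑-const W c = begin
  ∑[ W ] (λ _ → c) ≡⟨ ∑-congʳ W (λ _ → sym (ℤ.*-identityʳ c)) ⟩
  ∑[ W ] (λ _ → c * 1ℤ) ≡⟨ ∑-*ˡ W c _ ⟩
  c * ∑[ W ] (λ _ → 1ℤ) ≡⟨ cong (c *_) (+count W) ⟨
  c * pos (count W) ≡⟨ ℤ.*-comm c _ ⟩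
  pos (count W) * c ∎
  where open ≡-Reasoning

∑-permute : ∀ (W : Fin n → Bool) f (π : Permutation m n) →
  ∑[ W ] f ≡ ∑[ (λ i → W (π ⟨$⟩ʳ i)) ] (λ i → f (π ⟨$⟩ʳ i))
∑-permute W f π = sum-permute (λ i → on (W i) (f i)) π

count-cong : ∀ {V W : Fin n → Bool} → V ≗ W → count V ≡ count W
count-cong {V = V} {W} V≗W = ℤ.+-injective $
  trans (+count V) (trans (∑-cong V≗W λ _ → refl) (sym (+count W)))

∅ₛ : Fin n → Bool
∅ₛ _ = false

infixr 5 _⊕_
infixl 5 _⊖_

_≡ᵇ_ : Fin n → Fin n → Bool
x ≡ᵇ i = does (x Fin.≟ i)

≡ᵇ-refl : ∀ (x : Fin n) → (x ≡ᵇ x) ≡ true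
≡ᵇ-refl x = dec-true (x Fin.≟ x) refl

≡ᵇ-≢ : ∀ {x y : Fin n} → x ≢ y → (x ≡ᵇ y) ≡ false
≡ᵇ-≢ {x = x} {y} = dec-false (x Fin.≟ y)

_⊕_ : Fin n → (Fin n → Bool) → (Fin n → Bool)
(x ⊕ W) i = (x ≡ᵇ i) ∨ W i

_⊖_ : (Fin n → Bool) → Fin n → (Fin n → Bool)
(W ⊖ x) i = not (x ≡ᵇ i) ∧ W i

sum-≡ᵇ : ∀ (x : Fin n) (f : Fin n → ℤ) → sum (λ i → on (x ≡ᵇ i) (f i)) ≡ f x
sum-≡ᵇ zero    f = trans (cong (f zero +_) (sum-0 {f = λ i → on (zero ≡ᵇ suc i) (f (suc i))} λ _ → refl)) (ℤ.+-identityʳ _)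
sum-≡ᵇ (suc x) f = trans (ℤ.+-identityˡ _) (sum-≡ᵇ x (f ∘ suc))

∑-⊕ : ∀ x (W : Fin n → Bool) f → W x ≡ false → ∑[ x ⊕ W ] f ≡ f x + ∑[ W ] f
∑-⊕ x W f x∉W = begin
  ∑[ x ⊕ W ] f ≡⟨ sum-cong-≗ pointwise ⟩
  sum (λ i → on (x ≡ᵇ i) (f i) + on (W i) (f i)) ≡⟨ ∑-distrib-+ (λ i → on (x ≡ᵇ i) (f i)) _ ⟩
  sum (λ i → on (x ≡ᵇ i) (f i)) + ∑[ W ] f ≡⟨ cong (_+ ∑[ W ] f) (sum-≡ᵇ x f) ⟩
  f x + ∑[ W ] f ∎
  where
  open ≡-Reasoning
  pointwise : ∀ i → on ((x ⊕ W) i) (f i) ≡ on (x ≡ᵇ i) (f i) + on (W i) (f i)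
  pointwise i with x Fin.≟ i
  ... | yes refl rewrite x∉W = sym (ℤ.+-identityʳ _)
  ... | no  _    = sym (ℤ.+-identityˡ _)

∑-⊖ : ∀ x (W : Fin n → Bool) f → W x ≡ true → f x + ∑[ W ⊖ x ] f ≡ ∑[ W ] f
∑-⊖ x W f x∈W = begin
  f x + ∑[ W ⊖ x ] f ≡⟨ ∑-⊕ x (W ⊖ x) f x∉ ⟨
  ∑[ x ⊕ (W ⊖ x) ] f ≡⟨ ∑-cong {V = x ⊕ (W ⊖ x)} pointwise (λ _ → refl) ⟩
  ∑[ W ] f ∎
  where
  open ≡-Reasoning
  x∉ : (W ⊖ x) x ≡ false
  x∉ rewrite ≡ᵇ-refl x = refl
  pointwise : x ⊕ (W ⊖ x) ≗ W
  pointwise i with x Fin.≟ i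
  ... | yes refl = sym x∈W
  ... | no  _    = refl

count-⊕ : ∀ x (W : Fin n → Bool) → W x ≡ false → count (x ⊕ W) ≡ suc (count W)
count-⊕ x W x∉W = ℤ.+-injective $
  trans (+count (x ⊕ W)) (trans (∑-⊕ x W _ x∉W) (cong (1ℤ +_) (sym (+count W))))

count-⊖ : ∀ x (W : Fin n → Bool) → W x ≡ true → suc (count (W ⊖ x)) ≡ count W
count-⊖ x W x∈W = ℤ.+-injective $
  trans (cong (1ℤ +_) (+count (W ⊖ x))) (trans (∑-⊖ x W _ x∈W) (sym (+count W)))

-- Nut graphs over the integers

Kernel : Graph n → (Fin n → ℤ) → Set
Kernel G Y = ∀ i → ∑[ adj G i ] Y ≡ 0ℤ

-- Clearing denominators loses nothing, and expressing one-dimensionality by cross-multiplication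
-- avoids division.
record Nutℤ (G : Graph n) : Set where
  field
    2≤n       : 2 ≤ n
    vector    : Fin n → ℤ
    in-kernel : Kernel G vector
    nonzero   : ∀ i → vector i ≢ 0ℤ
    spans     : ∀ Y → Kernel G Y → ∀ i j → Y i * vector j ≡ Y j * vector i

-- Built directly with denominator 1, without a normalising division, so that injectivity is `cong`
-- of the numerator.
ι : ℤ → ℚ
ι z = mkℚ z 0 (Coprimality.sym (Coprimality.1-coprimeTo _))

ι-injective : ∀ {a b} → ι a ≡ ι b → a ≡ b
ι-injective = cong ↥_

ι-+ : ∀ a b → ι (a + b) ≡ ι a ℚ.+ ι b
ι-+ a b = begin
  ι (a + b) ≡⟨ ℚ.↥p/↧p≡p (ι (a + b)) ⟨
  (a + b) ℚ./ 1 ≡⟨ cong (ℚ._/ 1) (cong₂ _+_ (ℤ.*-identityʳ a) (ℤ.*-identityʳ b)) ⟨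
  (a * 1ℤ + b * 1ℤ) ℚ./ 1 ∎
  where open ≡-Reasoning

ι-* : ∀ a b → ι (a * b) ≡ ι a ℚ.* ι b
ι-* a b = sym (ℚ.↥p/↧p≡p (ι (a * b)))

ι-on : ∀ b z → ι (on b z) ≡ (if b then 1ℚ else 0ℚ) ℚ.* ι z
ι-on true  z = sym (ℚ.*-identityˡ (ι z))
ι-on false z = sym (ℚ.*-zeroˡ (ι z))

ι-∑ : ∀ (W : Fin n → Bool) Y →
  ι (∑[ W ] Y) ≡ ∑ (λ j → (if W j then 1ℚ else 0ℚ) ℚ.* ι (Y j))
ι-∑ {zero}  W Y = refl
ι-∑ {suc n} W Y = trans (ι-+ (on (W zero) (Y zero)) (∑[ W ∘ suc ] (Y ∘ suc)))
  (cong₂ ℚ._+_ (ι-on (W zero) (Y zero)) (ι-∑ (W ∘ suc) (Y ∘ suc)))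

∑-cong-ℚ : ∀ {f g : Fin n → ℚ} → f ≗ g → ∑ f ≡ ∑ g
∑-cong-ℚ {zero}  f≗g = refl
∑-cong-ℚ {suc n} f≗g = cong₂ ℚ._+_ (f≗g zero) (∑-cong-ℚ (f≗g ∘ suc))

∑-*ˡ-ℚ : ∀ c (f : Fin n → ℚ) → ∑ (λ i → c ℚ.* f i) ≡ c ℚ.* ∑ f
∑-*ˡ-ℚ {zero}  c f = sym (ℚ.*-zeroʳ c)
∑-*ˡ-ℚ {suc n} c f = trans (cong (c ℚ.* f zero ℚ.+_) (∑-*ˡ-ℚ c (f ∘ suc)))
  (sym (ℚ.*-distribˡ-+ c _ _))

*-assoc-comm : ∀ a b c → a ℚ.* (b ℚ.* c) ≡ b ℚ.* (a ℚ.* c)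
*-assoc-comm = solve 3 (λ a b c → a :* (b :* c) := b :* (a :* c)) refl
  where open ℚ-Solver.+-*-Solver

*-cancelˡ-≢0 : ∀ {a b c} → a ≢ 0ℚ → a ℚ.* b ≡ a ℚ.* c → b ≡ c
*-cancelˡ-≢0 {a} {b} {c} a≢0 eq = begin
  b ≡⟨ cancel b ⟨
  ℚ.1/ a ℚ.* (a ℚ.* b) ≡⟨ cong (ℚ.1/ a ℚ.*_) eq ⟩
  ℚ.1/ a ℚ.* (a ℚ.* c) ≡⟨ cancel c ⟩
  c ∎
  where
  open ≡-Reasoning
  instance _ = ℚ.≢-nonZero a≢0
  cancel : ∀ d → ℚ.1/ a ℚ.* (a ℚ.* d) ≡ d
  cancel d = trans (sym (ℚ.*-assoc (ℚ.1/ a) a d))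
    (trans (cong (ℚ._* d) (ℚ.*-inverseˡ a)) (ℚ.*-identityˡ d))

*≢0 : ∀ {a b} → a ≢ 0ℚ → b ≢ 0ℚ → a ℚ.* b ≢ 0ℚ
*≢0 {a} a≢0 b≢0 ab≡0 = b≢0 (*-cancelˡ-≢0 a≢0 (trans ab≡0 (sym (ℚ.*-zeroʳ a))))

ι≢0 : ∀ {a} → a ≢ 0ℤ → ι a ≢ 0ℚ
ι≢0 a≢0 = a≢0 ∘ ι-injective

↧-*-≡-↥ : ∀ q → ι (↧ q) ℚ.* q ≡ ι (↥ q)
↧-*-≡-↥ q@record{} = ℚ.toℚᵘ-injective
  (ℚᵘ.≃-trans (ℚ.toℚᵘ-homo-* (ι (↧ q)) q) (*≡* (identity (↧ q) (↥ q))))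
  where
  identity : ∀ d n → (d * n) * 1ℤ ≡ n * (1ℤ * d)
  identity = solve-∀

record Cleared (y : Fin n → ℚ) : Set where
  field
    factor  : ℤ
    factor≢0 : factor ≢ 0ℤ
    integral : Fin n → ℤ
    clears   : ∀ i → ι (integral i) ≡ ι factor ℚ.* y i

-- The factor is the product of all denominators; any nonzero common multiple would do.
clear : (y : Fin n → ℚ) → Cleared y
clear {zero}  y = record { factor = 1ℤ ; factor≢0 = λ () ; integral = λ () ; clears = λ () }
clear {suc n} y = record
  { factor   = d * factor
  ; factor≢0 = λ eq → ι≢0 factor≢0 $ *-cancelˡ-≢0 {ι d} (ι≢0 λ ())
      (trans (trans (sym (ι-* d factor)) (cong ι eq)) (sym (ℚ.*-zeroʳ (ι d))))
  ; integral = λ { zero → factor * ↥ (y zero) ; (suc i) → d * integral i }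
  ; clears   = λ
      { zero → begin
          ι (factor * ↥ (y zero)) ≡⟨ ι-* factor _ ⟩
          ι factor ℚ.* ι (↥ (y zero)) ≡⟨ cong (ι factor ℚ.*_) (↧-*-≡-↥ (y zero)) ⟨
          ι factor ℚ.* (ι d ℚ.* y zero) ≡⟨ *-assoc-comm (ι factor) (ι d) (y zero) ⟩
          ι d ℚ.* (ι factor ℚ.* y zero) ≡⟨ ℚ.*-assoc (ι d) (ι factor) (y zero) ⟨
          (ι d ℚ.* ι factor) ℚ.* y zero ≡⟨ cong (ℚ._* y zero) (ι-* d factor) ⟨
          ι (d * factor) ℚ.* y zero ∎
      ; (suc i) → begin
          ι (d * integral i) ≡⟨ ι-* d _ ⟩
          ι d ℚ.* ι (integral i) ≡⟨ cong (ι d ℚ.*_) (clears i) ⟩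
          ι d ℚ.* (ι factor ℚ.* y (suc i)) ≡⟨ ℚ.*-assoc (ι d) (ι factor) (y (suc i)) ⟨
          (ι d ℚ.* ι factor) ℚ.* y (suc i) ≡⟨ cong (ℚ._* y (suc i)) (ι-* d factor) ⟨
          ι (d * factor) ℚ.* y (suc i) ∎
      }
  }
  where
  open ≡-Reasoning
  open Cleared (clear (y ∘ suc))
  d = ↧ (y zero)

module _ (G : Graph n) where
  private A = adjacencyMatrix G

  Kernel⇒InEigenspace : ∀ {Y} → Kernel G Y → InEigenspace A 0ℚ (ι ∘ Y)
  Kernel⇒InEigenspace {Y} Y∈ker i =
    trans (sym (ι-∑ (adj G i) Y)) (trans (cong ι (Y∈ker i)) (sym (ℚ.*-zeroˡ (ι (Y i)))))

  InEigenspace⇒Kernel : ∀ {y} → InEigenspace A 0ℚ y → Kernel G (Cleared.integral (clear y))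
  InEigenspace⇒Kernel {y} y∈ker i = ι-injective $ begin
    ι (∑[ adj G i ] integral) ≡⟨ ι-∑ (adj G i) integral ⟩
    ∑ (λ j → A i j ℚ.* ι (integral j)) ≡⟨ ∑-cong-ℚ (λ j → cong (A i j ℚ.*_) (clears j)) ⟩
    ∑ (λ j → A i j ℚ.* (ι factor ℚ.* y j)) ≡⟨ ∑-cong-ℚ (λ j → *-assoc-comm (A i j) (ι factor) (y j)) ⟩
    ∑ (λ j → ι factor ℚ.* (A i j ℚ.* y j)) ≡⟨ ∑-*ˡ-ℚ (ι factor) (λ j → A i j ℚ.* y j) ⟩
    ι factor ℚ.* (A *ᵥ y) i ≡⟨ cong (ι factor ℚ.*_) (trans (y∈ker i) (ℚ.*-zeroˡ (y i))) ⟩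
    ι factor ℚ.* 0ℚ ≡⟨ ℚ.*-zeroʳ (ι factor) ⟩
    0ℚ ∎
    where
    open ≡-Reasoning
    open Cleared (clear y)

first : 2 ≤ n → Fin n
first (s≤s _) = zero

Nut⇒Nutℤ : {G : Graph n} → Nut G → Nutℤ G
Nut⇒Nutℤ {G = G} (2≤n , x , (x∈ker , _) , spans , x≢0) = record
  { 2≤n       = 2≤n
  ; vector    = integral
  ; in-kernel = InEigenspace⇒Kernel G x∈ker
  ; nonzero   = λ i X≡0 → *≢0 (ι≢0 factor≢0) (x≢0 i) (trans (sym (clears i)) (cong ι X≡0))
  ; spans     = cross
  }
  where
  open Cleared (clear x)
  cross : ∀ Y → Kernel G Y → ∀ i j → Y i * integral j ≡ Y j * integral i
  cross Y Y∈ker i j with spans (ι ∘ Y) (Kernel⇒InEigenspace G Y∈ker)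
  ... | c , Y≡cx = ι-injective $ begin
    ι (Y i * integral j) ≡⟨ ι-* (Y i) _ ⟩
    ι (Y i) ℚ.* ι (integral j) ≡⟨ cong₂ ℚ._*_ (Y≡cx i) (clears j) ⟩
    c ℚ.* x i ℚ.* (ι factor ℚ.* x j) ≡⟨ exchange c (x i) (ι factor) (x j) ⟩
    c ℚ.* x j ℚ.* (ι factor ℚ.* x i) ≡⟨ cong₂ ℚ._*_ (Y≡cx j) (clears i) ⟨
    ι (Y j) ℚ.* ι (integral i) ≡⟨ ι-* (Y j) _ ⟨
    ι (Y j * integral i) ∎
    where
    open ≡-Reasoning
    exchange : ∀ c a f b → c ℚ.* a ℚ.* (f ℚ.* b) ≡ c ℚ.* b ℚ.* (f ℚ.* a)
    exchange = solve 4 (λ c a f b → c :* a :* (f :* b) := c :* b :* (f :* a)) refl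
      where open ℚ-Solver.+-*-Solver

-- The coefficient of a rational kernel vector is read off at the vertex `o`. That it fits elsewhere
-- follows by applying `spans` to the cleared vector and cancelling the factor.
Nutℤ⇒Nut : {G : Graph n} → Nutℤ G → Nut G
Nutℤ⇒Nut {n} {G} N = 2≤n , x , (Kernel⇒InEigenspace G in-kernel , o , x≢0 o) , span , x≢0
  where
  open Nutℤ N
  o = first 2≤n
  x : Fin n → ℚ
  x = ι ∘ vector
  x≢0 : ∀ i → x i ≢ 0ℚ
  x≢0 i = ι≢0 (nonzero i)
  span : SpansEigenspace (adjacencyMatrix G) 0ℚ x
  span y y∈ker = y o ℚ.* ℚ.1/ x o , λ i → *-cancelˡ-≢0 (x≢0 o) (sym (begin
    x o ℚ.* (y o ℚ.* ℚ.1/ x o ℚ.* x i) ≡⟨ regroup (x o) (y o) (ℚ.1/ x o) (x i) ⟩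
    (x o ℚ.* ℚ.1/ x o) ℚ.* (y o ℚ.* x i) ≡⟨ cong (ℚ._* (y o ℚ.* x i)) (ℚ.*-inverseʳ (x o)) ⟩
    1ℚ ℚ.* (y o ℚ.* x i) ≡⟨ ℚ.*-identityˡ _ ⟩
    y o ℚ.* x i ≡⟨ y-cross i ⟨
    y i ℚ.* x o ≡⟨ ℚ.*-comm (y i) (x o) ⟩
    x o ℚ.* y i ∎))
    where
    open ≡-Reasoning
    open Cleared (clear y)
    instance _ = ℚ.≢-nonZero (x≢0 o)
    regroup : ∀ a b c d → a ℚ.* (b ℚ.* c ℚ.* d) ≡ (a ℚ.* c) ℚ.* (b ℚ.* d)
    regroup = solve 4 (λ a b c d → a :* (b :* c :* d) := (a :* c) :* (b :* d)) refl
      where open ℚ-Solver.+-*-Solver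
    scaled : ∀ i j → ι (integral i * vector j) ≡ ι factor ℚ.* (y i ℚ.* x j)
    scaled i j = trans (ι-* (integral i) (vector j))
      (trans (cong (ℚ._* x j) (clears i)) (ℚ.*-assoc (ι factor) (y i) (x j)))
    y-cross : ∀ i → y i ℚ.* x o ≡ y o ℚ.* x i
    y-cross i = *-cancelˡ-≢0 (ι≢0 factor≢0)
      (trans (sym (scaled i o))
        (trans (cong ι (spans integral (InEigenspace⇒Kernel G y∈ker) i o)) (scaled o i)))

-- Counting and double counting

count≡0⇒∉ : ∀ (W : Fin n → Bool) → count W ≡ 0 → ∀ x → W x ≡ false
count≡0⇒∉ W none x with W x in x∈W
... | false = refl
... | true  = contradiction (trans (count-⊖ x W x∈W) none) λ ()

count≢0⇒∃ : ∀ (W : Fin n → Bool) → 1 ≤ count W → ∃[ x ] W x ≡ true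
count≢0⇒∃ {suc n} W some with W zero in 0∈W
... | true  = zero , 0∈W
... | false = let (x , x∈W) = count≢0⇒∃ (W ∘ suc) some in suc x , x∈W

record Unique (W : Fin n → Bool) : Set where
  field
    element   : Fin n
    member    : W element ≡ true
    uniqueness : ∀ {u} → W u ≡ true → u ≡ element

count≡1⇒Unique : ∀ (W : Fin n → Bool) → count W ≡ 1 → Unique W
count≡1⇒Unique W one = record { element = x ; member = x∈W ; uniqueness = unique }
  where
  x,x∈W = count≢0⇒∃ W (ℕ.≤-reflexive (sym one))
  x = proj₁ x,x∈W
  x∈W = proj₂ x,x∈W
  unique : ∀ {u} → W u ≡ true → u ≡ x
  unique {u} u∈W with x Fin.≟ u | count≡0⇒∉ (W ⊖ x) (ℕ.suc-injective (trans (count-⊖ x W x∈W) one)) u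
  ... | yes x≡u | _   = sym x≡u
  ... | no  _   | u∉W = contradiction (trans (sym u∈W) u∉W) λ ()

count-≤ : ∀ (W : Fin n → Bool) → count W ≤ n
count-≤ W = ∣p∣≤n (tabulate W)

sum-1 : ∀ n → sum {n} (λ _ → 1ℤ) ≡ pos n
sum-1 zero    = refl
sum-1 (suc n) = cong (1ℤ +_) (sum-1 n)

count-not : ∀ (W : Fin n → Bool) → count W ℕ.+ count (not ∘ W) ≡ n
count-not {n} W = ℤ.+-injective $ begin
  pos (count W) + pos (count (not ∘ W)) ≡⟨ cong₂ _+_ (+count W) (+count (not ∘ W)) ⟩
  ∑[ W ] (λ _ → 1ℤ) + ∑[ not ∘ W ] (λ _ → 1ℤ) ≡⟨ ∑-distrib-+ (λ i → on (W i) 1ℤ) _ ⟨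
  sum (λ i → on (W i) 1ℤ + on (not (W i)) 1ℤ) ≡⟨ sum-cong-≗ (λ i → total (W i)) ⟩
  sum {n} (λ _ → 1ℤ) ≡⟨ sum-1 n ⟩
  pos n ∎
  where
  open ≡-Reasoning
  total : ∀ b → on b 1ℤ + on (not b) 1ℤ ≡ 1ℤ
  total true  = refl
  total false = refl

-- `N` dominates every single square, so a vanishing sum of squares forces every entry to vanish.
sum-squares : ∀ (f : Fin n → ℤ) → ∃[ N ] sum (λ i → f i * f i) ≡ pos N × (∀ i → ℤ.∣ f i ∣ ℕ.* ℤ.∣ f i ∣ ≤ N)
sum-squares {zero}  f = 0 , refl , λ ()
sum-squares {suc n} f with sum-squares (f ∘ suc)
... | N , sum≡N , ≤N = ℤ.∣ f zero ∣ ℕ.* ℤ.∣ f zero ∣ ℕ.+ N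
  , cong₂ _+_ (square (f zero)) sum≡N
  , λ { zero → ℕ.m≤m+n _ N ; (suc i) → ℕ.≤-trans (≤N i) (ℕ.m≤n+m N _) }
  where
  square : ∀ z → z * z ≡ pos (ℤ.∣ z ∣ ℕ.* ℤ.∣ z ∣)
  square (pos n)    = sym (ℤ.pos-* n n)
  square ℤ.-[1+ n ] = refl

sum-*ˡ : ∀ c (f : Fin n → ℤ) → sum (λ i → c * f i) ≡ c * sum f
sum-*ˡ c f = sym (*-distribˡ-sum c f)

-- Induction on the size: the first row and the first column contribute equal amounts, their common
-- diagonal entry nothing.
handshake : ∀ (a : Fin n → Fin n → ℤ) → (∀ i j → a i j ≡ a j i) → (∀ i → a i i ≡ 0ℤ) →
  ∃[ H ] sum (λ i → sum (a i)) ≡ pos 2 * H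
handshake {zero}  a a-sym a-diag = 0ℤ , refl
handshake {suc n} a a-sym a-diag with handshake (λ i j → a (suc i) (suc j)) (λ i j → a-sym _ _) (λ i → a-diag _)
... | H , rest≡2H = row + H , (begin
  (a zero zero + row) + sum (λ i → a (suc i) zero + sum (λ j → a (suc i) (suc j)))
    ≡⟨ cong₂ _+_ (cong (_+ row) (a-diag zero))
         (trans (∑-distrib-+ (λ i → a (suc i) zero) (λ i → sum (λ j → a (suc i) (suc j))))
           (cong₂ _+_ (sum-cong-≗ λ i → a-sym (suc i) zero) rest≡2H)) ⟩
  (0ℤ + row) + (row + pos 2 * H)
    ≡⟨ double row H ⟩
  pos 2 * (row + H) ∎)
  where
  open ≡-Reasoning
  row = sum (λ j → a zero (suc j))
  double : ∀ r H → (0ℤ + r) + (r + pos 2 * H) ≡ pos 2 * (r + H)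
  double = solve-∀

*-cancelʳ-≢0 : ∀ {a b c} → c ≢ 0ℤ → a * c ≡ b * c → a ≡ b
*-cancelʳ-≢0 {a} {b} {c} c≢0 = ℤ.*-cancelʳ-≡ a b c {{ℤ.≢-nonZero c≢0}}

-- Vertex-transitive nut graphs

sgn : Bool → ℤ
sgn b = 1ℤ - pos 2 * on b 1ℤ

sgn≢0 : ∀ b → sgn b ≢ 0ℤ
sgn≢0 true  ()
sgn≢0 false ()

module _ {G : Graph n} (vt : VertexTransitive G) (nut : Nutℤ G) where
  open Nutℤ nut

  -- Squaring the proportionality between `X ∘ π` and `X` and summing over all vertices leaves the
  -- same nonzero `S` on both sides, since `π` only permutes its terms.
  squares-equal : ∀ u v → vector v * vector v ≡ vector u * vector u
  squares-equal u v with vt u v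
  ... | π , π-aut , refl = *-cancelʳ-≢0 S≢0 $ begin
    X (π ⟨$⟩ʳ u) * X (π ⟨$⟩ʳ u) * S
      ≡⟨ sum-*ˡ (X (π ⟨$⟩ʳ u) * X (π ⟨$⟩ʳ u)) (λ i → X i * X i) ⟨
    sum (λ i → X (π ⟨$⟩ʳ u) * X (π ⟨$⟩ʳ u) * (X i * X i))
      ≡⟨ sum-cong-≗ (λ i → pointwise i) ⟩
    sum (λ i → X u * X u * (X (π ⟨$⟩ʳ i) * X (π ⟨$⟩ʳ i)))
      ≡⟨ sum-*ˡ (X u * X u) (λ i → X (π ⟨$⟩ʳ i) * X (π ⟨$⟩ʳ i)) ⟩
    X u * X u * sum (λ i → X (π ⟨$⟩ʳ i) * X (π ⟨$⟩ʳ i))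
      ≡⟨ cong (X u * X u *_) (sum-permute (λ i → X i * X i) π) ⟨
    X u * X u * S ∎
    where
    open ≡-Reasoning
    X = vector
    S = sum (λ i → X i * X i)
    S≢0 : S ≢ 0ℤ
    S≢0 S≡0 with sum-squares X
    ... | N , S≡N , ≤N = nonzero u $ ℤ.∣i∣≡0⇒i≡0 $ square≡0 $ ℕ.n≤0⇒n≡0 $
      ℕ.≤-trans (≤N u) (ℕ.≤-reflexive (ℤ.+-injective (trans (sym S≡N) S≡0)))
      where
      square≡0 : ∀ {k} → k ℕ.* k ≡ 0 → k ≡ 0
      square≡0 {zero} _ = refl
    π-kernel : Kernel G (X ∘ (π ⟨$⟩ʳ_))
    π-kernel i = trans (∑-cong {W = λ j → adj G (π ⟨$⟩ʳ i) (π ⟨$⟩ʳ j)} (λ j → sym (π-aut i j)) λ _ → refl)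
      (trans (sym (∑-permute (adj G (π ⟨$⟩ʳ i)) X π)) (in-kernel (π ⟨$⟩ʳ i)))
    square-product : ∀ a b → a * a * (b * b) ≡ (a * b) * (a * b)
    square-product = solve-∀
    square-product′ : ∀ a b → (a * b) * (a * b) ≡ b * b * (a * a)
    square-product′ = solve-∀
    pointwise : ∀ i → X (π ⟨$⟩ʳ u) * X (π ⟨$⟩ʳ u) * (X i * X i) ≡ X u * X u * (X (π ⟨$⟩ʳ i) * X (π ⟨$⟩ʳ i))
    pointwise i = trans (square-product (X (π ⟨$⟩ʳ u)) (X i)) (trans
      (cong₂ _*_ (spans _ π-kernel u i) (spans _ π-kernel u i)) (square-product′ (X (π ⟨$⟩ʳ i)) (X u)))

  root : Fin n
  root = first 2≤n

  ±-cases : ∀ v → vector v ≡ vector root ⊎ vector v ≡ - vector root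
  ±-cases v with ℤ.i*j≡0⇒i≡0∨j≡0 (vector v - vector root) difference≡0
    where
    factor : ∀ a b → (a - b) * (a + b) ≡ a * a - b * b
    factor = solve-∀
    difference≡0 : (vector v - vector root) * (vector v + vector root) ≡ 0ℤ
    difference≡0 = trans (factor (vector v) (vector root)) (ℤ.i≡j⇒i-j≡0 (squares-equal root v))
  ... | inj₁ eq = inj₁ (ℤ.i-j≡0⇒i≡j _ _ eq)
  ... | inj₂ eq = inj₂ (ℤ.i-j≡0⇒i≡j _ _ (trans (cong (vector v +_) (ℤ.neg-involutive _)) eq))

  negative : Fin n → Bool
  negative v with ±-cases v
  ... | inj₁ _ = false
  ... | inj₂ _ = true

  signs : Fin n → ℤ
  signs v = sgn (negative v)

  signs-scale : ∀ v → vector v ≡ signs v * vector root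
  signs-scale v with ±-cases v
  ... | inj₁ eq = trans eq (sym (ℤ.*-identityˡ _))
  ... | inj₂ eq = trans eq (sym (ℤ.-1*i≡-i _))

  sign-nut : Nutℤ G
  sign-nut = record
    { 2≤n       = 2≤n
    ; vector    = signs
    ; in-kernel = λ i → *-cancelʳ-≢0 (nonzero root) (begin
        ∑[ adj G i ] signs * vector root ≡⟨ ℤ.*-comm (∑[ adj G i ] signs) _ ⟩
        vector root * ∑[ adj G i ] signs ≡⟨ ∑-*ˡ (adj G i) (vector root) signs ⟨
        ∑[ adj G i ] (λ j → vector root * signs j) ≡⟨ ∑-congʳ (adj G i) (λ j → trans (signs-scale j) (ℤ.*-comm (signs j) _)) ⟨
        ∑[ adj G i ] vector ≡⟨ in-kernel i ⟩
        0ℤ ∎)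
    ; nonzero   = λ i → sgn≢0 (negative i)
    ; spans     = λ Y Y∈ker i j → *-cancelʳ-≢0 (nonzero root) (begin
        Y i * signs j * vector root ≡⟨ ℤ.*-assoc (Y i) _ _ ⟩
        Y i * (signs j * vector root) ≡⟨ cong (Y i *_) (signs-scale j) ⟨
        Y i * vector j ≡⟨ spans Y Y∈ker i j ⟩
        Y j * vector i ≡⟨ cong (Y j *_) (signs-scale i) ⟩
        Y j * (signs i * vector root) ≡⟨ ℤ.*-assoc (Y j) _ _ ⟨
        Y j * signs i * vector root ∎)
    }
    where open ≡-Reasoning

∣-even : ∀ {x y} → pos x ≡ pos 2 * y → x ≡ 2 ℕ.* ℤ.∣ y ∣
∣-even {x} {y} eq = trans (cong ℤ.∣_∣ eq) (ℤ.abs-* (pos 2) y)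

module _ {G : Graph n} {d : ℕ} (reg : Regular d G) (negative : Fin n → Bool)
  (kernel : Kernel G (sgn ∘ negative)) where
  private
    minus : Fin n → ℤ
    minus v = on (negative v) 1ℤ

  -- Write 1 as the sign plus twice `minus` and sum over the neighbours of `v`; the signs cancel by
  -- the kernel equation.
  negative-neighbours : ∀ v → pos d ≡ pos 2 * ∑[ adj G v ] minus
  negative-neighbours v = begin
    pos d ≡⟨ cong pos (reg v) ⟨
    pos (count (adj G v)) ≡⟨ +count (adj G v) ⟩
    ∑[ adj G v ] (λ _ → 1ℤ) ≡⟨ ∑-congʳ (adj G v) (λ u → split (minus u)) ⟩
    ∑[ adj G v ] (λ u → sgn (negative u) + pos 2 * minus u) ≡⟨ ∑-+ (adj G v) (sgn ∘ negative) _ ⟩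
    ∑[ adj G v ] (sgn ∘ negative) + ∑[ adj G v ] (λ u → pos 2 * minus u)
      ≡⟨ cong₂ _+_ (kernel v) (∑-*ˡ (adj G v) (pos 2) minus) ⟩
    0ℤ + pos 2 * ∑[ adj G v ] minus ≡⟨ ℤ.+-identityˡ _ ⟩
    pos 2 * ∑[ adj G v ] minus ∎
    where
    open ≡-Reasoning
    split : ∀ m → 1ℤ ≡ (1ℤ - pos 2 * m) + pos 2 * m
    split = solve-∀

  negatives : ℕ
  negatives = count negative

  halves : d ≢ 0 → n ≡ 2 ℕ.* negatives
  halves d≢0 = ℤ.+-injective $ begin
    pos n ≡⟨ sum-1 n ⟨
    sum {n} (λ _ → 1ℤ) ≡⟨ sum-cong-≗ (λ u → split (minus u)) ⟩
    sum (λ u → sgn (negative u) + pos 2 * minus u) ≡⟨ ∑-distrib-+ (sgn ∘ negative) _ ⟩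
    sum (sgn ∘ negative) + sum (λ u → pos 2 * minus u)
      ≡⟨ cong₂ _+_ balanced (sum-*ˡ (pos 2) minus) ⟩
    0ℤ + pos 2 * sum minus ≡⟨ ℤ.+-identityˡ _ ⟩
    pos 2 * sum minus ≡⟨ cong (pos 2 *_) (+count negative) ⟨
    pos 2 * pos negatives ≡⟨ ℤ.pos-* 2 negatives ⟨
    pos (2 ℕ.* negatives) ∎
    where
    open ≡-Reasoning
    split : ∀ m → 1ℤ ≡ (1ℤ - pos 2 * m) + pos 2 * m
    split = solve-∀
    s = sgn ∘ negative
    -- Adding the kernel equations of all vertices counts every sign once per neighbour, that is `d`
    -- times.
    weighted : sum s * pos d ≡ 0ℤ
    weighted = begin
      sum s * pos d ≡⟨ ℤ.*-comm (sum s) (pos d) ⟩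
      pos d * sum s ≡⟨ sum-*ˡ (pos d) s ⟨
      sum (λ u → pos d * s u) ≡⟨ sum-cong-≗ (λ u → trans (cong (λ k → pos k * s u) (sym (reg u))) (sym (∑-const (adj G u) (s u)))) ⟩
      sum (λ u → ∑[ adj G u ] (λ _ → s u)) ≡⟨ ∑-comm (λ u v → on (adj G u v) (s u)) ⟩
      sum (λ v → sum (λ u → on (adj G u v) (s u))) ≡⟨ sum-cong-≗ (λ v → sum-cong-≗ (λ u → cong (λ b → on b (s u)) (adj-sym G u v))) ⟩
      sum (λ v → ∑[ adj G v ] s) ≡⟨ sum-0 kernel ⟩
      0ℤ ∎
    balanced : sum s ≡ 0ℤ
    balanced = *-cancelʳ-≢0 (λ eq → d≢0 (ℤ.+-injective eq)) weighted

  -- Every vertex has `M` negative neighbours, so the product counts ordered pairs of adjacent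
  -- negative vertices, and these come in twos.
  handshake-parity : ∀ {M} → d ≡ 2 ℕ.* M → ∃[ H ] M ℕ.* negatives ≡ 2 ℕ.* H
  handshake-parity {M} d≡2M with handshake a a-sym a-diag
    where
    a : Fin n → Fin n → ℤ
    a u v = on (negative u) (on (adj G u v) (minus v))
    swap : ∀ b x y → on x (on b (on y 1ℤ)) ≡ on y (on b (on x 1ℤ))
    swap false true  true  = refl
    swap false true  false = refl
    swap false false true  = refl
    swap false false false = refl
    swap true  true  true  = refl
    swap true  true  false = refl
    swap true  false true  = refl
    swap true  false false = refl
    a-sym : ∀ u v → a u v ≡ a v u
    a-sym u v = trans (cong (λ b → on (negative u) (on b (minus v))) (adj-sym G u v))
      (swap (adj G v u) (negative u) (negative v))
    a-diag : ∀ v → a v v ≡ 0ℤ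
    a-diag v = trans (cong (λ b → on (negative v) (on b (minus v))) (adj-irrefl G v)) (on-0 (negative v))
  ... | H , eq = ℤ.∣ H ∣ , ∣-even (begin
    pos (M ℕ.* negatives) ≡⟨ cong pos (ℕ.*-comm M _) ⟩
    pos (negatives ℕ.* M) ≡⟨ ℤ.pos-* negatives M ⟩
    pos negatives * pos M ≡⟨ ∑-const negative (pos M) ⟨
    ∑[ negative ] (λ _ → pos M) ≡⟨ ∑-congʳ negative (λ u → M-neighbours u) ⟩
    ∑[ negative ] (λ u → ∑[ adj G u ] minus) ≡⟨ sum-cong-≗ (λ u → push (negative u) (λ v → on (adj G u v) (minus v))) ⟩
    sum (λ u → sum (λ v → on (negative u) (on (adj G u v) (minus v)))) ≡⟨ eq ⟩
    pos 2 * H ∎)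
    where
    open ≡-Reasoning
    M-neighbours : ∀ u → pos M ≡ ∑[ adj G u ] minus
    M-neighbours u = ℤ.*-cancelˡ-≡ (pos 2) _ _
      (trans (sym (ℤ.pos-* 2 M)) (trans (cong pos (sym d≡2M)) (negative-neighbours u)))
    push : ∀ b (f : Fin n → ℤ) → on b (sum f) ≡ sum (λ v → on b (f v))
    push true  f = refl
    push false f = sym (sum-replicate-zero n)

-- Edgeless graphs, twins and cocktail party graphs

∑-δ : ∀ (W : Fin n → Bool) x → ∑[ W ] (λ i → on (x ≡ᵇ i) 1ℤ) ≡ on (W x) 1ℤ
∑-δ W x = trans (sum-cong-≗ λ i → swap (W i) (x ≡ᵇ i)) (sum-≡ᵇ x (λ i → on (W i) 1ℤ))
  where
  swap : ∀ a b → on a (on b 1ℤ) ≡ on b (on a 1ℤ)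
  swap true  true  = refl
  swap true  false = refl
  swap false true  = refl
  swap false false = refl

module _ {G : Graph n} {d : ℕ} (reg : Regular d G) (nut : Nutℤ G) where
  open Nutℤ nut

  -- Without edges the indicator of one vertex lies in the kernel, yet it vanishes at a second
  -- vertex.
  degree≢0 : d ≢ 0
  degree≢0 refl = nonzero s (begin
    vector s ≡⟨ ℤ.*-identityˡ _ ⟨
    1ℤ * vector s ≡⟨ cong (λ b → on b 1ℤ * vector s) (≡ᵇ-refl o) ⟨
    δ o * vector s ≡⟨ spans δ δ-kernel o s ⟩
    δ s * vector o ≡⟨ cong (λ b → on b 1ℤ * vector o) (≡ᵇ-≢ o≢s) ⟩
    0ℤ ∎)
    where
    open ≡-Reasoning
    second : 2 ≤ n → ∃[ s ] first 2≤n ≢ s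
    second (s≤s (s≤s _)) with first 2≤n
    ... | zero  = suc zero , λ ()
    ... | suc _ = zero , λ ()
    o = first 2≤n
    s = proj₁ (second 2≤n)
    o≢s = proj₂ (second 2≤n)
    δ : Fin n → ℤ
    δ i = on (o ≡ᵇ i) 1ℤ
    δ-kernel : Kernel G δ
    δ-kernel i = trans (∑-δ (adj G i) o) (cong (λ b → on b 1ℤ) (count≡0⇒∉ (adj G i) (reg i) o))

  closed-neighbourhood : suc d ≤ n
  closed-neighbourhood = subst (λ k → suc k ≤ n) (reg o)
    (subst (_≤ n) (count-⊕ o (adj G o) (adj-irrefl G o)) (count-≤ (o ⊕ adj G o)))
    where o = first 2≤n

  -- The difference of the indicators of two twins lies in the kernel. It vanishes at any neighbour
  -- of `v`, because neither twin is a neighbour of `v`.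
  no-twins : ∀ {v v′} → v′ ≢ v → (∀ u → adj G v u ≡ adj G v′ u) → ⊥
  no-twins {v} {v′} v′≢v twins = nonzero w (begin
    vector w ≡⟨ ℤ.*-identityˡ _ ⟨
    1ℤ * vector w ≡⟨ cong (_* vector w) Yv≡1 ⟨
    Y v * vector w ≡⟨ spans Y Y-kernel v w ⟩
    Y w * vector v ≡⟨ cong (_* vector v) Yw≡0 ⟩
    0ℤ ∎)
    where
    open ≡-Reasoning
    neighbour : ∃[ w ] adj G v w ≡ true
    neighbour = count≢0⇒∃ (adj G v) (subst (1 ≤_) (sym (reg v)) (ℕ.n≢0⇒n>0 degree≢0))
    w = proj₁ neighbour
    Y : Fin n → ℤ
    Y i = on (v ≡ᵇ i) 1ℤ - on (v′ ≡ᵇ i) 1ℤ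
    Y-kernel : Kernel G Y
    Y-kernel i = begin
      ∑[ adj G i ] Y
        ≡⟨ ∑-+ (adj G i) (λ j → on (v ≡ᵇ j) 1ℤ) _ ⟩
      ∑[ adj G i ] (λ j → on (v ≡ᵇ j) 1ℤ) + ∑[ adj G i ] (λ j → - on (v′ ≡ᵇ j) 1ℤ)
        ≡⟨ cong₂ _+_ (∑-δ (adj G i) v) (trans (∑-neg (adj G i) _) (cong -_ (∑-δ (adj G i) v′))) ⟩
      on (adj G i v) 1ℤ - on (adj G i v′) 1ℤ
        ≡⟨ cong (λ b → on b 1ℤ - on (adj G i v′) 1ℤ) (trans (adj-sym G i v) (trans (twins i) (adj-sym G v′ i))) ⟩
      on (adj G i v′) 1ℤ - on (adj G i v′) 1ℤ
        ≡⟨ ℤ.+-inverseʳ (on (adj G i v′) 1ℤ) ⟩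
      0ℤ ∎
    Yv≡1 : Y v ≡ 1ℤ
    Yv≡1 = cong₂ (λ a b → on a 1ℤ - on b 1ℤ) (≡ᵇ-refl v) (≡ᵇ-≢ v′≢v)
    non-neighbour≢ : ∀ {u} → adj G v u ≡ false → u ≢ w
    non-neighbour≢ vu refl = contradiction (trans (sym (proj₂ neighbour)) vu) λ ()
    Yw≡0 : Y w ≡ 0ℤ
    Yw≡0 = cong₂ (λ a b → on a 1ℤ - on b 1ℤ) (≡ᵇ-≢ (non-neighbour≢ (adj-irrefl G v)))
      (≡ᵇ-≢ (non-neighbour≢ (trans (twins v′) (adj-irrefl G v′))))

  record Mate (u : Fin n) : Set where
    field
      mate     : Fin n
      distinct : mate ≢ u
      nonadj   : adj G u mate ≡ false
      only     : ∀ {w} → w ≢ u → adj G u w ≡ false → w ≡ mate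

  find-mate : n ≡ 2 ℕ.+ d → ∀ u → Mate u
  find-mate n≡2+d u = from-unique (count≡1⇒Unique others others-count)
    where
    others : Fin n → Bool
    others = (not ∘ adj G u) ⊖ u
    others-count : count others ≡ 1
    others-count = ℕ.suc-injective $ trans (count-⊖ u (not ∘ adj G u) (cong not (adj-irrefl G u))) $
      ℕ.+-cancelˡ-≡ d _ 2 $
        trans (trans (cong (ℕ._+ count (not ∘ adj G u)) (sym (reg u))) (count-not (adj G u)))
          (trans n≡2+d (ℕ.+-comm 2 d))
    others-elim : ∀ w → others w ≡ true → w ≢ u × adj G u w ≡ false
    others-elim w eq with u Fin.≟ w
    ... | no u≢w = (u≢w ∘ sym) , trans (sym (Bool.not-involutive _)) (cong not eq)
    others-intro : ∀ {w} → w ≢ u → adj G u w ≡ false → others w ≡ true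
    others-intro {w} w≢u uw = cong₂ (λ a b → not a ∧ not b) (≡ᵇ-≢ (w≢u ∘ sym)) uw
    from-unique : Unique others → Mate u
    from-unique U = record
      { mate     = element
      ; distinct = proj₁ (others-elim element member)
      ; nonadj   = proj₂ (others-elim element member)
      ; only     = λ w≢u uw → uniqueness (others-intro w≢u uw)
      }
      where open Unique U

  -- Otherwise G is a cocktail party graph, whose antipodal vertices are twins.
  not-cocktail-party : n ≢ 2 ℕ.+ d
  not-cocktail-party n≡2+d = no-twins (Mate.distinct (mate v)) twins
    where
    mate = find-mate n≡2+d
    v = first 2≤n
    v′ = Mate.mate (mate v)
    v′v : adj G v′ v ≡ false
    v′v = trans (adj-sym G v′ v) (Mate.nonadj (mate v))
    twins : ∀ u → adj G v u ≡ adj G v′ u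
    twins u with u Fin.≟ v
    ... | yes refl = trans (adj-irrefl G v) (sym v′v)
    ... | no u≢v with u Fin.≟ v′
    ...   | yes refl = trans (Mate.nonadj (mate v)) (sym (adj-irrefl G v′))
    ...   | no u≢v′ with adj G v u in vu | adj G v′ u in v′u
    ...     | true  | true  = refl
    ...     | false | _     = contradiction (Mate.only (mate v) u≢v vu) u≢v′
    ...     | true  | false = contradiction
      (trans (Mate.only (mate v′) u≢v′ v′u) (sym (Mate.only (mate v′) (Mate.distinct (mate v) ∘ sym) v′v))) u≢v

-- Orbits of injective maps and 2-regular graphs

iterate : (Fin n → Fin n) → ℕ → Fin n → Fin n
iterate ρ zero    v = v
iterate ρ (suc k) v = ρ (iterate ρ k v)

iterate-suc : ∀ (ρ : Fin n → Fin n) k v → iterate ρ k (ρ v) ≡ ρ (iterate ρ k v)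
iterate-suc ρ zero    v = refl
iterate-suc ρ (suc k) v = cong ρ (iterate-suc ρ k v)

iterate-+ : ∀ (ρ : Fin n → Fin n) j k v → iterate ρ (j ℕ.+ k) v ≡ iterate ρ j (iterate ρ k v)
iterate-+ ρ zero    k v = refl
iterate-+ ρ (suc j) k v = cong ρ (iterate-+ ρ j k v)

module _ (ρ : Fin n → Fin n) (ρ-injective : ∀ {u v} → ρ u ≡ ρ v → u ≡ v) where

  iterate-injective : ∀ k {u v} → iterate ρ k u ≡ iterate ρ k v → u ≡ v
  iterate-injective zero    eq = eq
  iterate-injective (suc k) eq = iterate-injective k (ρ-injective eq)

  period : ∀ v → ∃[ N ] iterate ρ (suc N) v ≡ v
  period v with Fin.pigeonhole (ℕ.n<1+n n) (λ i → iterate ρ (toℕ i) v)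
  ... | i , j , i<j , eq with ℕ.m≤n⇒∃[o]m+o≡n i<j
  ...   | N , i+N≡j = N , sym (iterate-injective (toℕ i) (begin
    iterate ρ (toℕ i) v ≡⟨ eq ⟩
    iterate ρ (toℕ j) v ≡⟨ cong (λ k → iterate ρ k v) (trans (sym i+N≡j) (sym (ℕ.+-suc (toℕ i) N))) ⟩
    iterate ρ (toℕ i ℕ.+ suc N) v ≡⟨ iterate-+ ρ (toℕ i) (suc N) v ⟩
    iterate ρ (toℕ i) (iterate ρ (suc N) v) ∎))
    where open ≡-Reasoning

  visit : Fin n → ℕ → Fin n → ℕ
  visit v k u = if iterate ρ k v ≡ᵇ u then 1 else 0

  -- The number of times k < N at which the orbit of `v` is at `u`. Multiplicities serve as an
  -- indicator of the orbit even if the return time `N` is not minimal.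
  visits : Fin n → ℕ → Fin n → ℕ
  visits v zero    u = 0
  visits v (suc N) u = visit v N u ℕ.+ visits v N u

  visit-shift : ∀ v k u → visit v (suc k) (ρ u) ≡ visit v k u
  visit-shift v k u with iterate ρ k v Fin.≟ u
  ... | yes refl = cong (if_then 1 else 0) (≡ᵇ-refl (ρ u))
  ... | no  ≢u   = cong (if_then 1 else 0) (≡ᵇ-≢ (≢u ∘ ρ-injective))

  visits-shift : ∀ v N u → visits v (suc N) (ρ u) ≡ visits v N u ℕ.+ visit v 0 (ρ u)
  visits-shift v zero    u = ℕ.+-comm _ 0
  visits-shift v (suc N) u = trans (cong₂ ℕ._+_ (visit-shift v N u) (visits-shift v N u))
    (sym (ℕ.+-assoc (visit v N u) _ _))

  -- Shifting the time window by one exchanges the visit at time 0 for the one at time `N`, and both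
  -- are at `v`.
  visits-ρ : ∀ {v N} → iterate ρ N v ≡ v → ∀ u → visits v N (ρ u) ≡ visits v N u
  visits-ρ {v} {N} closed u = ℕ.+-cancelʳ-≡ (visit v 0 (ρ u)) _ _ (begin
    visits v N (ρ u) ℕ.+ visit v 0 (ρ u) ≡⟨ ℕ.+-comm (visits v N (ρ u)) _ ⟩
    visit v 0 (ρ u) ℕ.+ visits v N (ρ u) ≡⟨ cong (λ w → (if w ≡ᵇ ρ u then 1 else 0) ℕ.+ visits v N (ρ u)) closed ⟨
    visits v (suc N) (ρ u) ≡⟨ visits-shift v N u ⟩
    visits v N u ℕ.+ visit v 0 (ρ u) ∎)
    where open ≡-Reasoning

  visits-start : ∀ v N → 1 ≤ visits v (suc N) v
  visits-start v zero    = subst (λ b → 1 ≤ (if b then 1 else 0) ℕ.+ 0) (sym (≡ᵇ-refl v)) ℕ.≤-refl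
  visits-start v (suc N) = ℕ.≤-trans (visits-start v N) (ℕ.m≤n+m _ (visit v (suc N) v))

  visits-never : ∀ v u → (∀ k → iterate ρ k v ≢ u) → ∀ N → visits v N u ≡ 0
  visits-never v u never zero    = refl
  visits-never v u never (suc N) =
    cong₂ ℕ._+_ (cong (if_then 1 else 0) (≡ᵇ-≢ (never N))) (visits-never v u never N)

-- In a 2-regular graph each vertex v has one neighbour σ v of its own sign and
-- one neighbour τ v of the other.  A kernel vector is one that changes sign under
-- ρ = τ σ, and the ρ-orbit of v does not contain σ v, so restricting the sign
-- vector to that orbit gives a second kernel vector.
module _ {G : Graph n} (reg : Regular 2 G) (nut : Nutℤ G) (negative : Fin n → Bool)
  (negative-kernel : Kernel G (sgn ∘ negative))
  (negative-spans : ∀ Y → Kernel G Y → ∀ i j → Y i * sgn (negative j) ≡ Y j * sgn (negative i)) where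

  private
    with-sign : Fin n → Bool → Fin n → Bool
    with-sign v b u = adj G v u ∧ (if b then negative u else not (negative u))

    sign-counts : ∀ v b → count (with-sign v b) ≡ 1
    sign-counts v true = ℤ.+-injective $ begin
      pos (count (with-sign v true)) ≡⟨ +count (with-sign v true) ⟩
      ∑[ with-sign v true ] (λ _ → 1ℤ) ≡⟨ sum-cong-≗ (λ u → ∧-on (adj G v u) (negative u)) ⟩
      ∑[ adj G v ] (λ u → on (negative u) 1ℤ) ≡⟨ ℤ.*-cancelˡ-≡ (pos 2) _ 1ℤ (sym (negative-neighbours {G = G} reg negative negative-kernel v)) ⟩
      1ℤ ∎
      where
      open ≡-Reasoning
      ∧-on : ∀ a b → on (a ∧ b) 1ℤ ≡ on a (on b 1ℤ)
      ∧-on true  b = refl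
      ∧-on false b = refl
    sign-counts v false = ℕ.+-cancelˡ-≡ 1 _ 1 $ ℤ.+-injective $ begin
      pos 1 + pos (count (with-sign v false)) ≡⟨ cong (λ k → pos k + pos (count (with-sign v false))) (sign-counts v true) ⟨
      pos (count (with-sign v true)) + pos (count (with-sign v false)) ≡⟨ cong₂ _+_ (+count (with-sign v true)) (+count (with-sign v false)) ⟩
      ∑[ with-sign v true ] (λ _ → 1ℤ) + ∑[ with-sign v false ] (λ _ → 1ℤ) ≡⟨ ∑-distrib-+ (λ u → on (with-sign v true u) 1ℤ) _ ⟨
      sum (λ u → on (with-sign v true u) 1ℤ + on (with-sign v false u) 1ℤ) ≡⟨ sum-cong-≗ (λ u → merge (adj G v u) (negative u)) ⟩
      ∑[ adj G v ] (λ _ → 1ℤ) ≡⟨ +count (adj G v) ⟨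
      pos (count (adj G v)) ≡⟨ cong pos (reg v) ⟩
      pos 2 ∎
      where
      open ≡-Reasoning
      merge : ∀ a b → on (a ∧ b) 1ℤ + on (a ∧ not b) 1ℤ ≡ on a 1ℤ
      merge true  true  = refl
      merge true  false = refl
      merge false b     = refl

    neighbour : Fin n → Bool → Fin n
    neighbour v b = Unique.element (count≡1⇒Unique (with-sign v b) (sign-counts v b))

    neighbour-member : ∀ v b → with-sign v b (neighbour v b) ≡ true
    neighbour-member v b = Unique.member (count≡1⇒Unique (with-sign v b) (sign-counts v b))

    split-∧ : ∀ a b → a ∧ b ≡ true → a ≡ true × b ≡ true
    split-∧ true true refl = refl , refl

    sign-true : ∀ b c → (if b then c else not c) ≡ true → c ≡ b
    sign-true true  true  _ = refl
    sign-true false false _ = refl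

    true-sign : ∀ b → (if b then b else not b) ≡ true
    true-sign true  = refl
    true-sign false = refl

    neighbour-adj : ∀ v b → adj G v (neighbour v b) ≡ true
    neighbour-adj v b = proj₁ (split-∧ _ _ (neighbour-member v b))

    neighbour-sign : ∀ v b → negative (neighbour v b) ≡ b
    neighbour-sign v b = sign-true b _ (proj₂ (split-∧ _ _ (neighbour-member v b)))

    neighbour-unique : ∀ v {u} → adj G v u ≡ true → u ≡ neighbour v (negative u)
    neighbour-unique v {u} vu = Unique.uniqueness (count≡1⇒Unique (with-sign v (negative u)) (sign-counts v (negative u)))
      (cong₂ _∧_ vu (true-sign (negative u)))

    neighbour-back : ∀ v b → neighbour (neighbour v b) (negative v) ≡ v
    neighbour-back v b = sym (neighbour-unique (neighbour v b)
      (trans (adj-sym G (neighbour v b) v) (neighbour-adj v b)))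

    neighbour≢ : ∀ v b → neighbour v b ≢ v
    neighbour≢ v b eq = contradiction
      (trans (sym (neighbour-adj v b)) (trans (cong (adj G v) eq) (adj-irrefl G v))) λ ()

    σ τ ρ : Fin n → Fin n
    σ v = neighbour v (negative v)
    τ v = neighbour v (not (negative v))
    ρ v = τ (σ v)

    σσ : ∀ v → σ (σ v) ≡ v
    σσ v = trans (cong (neighbour (σ v)) (neighbour-sign v (negative v))) (neighbour-back v (negative v))

    ττ : ∀ v → τ (τ v) ≡ v
    ττ v = trans (cong (neighbour (τ v)) (trans (cong not (neighbour-sign v (not (negative v)))) (Bool.not-involutive (negative v))))
      (neighbour-back v (not (negative v)))

    ρ-injective : ∀ {u v} → ρ u ≡ ρ v → u ≡ v
    ρ-injective {u} {v} eq = trans (sym (σσ u)) (trans (cong σ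
      (trans (sym (ττ (σ u))) (trans (cong τ eq) (ττ (σ v))))) (σσ v))

    -- As `σ` and `τ` are involutions, `σ` conjugates `ρ` to its inverse. Hence ρ^(k+2) v = σ v
    -- implies ρ^k (ρ v) = σ (ρ v), a descent by two that ends at a vertex equal to its own
    -- neighbour.
    ρ-avoids-σ : ∀ k v → iterate ρ k v ≢ σ v
    ρ-avoids-σ zero          v eq = neighbour≢ v (negative v) (sym eq)
    ρ-avoids-σ (suc zero)    v eq = neighbour≢ (σ v) (not (negative (σ v))) eq
    ρ-avoids-σ (suc (suc k)) v eq = ρ-avoids-σ k (ρ v) (begin
      iterate ρ k (ρ v) ≡⟨ iterate-suc ρ k v ⟩
      iterate ρ (suc k) v ≡⟨ trans (cong σ (ττ (σ (iterate ρ (suc k) v)))) (σσ _) ⟨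
      σ (τ (ρ (iterate ρ (suc k) v))) ≡⟨ cong (σ ∘ τ) eq ⟩
      σ (τ (σ v)) ∎)
      where open ≡-Reasoning

    ∑-neighbours : ∀ v Y → ∑[ adj G v ] Y ≡ Y (σ v) + Y (τ v)
    ∑-neighbours v Y = begin
      ∑[ adj G v ] Y ≡⟨ ∑-cong {W = σ v ⊕ τ v ⊕ ∅ₛ} pointwise (λ _ → refl) ⟩
      ∑[ σ v ⊕ τ v ⊕ ∅ₛ ] Y ≡⟨ ∑-⊕ (σ v) (τ v ⊕ ∅ₛ) Y (cong (_∨ false) (≡ᵇ-≢ (σ≢τ v ∘ sym))) ⟩
      Y (σ v) + ∑[ τ v ⊕ ∅ₛ ] Y ≡⟨ cong (Y (σ v) +_) (∑-⊕ (τ v) ∅ₛ Y refl) ⟩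
      Y (σ v) + (Y (τ v) + ∑[ ∅ₛ ] Y) ≡⟨ cong (λ z → Y (σ v) + (Y (τ v) + z)) (sum-0 {f = λ i → on (∅ₛ i) (Y i)} λ _ → refl) ⟩
      Y (σ v) + (Y (τ v) + 0ℤ) ≡⟨ cong (Y (σ v) +_) (ℤ.+-identityʳ _) ⟩
      Y (σ v) + Y (τ v) ∎
      where
      open ≡-Reasoning
      σ≢τ : ∀ v → σ v ≢ τ v
      σ≢τ v eq = Bool.not-¬ (sym (neighbour-sign v (negative v)))
        (trans (sym (Bool.not-involutive _)) (cong not (trans (sym (neighbour-sign v (not (negative v)))) (cong negative (sym eq)))))
      pointwise : adj G v ≗ σ v ⊕ τ v ⊕ ∅ₛ
      pointwise u with σ v Fin.≟ u | τ v Fin.≟ u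
      ... | yes refl | _        = neighbour-adj v (negative v)
      ... | no _     | yes refl = neighbour-adj v (not (negative v))
      ... | no σ≢u   | no τ≢u   with adj G v u in vu
      ...   | false = refl
      ...   | true with negative v Bool.≟ negative u
      ...     | yes eq = contradiction (trans (cong (neighbour v) eq) (sym (neighbour-unique v vu))) σ≢u
      ...     | no neq = contradiction (trans (cong (neighbour v) (sym (Bool.¬-not (neq ∘ sym)))) (sym (neighbour-unique v vu))) τ≢u

  -- `Y` weights each sign by the number of visits `c`, which is constant along `ρ`. Were `Y`
  -- proportional to the signs, then `c o` and `c (σ o)` would agree; but the first is at least 1
  -- and the second is 0.
  not-2-regular : ⊥
  not-2-regular = ℕ.1+n≰n (ℕ.≤-trans (visits-start ρ ρ-injective o N)
      (ℕ.≤-reflexive (trans same-visits (visits-never ρ ρ-injective o (σ o) (λ k → ρ-avoids-σ k o) (suc N)))))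
    where
    o = first (Nutℤ.2≤n nut)
    N = proj₁ (period ρ ρ-injective o)
    c : Fin n → ℕ
    c = visits ρ ρ-injective o (suc N)
    c-ρ : ∀ u → c (ρ u) ≡ c u
    c-ρ = visits-ρ ρ ρ-injective {o} {suc N} (proj₂ (period ρ ρ-injective o))
    s : Fin n → ℤ
    s = sgn ∘ negative
    Y : Fin n → ℤ
    Y u = s u * pos (c u)
    sgn-not : ∀ b → sgn (not b) ≡ - sgn b
    sgn-not true  = refl
    sgn-not false = refl
    Y-kernel : Kernel G Y
    Y-kernel v = begin
      ∑[ adj G v ] Y ≡⟨ ∑-neighbours v Y ⟩
      s (σ v) * pos (c (σ v)) + s (τ v) * pos (c (τ v))
        ≡⟨ cong₂ _+_ (cong (λ b → sgn b * pos (c (σ v))) (neighbour-sign v (negative v)))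
             (cong₂ (λ b k → sgn b * pos k) (neighbour-sign v (not (negative v))) c-τ) ⟩
      s v * pos (c (σ v)) + sgn (not (negative v)) * pos (c (σ v)) ≡⟨ cong (λ z → s v * pos (c (σ v)) + z * pos (c (σ v))) (sgn-not (negative v)) ⟩
      s v * pos (c (σ v)) + - s v * pos (c (σ v)) ≡⟨ cancel (s v) (pos (c (σ v))) ⟩
      0ℤ ∎
      where
      open ≡-Reasoning
      cancel : ∀ a b → a * b + - a * b ≡ 0ℤ
      cancel = solve-∀
      c-τ : c (τ v) ≡ c (σ v)
      c-τ = trans (cong (c ∘ τ) (sym (σσ v))) (c-ρ (σ v))
    same-visits : c o ≡ c (σ o)
    same-visits = ℤ.+-injective $ *-cancelʳ-≢0 (λ eq → [ sgn≢0 (negative o) , sgn≢0 (negative o) ]′ (ℤ.i*j≡0⇒i≡0∨j≡0 (s o) eq)) (begin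
      pos (c o) * (s o * s o) ≡⟨ shuffle (pos (c o)) (s o) (s o) ⟩
      Y o * s o ≡⟨ cong (Y o *_) (cong sgn (neighbour-sign o (negative o))) ⟨
      Y o * s (σ o) ≡⟨ negative-spans Y Y-kernel o (σ o) ⟩
      Y (σ o) * s o ≡⟨ cong (λ b → sgn b * pos (c (σ o)) * s o) (neighbour-sign o (negative o)) ⟩
      s o * pos (c (σ o)) * s o ≡⟨ shuffle (pos (c (σ o))) (s o) (s o) ⟨
      pos (c (σ o)) * (s o * s o) ∎)
      where
      open ≡-Reasoning
      shuffle : ∀ a b c → a * (b * c) ≡ b * a * c
      shuffle = solve-∀

-- The admissible pairs of degree and order

Admissible : ℕ → ℕ → Set
Admissible d n = (4 ∣ d × 4 ≤ d × 2 ∣ n × d ℕ.+ 4 ≤ n) ⊎ (d % 4 ≡ 2 × 6 ≤ d × 4 ∣ n × d ℕ.+ 6 ≤ n)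

halve : ∀ n → ∃[ q ] (n ≡ 2 ℕ.* q ⊎ n ≡ 1 ℕ.+ 2 ℕ.* q)
halve zero    = 0 , inj₁ refl
halve (suc n) with halve n
... | q , inj₁ refl = q , inj₂ refl
... | q , inj₂ refl = suc q , inj₁ (lemma q)
  where
  lemma : ∀ q → 2 ℕ.+ 2 ℕ.* q ≡ 2 ℕ.* (1 ℕ.+ q)
  lemma = ℕ-Solver.solve-∀

odd≢even : ∀ x y → 1 ℕ.+ 2 ℕ.* x ≢ 2 ℕ.* y
odd≢even x y eq = contradiction (trans (sym (odd x)) (trans (cong (_% 2) eq) (even y))) λ ()
  where
  open import Data.Nat.DivMod using (m*n%n≡0)
  odd : ∀ x → (1 ℕ.+ 2 ℕ.* x) % 2 ≡ 1
  odd x = trans (cong (λ k → (1 ℕ.+ k) % 2) (ℕ.*-comm 2 x)) ([m+kn]%n≡m%n 1 x 2)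
  even : ∀ y → (2 ℕ.* y) % 2 ≡ 0
  even y = trans (cong (_% 2) (ℕ.*-comm 2 y)) (m*n%n≡0 y 2)

-- For odd `M` the parity condition makes `B` even, while 2 + `M` is odd, so the lower bound on `B`
-- improves by one. This is the passage from d + 4 to d + 6.
arithmetic : ∀ M B → 2 ≤ M → 2 ℕ.+ M ≤ B → (∃[ H ] M ℕ.* B ≡ 2 ℕ.* H) →
  Admissible (2 ℕ.* M) (2 ℕ.* B)
arithmetic M B 2≤M M+2≤B (H , MB≡2H) with halve M
... | q , inj₁ refl = inj₁ (divides q (four q) , four≤ , divides B (ℕ.*-comm 2 B)
    , subst (ℕ._≤ 2 ℕ.* B) (distrib (2 ℕ.* q)) (ℕ.*-monoʳ-≤ 2 M+2≤B))
  where
  four : ∀ q → 2 ℕ.* (2 ℕ.* q) ≡ q ℕ.* 4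
  four = ℕ-Solver.solve-∀
  four≤ : 4 ≤ 2 ℕ.* (2 ℕ.* q)
  four≤ = ℕ.*-monoʳ-≤ 2 2≤M
  distrib : ∀ m → 2 ℕ.* (2 ℕ.+ m) ≡ 2 ℕ.* m ℕ.+ 4
  distrib = ℕ-Solver.solve-∀
... | q , inj₂ refl with halve B
...   | b , inj₂ refl = contradiction (trans (sym (odd-product q b)) MB≡2H) (odd≢even (q ℕ.+ b ℕ.+ 2 ℕ.* (q ℕ.* b)) H)
  where
  odd-product : ∀ q b → (1 ℕ.+ 2 ℕ.* q) ℕ.* (1 ℕ.+ 2 ℕ.* b) ≡ 1 ℕ.+ 2 ℕ.* (q ℕ.+ b ℕ.+ 2 ℕ.* (q ℕ.* b))
  odd-product = ℕ-Solver.solve-∀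
...   | b , inj₁ refl = inj₂ (residue , ℕ.*-monoʳ-≤ 2 3≤M , divides b (four b)
    , subst (ℕ._≤ 2 ℕ.* (2 ℕ.* b)) (distrib q) (ℕ.*-monoʳ-≤ 2 M+3≤B))
  where
  four : ∀ q → 2 ℕ.* (2 ℕ.* q) ≡ q ℕ.* 4
  four = ℕ-Solver.solve-∀
  residue : (2 ℕ.* (1 ℕ.+ 2 ℕ.* q)) % 4 ≡ 2
  residue = trans (cong (_% 4) (lemma q)) ([m+kn]%n≡m%n 2 q 4)
    where
    lemma : ∀ q → 2 ℕ.* (1 ℕ.+ 2 ℕ.* q) ≡ 2 ℕ.+ q ℕ.* 4
    lemma = ℕ-Solver.solve-∀
  3≤M : 3 ≤ 1 ℕ.+ 2 ℕ.* q
  3≤M = s≤s (ℕ.*-monoʳ-≤ 2 (positive q 2≤M))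
    where
    positive : ∀ q → 2 ≤ 1 ℕ.+ 2 ℕ.* q → 1 ≤ q
    positive zero    (s≤s ())
    positive (suc q) _ = s≤s z≤n
  M+3≤B : 4 ℕ.+ 2 ℕ.* q ≤ 2 ℕ.* b
  M+3≤B = ℕ.≤∧≢⇒< M+2≤B (odd≢even (1 ℕ.+ q) b ∘ trans (lemma q))
    where
    lemma : ∀ q → 1 ℕ.+ 2 ℕ.* (1 ℕ.+ q) ≡ 3 ℕ.+ 2 ℕ.* q
    lemma = ℕ-Solver.solve-∀
  distrib : ∀ q → 2 ℕ.* (4 ℕ.+ 2 ℕ.* q) ≡ 2 ℕ.* (1 ℕ.+ 2 ℕ.* q) ℕ.+ 6
  distrib = ℕ-Solver.solve-∀

-- In terms of the halves, `suc d ≤ n` says that M < B, and `n ≢ 2 + d` excludes B = M + 1.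
order-bounds : ∀ {d n M B} → d ≡ 2 ℕ.* M → n ≡ 2 ℕ.* B → d ≢ 0 → d ≢ 2 → suc d ≤ n → n ≢ 2 ℕ.+ d →
  2 ≤ M × 2 ℕ.+ M ≤ B
order-bounds {M = zero}        refl refl d≢0 _ _ _ = contradiction refl d≢0
order-bounds {M = suc zero}    refl refl _ d≢2 _ _ = contradiction refl d≢2
order-bounds {M = suc (suc k)} {B} refl refl _ _ d<n n≢2+d = s≤s (s≤s z≤n)
  , ℕ.≤∧≢⇒< (ℕ.*-cancelˡ-< 2 (2 ℕ.+ k) B d<n) λ { refl → n≢2+d (distrib k) }
  where
  distrib : ∀ k → 2 ℕ.* (3 ℕ.+ k) ≡ 2 ℕ.+ 2 ℕ.* (2 ℕ.+ k)
  distrib = ℕ-Solver.solve-∀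

even⇒Admissible : ∀ {d n M B} → d ≡ 2 ℕ.* M → n ≡ 2 ℕ.* B → d ≢ 0 → d ≢ 2 → suc d ≤ n → n ≢ 2 ℕ.+ d →
  (∃[ H ] M ℕ.* B ≡ 2 ℕ.* H) → Admissible d n
even⇒Admissible {M = M} {B} d≡2M n≡2B d≢0 d≢2 d<n n≢2+d parity with order-bounds d≡2M n≡2B d≢0 d≢2 d<n n≢2+d
... | 2≤M , 2+M≤B = subst₂ Admissible (sym d≡2M) (sym n≡2B) (arithmetic M B 2≤M 2+M≤B parity)

signs⇒Admissible : ∀ {d n} {G : Graph n} → Regular d G → Nutℤ G → ∀ negative →
  Kernel G (sgn ∘ negative) →
  (∀ Y → Kernel G Y → ∀ i j → Y i * sgn (negative j) ≡ Y j * sgn (negative i)) → Admissible d n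
signs⇒Admissible {d} {n} {G} reg nut neg ker spans = conclude
  (ℤ.∣ ∑[ adj G (first (Nutℤ.2≤n nut)) ] (λ u → on (neg u) 1ℤ) ∣ , ∣-even (negative-neighbours {G = G} reg neg ker (first (Nutℤ.2≤n nut))))
  where
  d≢0 = degree≢0 reg nut
  d≢2 : d ≢ 2
  d≢2 refl = not-2-regular reg nut neg ker spans
  conclude : ∃[ M ] d ≡ 2 ℕ.* M → Admissible d n
  conclude (M , d≡2M) = even⇒Admissible {M = M} {B = count neg} d≡2M (halves {G = G} reg neg ker d≢0) d≢0 d≢2
    (closed-neighbourhood reg nut) (not-cocktail-party reg nut) (handshake-parity {G = G} reg neg ker {M} d≡2M)

VT⇒Admissible : ∀ {d n} → 𝔑-VT d n → Admissible d n
VT⇒Admissible {d} {n} (G , reg , vt , nutℚ) =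
  signs⇒Admissible reg nut (negative vt nut) (Nutℤ.in-kernel (sign-nut vt nut)) (Nutℤ.spans (sign-nut vt nut))
  where
  nut : Nutℤ G
  nut = Nut⇒Nutℤ nutℚ

-- Cayley graphs

module _ (Γ : FiniteGroup m) where
  open FiniteGroup Γ
  private module Γ = Group group

  -- Right translations are the automorphisms, because adjacency depends on `v ∙ u ⁻¹` only.
  translation : Fin m → Permutation′ m
  translation g = permutation (_∙ g) (_∙ g ⁻¹)
    (λ x → trans (Γ.assoc x (g ⁻¹) g) (trans (cong (x ∙_) (Γ.inverseˡ g)) (Γ.identityʳ x)))
    (λ x → trans (Γ.assoc x g (g ⁻¹)) (trans (cong (x ∙_) (Γ.inverseʳ g)) (Γ.identityʳ x)))

  quotient-translate : ∀ x y g → (y ∙ g) ∙ (x ∙ g) ⁻¹ ≡ y ∙ x ⁻¹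
  quotient-translate x y g = begin
    (y ∙ g) ∙ (x ∙ g) ⁻¹ ≡⟨ cong ((y ∙ g) ∙_) (GroupProperties.⁻¹-anti-homo-∙ group x g) ⟩
    (y ∙ g) ∙ (g ⁻¹ ∙ x ⁻¹) ≡⟨ Γ.assoc (y ∙ g) (g ⁻¹) (x ⁻¹) ⟨
    ((y ∙ g) ∙ g ⁻¹) ∙ x ⁻¹ ≡⟨ cong (_∙ x ⁻¹) (inverseˡ (translation g)) ⟩
    y ∙ x ⁻¹ ∎
    where open ≡-Reasoning

  Cay-vertexTransitive : (S : ConnectionSet Γ) → VertexTransitive (Cay Γ S)
  Cay-vertexTransitive S u v = translation (u ⁻¹ ∙ v)
    , (λ x y → cong (lookup (ConnectionSet.C S)) (quotient-translate x y (u ⁻¹ ∙ v)))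
    , trans (sym (Γ.assoc u (u ⁻¹) v)) (trans (cong (_∙ v) (Γ.inverseʳ u)) (Γ.identityˡ v))

≅-vertexTransitive : {G : Graph n} {H : Graph m} → G ≅ H → VertexTransitive H → VertexTransitive G
≅-vertexTransitive {G = G} {H} (π , iso) vt u v with vt (π ⟨$⟩ʳ u) (π ⟨$⟩ʳ v)
... | ρ , ρ-aut , ρu≡v = π ∘ₚ ρ ∘ₚ flip π
  , (λ x y → begin
      adj G (π ⟨$⟩ˡ (ρ ⟨$⟩ʳ (π ⟨$⟩ʳ x))) (π ⟨$⟩ˡ (ρ ⟨$⟩ʳ (π ⟨$⟩ʳ y)))
        ≡⟨ iso _ _ ⟨
      adj H (π ⟨$⟩ʳ (π ⟨$⟩ˡ (ρ ⟨$⟩ʳ (π ⟨$⟩ʳ x)))) (π ⟨$⟩ʳ (π ⟨$⟩ˡ (ρ ⟨$⟩ʳ (π ⟨$⟩ʳ y))))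
        ≡⟨ cong₂ (adj H) (inverseʳ π) (inverseʳ π) ⟩
      adj H (ρ ⟨$⟩ʳ (π ⟨$⟩ʳ x)) (ρ ⟨$⟩ʳ (π ⟨$⟩ʳ y))
        ≡⟨ ρ-aut _ _ ⟩
      adj H (π ⟨$⟩ʳ x) (π ⟨$⟩ʳ y)
        ≡⟨ iso x y ⟩
      adj G x y ∎)
  , trans (cong (π ⟨$⟩ˡ_) ρu≡v) (inverseˡ π)
  where open ≡-Reasoning

Cay⇒VT : ∀ {d n} → 𝔑-Cay d n → 𝔑-VT d n
Cay⇒VT (G , reg , (m , Γ , S , G≅Cay) , nut) =
  G , reg , ≅-vertexTransitive {G = G} {Cay Γ S} G≅Cay (Cay-vertexTransitive Γ S) , nut

-- Cyclic groups

module Cyclic (m : ℕ) .{{_ : ℕ.NonZero m}} where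
  infixl 6 _⊞_ _⊟_

  [_] : ℕ → Fin m
  [ x ] = x mod m

  toℕ-[] : ∀ x → toℕ [ x ] ≡ x % m
  toℕ-[] x = Fin.toℕ-fromℕ< _

  []-cong : ∀ {x y} → x % m ≡ y % m → [ x ] ≡ [ y ]
  []-cong {x} {y} eq = Fin.toℕ-injective (trans (toℕ-[] x) (trans eq (sym (toℕ-[] y))))

  [toℕ] : ∀ a → [ toℕ a ] ≡ a
  [toℕ] a = Fin.toℕ-injective (trans (toℕ-[] (toℕ a)) (m<n⇒m%n≡m (Fin.toℕ<n a)))

  []-periodic : ∀ x → [ m ℕ.+ x ] ≡ [ x ]
  []-periodic x = []-cong (trans (cong (_% m) (ℕ.+-comm m x)) ([m+n]%n≡m%n x m))

  [m]≡[0] : [ m ] ≡ [ 0 ]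
  [m]≡[0] = trans (cong [_] (sym (ℕ.+-identityʳ m))) ([]-periodic 0)

  _⊞_ : Fin m → Fin m → Fin m
  a ⊞ b = [ toℕ a ℕ.+ toℕ b ]

  ⊟_ : Fin m → Fin m
  ⊟ a = [ m ℕ.∸ toℕ a ]

  []-⊞ : ∀ x y → [ x ] ⊞ [ y ] ≡ [ x ℕ.+ y ]
  []-⊞ x y = []-cong (trans (cong₂ (λ u v → (u ℕ.+ v) % m) (toℕ-[] x) (toℕ-[] y)) (sym (%-distribˡ-+ x y m)))

  ⊞-[] : ∀ a y → a ⊞ [ y ] ≡ [ toℕ a ℕ.+ y ]
  ⊞-[] a y = trans (cong (_⊞ [ y ]) (sym ([toℕ] a))) ([]-⊞ (toℕ a) y)

  ⊞-comm : ∀ a b → a ⊞ b ≡ b ⊞ a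
  ⊞-comm a b = cong [_] (ℕ.+-comm (toℕ a) (toℕ b))

  ⊞-assoc : ∀ a b c → (a ⊞ b) ⊞ c ≡ a ⊞ (b ⊞ c)
  ⊞-assoc a b c = begin
    [ toℕ a ℕ.+ toℕ b ] ⊞ c ≡⟨ ⊞-comm _ c ⟩
    c ⊞ [ toℕ a ℕ.+ toℕ b ] ≡⟨ ⊞-[] c _ ⟩
    [ toℕ c ℕ.+ (toℕ a ℕ.+ toℕ b) ] ≡⟨ cong [_] (trans (ℕ.+-comm (toℕ c) _) (ℕ.+-assoc (toℕ a) _ _)) ⟩
    [ toℕ a ℕ.+ (toℕ b ℕ.+ toℕ c) ] ≡⟨ ⊞-[] a _ ⟨
    a ⊞ [ toℕ b ℕ.+ toℕ c ] ∎
    where open ≡-Reasoning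

  ⊞-identityˡ : ∀ a → [ 0 ] ⊞ a ≡ a
  ⊞-identityˡ a = trans (⊞-comm [ 0 ] a) (trans (⊞-[] a 0) (trans (cong [_] (ℕ.+-identityʳ _)) ([toℕ] a)))

  ⊞-inverseʳ : ∀ a → a ⊞ ⊟ a ≡ [ 0 ]
  ⊞-inverseʳ a = trans (⊞-[] a _) (trans (cong [_] (ℕ.m+[n∸m]≡n (ℕ.<⇒≤ (Fin.toℕ<n a)))) [m]≡[0])

  isAbelianGroup : IsAbelianGroup _≡_ _⊞_ [ 0 ] ⊟_
  isAbelianGroup = record
    { isGroup = record
      { isMonoid = record
        { isSemigroup = record
          { isMagma = record { isEquivalence = isEquivalence ; ∙-cong = cong₂ _⊞_ }
          ; assoc = ⊞-assoc
          }
        ; identity = ⊞-identityˡ , λ a → trans (⊞-comm a [ 0 ]) (⊞-identityˡ a)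
        }
      ; inverse = (λ a → trans (⊞-comm (⊟ a) a) (⊞-inverseʳ a)) , ⊞-inverseʳ
      ; ⁻¹-cong = cong ⊟_
      }
    ; comm = ⊞-comm
    }

  abelianGroup : AbelianGroup 0ℓ 0ℓ
  abelianGroup = record { isAbelianGroup = isAbelianGroup }

  _⊟_ : Fin m → Fin m → Fin m
  a ⊟ b = a ⊞ ⊟ b

  open AbelianGroupProperties abelianGroup public
    using () renaming (⁻¹-involutive to ⊟-involutive; ⁻¹-anti-homo-// to ⊟-anti-homo; //-rightDividesʳ to ⊞-⊟; //-rightDividesˡ to ⊟-⊞)

  []-⊟ : ∀ x y → [ x ℕ.+ y ] ⊟ [ y ] ≡ [ x ]
  []-⊟ x y = trans (cong (_⊟ [ y ]) (sym ([]-⊞ x y))) (⊞-⊟ [ y ] [ x ])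

  negation : Permutation′ m
  negation = permutation ⊟_ ⊟_ ⊟-involutive ⊟-involutive

  ∑-reflect : ∀ (W : Fin m → Bool) → (∀ a → W (⊟ a) ≡ W a) → ∀ (f : Fin m → ℤ) x →
    ∑[ W ] (λ a → f (x ⊟ a)) ≡ ∑[ W ] (λ a → f (a ⊞ x))
  ∑-reflect W W-sym f x = trans (∑-permute W (λ a → f (x ⊟ a)) negation)
    (∑-cong {W = W} W-sym λ a → cong f (trans (cong (x ⊞_) (⊟-involutive a)) (⊞-comm x a)))

  ⊟-complement : ∀ {x y} → x ℕ.+ y ≡ m → ⊟ [ x ] ≡ [ y ]
  ⊟-complement {x} {y} x+y≡m = sym (inverseʳ-unique [ x ] [ y ] (trans ([]-⊞ x y) (trans (cong [_] x+y≡m) [m]≡[0])))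
    where open AbelianGroupProperties abelianGroup using (inverseʳ-unique)

  ⊟-fixed : ∀ {x} → ⊟ x ≡ x → x ≡ [ 0 ] ⊎ toℕ x ℕ.+ toℕ x ≡ m
  ⊟-fixed {x} fixed with toℕ x in eq
  ... | zero  = inj₁ (trans (sym ([toℕ] x)) (cong [_] eq))
  ... | suc k = inj₂ (begin
    suc k ℕ.+ suc k ≡⟨ cong (ℕ._+ suc k) x≡m-x ⟩
    m ℕ.∸ suc k ℕ.+ suc k ≡⟨ ℕ.m∸n+n≡m (ℕ.<⇒≤ k<m) ⟩
    m ∎)
    where
    open ≡-Reasoning
    k<m : suc k < m
    k<m = subst (_< m) eq (Fin.toℕ<n x)
    x≡m-x : suc k ≡ m ℕ.∸ suc k
    x≡m-x = trans (sym eq) (trans (cong toℕ (sym fixed)) (trans (toℕ-[] _)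
      (m<n⇒m%n≡m (ℕ.∸-monoʳ-< {m = m} {n = suc k} {o = 0} (s≤s z≤n) (ℕ.<⇒≤ k<m)))))

  []-injective : ∀ {x y} → x < m → y < m → [ x ] ≡ [ y ] → x ≡ y
  []-injective {x} {y} x<m y<m eq = trans (sym (m<n⇒m%n≡m x<m))
    (trans (sym (toℕ-[] x)) (trans (cong toℕ eq) (trans (toℕ-[] y) (m<n⇒m%n≡m y<m))))

-- Dihedral groups: inj₁ a stands for the rotation r ^ a and inj₂ a for the
-- reflection s r ^ a.

module Dihedral (m : ℕ) .{{_ : ℕ.NonZero m}} where
  open Cyclic m
  open AbelianGroupProperties abelianGroup using (⁻¹-∙-comm)
  private module A = AbelianGroup abelianGroup

  infixl 7 _·_
  _·_ : Fin m ⊎ Fin m → Fin m ⊎ Fin m → Fin m ⊎ Fin m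
  inj₁ a · inj₁ x = inj₁ (a ⊞ x)
  inj₁ a · inj₂ x = inj₂ (x ⊟ a)
  inj₂ b · inj₁ x = inj₂ (b ⊞ x)
  inj₂ b · inj₂ x = inj₁ (x ⊟ b)

  inv : Fin m ⊎ Fin m → Fin m ⊎ Fin m
  inv (inj₁ a) = inj₁ (⊟ a)
  inv (inj₂ b) = inj₂ b

  private
    ⊟-⊞-swap : ∀ x y a → (x ⊟ a) ⊞ y ≡ (x ⊞ y) ⊟ a
    ⊟-⊞-swap x y a = trans (A.assoc x (⊟ a) y) (trans (cong (x ⊞_) (A.comm (⊟ a) y)) (sym (A.assoc x y (⊟ a))))
    ⊟-sum : ∀ x a b → x ⊟ (a ⊞ b) ≡ (x ⊟ b) ⊟ a
    ⊟-sum x a b = trans (cong (λ c → x ⊞ ⊟ c) (A.comm a b))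
      (trans (cong (x ⊞_) (sym (⁻¹-∙-comm b a))) (sym (A.assoc x (⊟ b) (⊟ a))))
    ⊟-difference : ∀ a x y → y ⊟ (x ⊟ a) ≡ a ⊞ (y ⊟ x)
    ⊟-difference a x y = trans (cong (y ⊞_) (⊟-anti-homo x a))
      (trans (A.comm y (a ⊟ x)) (trans (⊟-⊞-swap a y x) (A.assoc a y (⊟ x))))

  ·-assoc : ∀ u v w → (u · v) · w ≡ u · (v · w)
  ·-assoc (inj₁ a) (inj₁ b) (inj₁ c) = cong inj₁ (A.assoc a b c)
  ·-assoc (inj₁ a) (inj₁ b) (inj₂ x) = cong inj₂ (⊟-sum x a b)
  ·-assoc (inj₁ a) (inj₂ x) (inj₁ c) = cong inj₂ (⊟-⊞-swap x c a)
  ·-assoc (inj₁ a) (inj₂ x) (inj₂ y) = cong inj₁ (⊟-difference a x y)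
  ·-assoc (inj₂ b) (inj₁ x) (inj₁ y) = cong inj₂ (A.assoc b x y)
  ·-assoc (inj₂ b) (inj₁ x) (inj₂ y) = cong inj₁ (⊟-sum y b x)
  ·-assoc (inj₂ b) (inj₂ x) (inj₁ y) = cong inj₁ (⊟-⊞-swap x y b)
  ·-assoc (inj₂ b) (inj₂ x) (inj₂ y) = cong inj₂ (⊟-difference b x y)

  ·-identityˡ : ∀ u → inj₁ [ 0 ] · u ≡ u
  ·-identityˡ (inj₁ a) = cong inj₁ (A.identityˡ a)
  ·-identityˡ (inj₂ x) = cong inj₂ (trans (cong (x ⊞_) ε⁻¹≈ε) (A.identityʳ x))
    where open AbelianGroupProperties abelianGroup using (ε⁻¹≈ε)

  ·-identityʳ : ∀ u → u · inj₁ [ 0 ] ≡ u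
  ·-identityʳ (inj₁ a) = cong inj₁ (A.identityʳ a)
  ·-identityʳ (inj₂ x) = cong inj₂ (A.identityʳ x)

  ·-inverseˡ : ∀ u → inv u · u ≡ inj₁ [ 0 ]
  ·-inverseˡ (inj₁ a) = cong inj₁ (A.inverseˡ a)
  ·-inverseˡ (inj₂ x) = cong inj₁ (A.inverseʳ x)

  ·-inverseʳ : ∀ u → u · inv u ≡ inj₁ [ 0 ]
  ·-inverseʳ (inj₁ a) = cong inj₁ (A.inverseʳ a)
  ·-inverseʳ (inj₂ x) = cong inj₁ (A.inverseʳ x)

  enc : Fin m ⊎ Fin m → Fin (m ℕ.+ m)
  enc = join m m

  dec : Fin (m ℕ.+ m) → Fin m ⊎ Fin m
  dec = splitAt m

  dec-enc : ∀ u → dec (enc u) ≡ u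
  dec-enc = Fin.splitAt-join m m

  enc-dec : ∀ i → enc (dec i) ≡ i
  enc-dec = Fin.join-splitAt m m

  dihedral : FiniteGroup (m ℕ.+ m)
  dihedral = record
    { _∙_ = λ i j → enc (dec i · dec j)
    ; ε   = enc (inj₁ [ 0 ])
    ; _⁻¹ = λ i → enc (inv (dec i))
    ; isGroup = record
      { isMonoid = record
        { isSemigroup = record
          { isMagma = record { isEquivalence = isEquivalence ; ∙-cong = cong₂ (λ i j → enc (dec i · dec j)) }
          ; assoc = λ i j k → cong enc (trans (cong (_· dec k) (dec-enc _))
              (trans (·-assoc (dec i) (dec j) (dec k)) (cong (dec i ·_) (sym (dec-enc _)))))
          }
        ; identity = (λ i → trans (cong enc (trans (cong (_· dec i) (dec-enc _)) (·-identityˡ (dec i)))) (enc-dec i))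
                   , (λ i → trans (cong enc (trans (cong (dec i ·_) (dec-enc _)) (·-identityʳ (dec i)))) (enc-dec i))
        }
      ; inverse = (λ i → cong enc (trans (cong (_· dec i) (dec-enc _)) (·-inverseˡ (dec i))))
                , (λ i → cong enc (trans (cong (dec i ·_) (dec-enc _)) (·-inverseʳ (dec i))))
      ; ⁻¹-cong = cong (λ i → enc (inv (dec i)))
      }
    }
  open FiniteGroup dihedral using (_∙_; _⁻¹)

  module _ (R T : Fin m → Bool) (0∉R : R [ 0 ] ≡ false) (R-sym : ∀ a → R (⊟ a) ≡ R a) where

    member : Fin m ⊎ Fin m → Bool
    member (inj₁ a) = R a
    member (inj₂ b) = T b

    member-inv : ∀ u → member (inv u) ≡ member u
    member-inv (inj₁ a) = R-sym a
    member-inv (inj₂ b) = refl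

    private
      in-C : Fin (m ℕ.+ m) → Bool
      in-C i = member (dec i)

    connection : ConnectionSet dihedral
    connection = record
      { C     = tabulate in-C
      ; ε∉C   = λ ε∈C → contradiction
          (trans (sym ([]=⇒lookup ε∈C)) (trans (lookup∘tabulate in-C _) (trans (cong member (dec-enc (inj₁ [ 0 ]))) 0∉R))) λ ()
      ; C-inv = λ {g} g∈C → lookup⇒[]= _ _ (trans (lookup∘tabulate in-C _)
          (trans (cong member (dec-enc (inv (dec g)))) (trans (member-inv (dec g))
            (trans (sym (lookup∘tabulate in-C g)) ([]=⇒lookup g∈C)))))
      }

    dihedrant : Graph (m ℕ.+ m)
    dihedrant = Cay dihedral connection

    ∑-dihedrant : ∀ v Y → ∑[ adj dihedrant v ] Y ≡
      ∑[ R ] (λ a → Y (enc (inj₁ a · dec v))) + ∑[ T ] (λ b → Y (enc (inj₂ b · dec v)))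
    ∑-dihedrant v Y = begin
      ∑[ adj dihedrant v ] Y
        ≡⟨ ∑-permute (adj dihedrant v) Y (translation dihedral v) ⟩
      ∑[ (λ g → adj dihedrant v (g ∙ v)) ] (λ g → Y (g ∙ v))
        ≡⟨ ∑-cong {W = in-C} (λ g → trans (lookup∘tabulate in-C _) (cong in-C (inverseˡ (translation dihedral v) {g}))) (λ _ → refl) ⟩
      ∑[ in-C ] (λ g → Y (g ∙ v))
        ≡⟨ sum-↑ m (λ g → on (in-C g) (Y (g ∙ v))) ⟩
      sum (λ a → on (in-C (a Fin.↑ˡ m)) (Y ((a Fin.↑ˡ m) ∙ v))) + sum (λ b → on (in-C (m Fin.↑ʳ b)) (Y ((m Fin.↑ʳ b) ∙ v)))
        ≡⟨ cong₂ _+_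
             (sum-cong-≗ λ a → cong (λ u → on (member u) (Y (enc (u · dec v)))) (dec-enc (inj₁ a)))
             (sum-cong-≗ λ b → cong (λ u → on (member u) (Y (enc (u · dec v)))) (dec-enc (inj₂ b))) ⟩
      ∑[ R ] (λ a → Y (enc (inj₁ a · dec v))) + ∑[ T ] (λ b → Y (enc (inj₂ b · dec v))) ∎
      where open ≡-Reasoning

    ∑-dihedrant-enc : ∀ u Y → ∑[ adj dihedrant (enc u) ] Y ≡
      ∑[ R ] (λ a → Y (enc (inj₁ a · u))) + ∑[ T ] (λ b → Y (enc (inj₂ b · u)))
    ∑-dihedrant-enc u Y = trans (∑-dihedrant (enc u) Y)
      (cong (λ w → ∑[ R ] (λ a → Y (enc (inj₁ a · w))) + ∑[ T ] (λ b → Y (enc (inj₂ b · w)))) (dec-enc u))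

    dihedrant-regular : Regular (count R ℕ.+ count T) dihedrant
    dihedrant-regular v = ℤ.+-injective $ begin
      pos (count (adj dihedrant v)) ≡⟨ +count (adj dihedrant v) ⟩
      ∑[ adj dihedrant v ] (λ _ → 1ℤ) ≡⟨ ∑-dihedrant v (λ _ → 1ℤ) ⟩
      ∑[ R ] (λ _ → 1ℤ) + ∑[ T ] (λ _ → 1ℤ) ≡⟨ cong₂ _+_ (+count R) (+count T) ⟨
      pos (count R) + pos (count T) ∎
      where open ≡-Reasoning

    -- The kernel equations for values `g` on rotations and `k` on reflections. At a reflection both
    -- sums run over differences with `x`; the one over `R` has been reflected by symmetry, the one
    -- over `T` is the adjoint of convolution with `T`.
    record Solution (g k : Fin m → ℤ) : Set where
      field
        rotations   : ∀ x → ∑[ R ] (λ a → g (a ⊞ x)) + ∑[ T ] (λ b → k (b ⊞ x)) ≡ 0ℤ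
        reflections : ∀ x → ∑[ R ] (λ a → k (a ⊞ x)) + ∑[ T ] (λ b → g (x ⊟ b)) ≡ 0ℤ

    -- These laws force the values ±1, so `χ` is a real character of ℤ/m. The kernel vector is `χ`
    -- on rotations and `- χ` on reflections; the trivial and the alternating character will occur.
    record Sign (χ : Fin m → ℤ) : Set where
      field
        homo    : ∀ a b → χ (a ⊞ b) ≡ χ a * χ b
        even    : ∀ a → χ (⊟ a) ≡ χ a
        nonzero : ∀ a → χ a ≢ 0ℤ

    module _ {χ : Fin m → ℤ} (χ-sign : Sign χ) (χ-balanced : ∑[ R ] χ ≡ ∑[ T ] χ) (2≤m+m : 2 ≤ m ℕ.+ m)
      (solve-dihedrant : ∀ g k → Solution g k → ∃[ c ] (∀ x → g x ≡ c * χ x) × (∀ x → k x ≡ - (c * χ x))) where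
      open Sign χ-sign

      private
        X′ : Fin m ⊎ Fin m → ℤ
        X′ (inj₁ x) = χ x
        X′ (inj₂ x) = - χ x

        X : Fin (m ℕ.+ m) → ℤ
        X i = X′ (dec i)

        X′-nonzero : ∀ u → X′ u ≢ 0ℤ
        X′-nonzero (inj₁ x) = nonzero x
        X′-nonzero (inj₂ x) eq = nonzero x (trans (sym (ℤ.neg-involutive (χ x))) (cong -_ eq))

        ∑-homo : ∀ (W : Fin m → Bool) x (f : Fin m → Fin m) → (∀ a → χ (f a) ≡ χ x * χ a) →
          ∑[ W ] (λ a → χ (f a)) ≡ χ x * ∑[ W ] χ
        ∑-homo W x f χ∘f = trans (∑-congʳ W χ∘f) (∑-*ˡ W (χ x) χ)

        χ-⊞ : ∀ x a → χ (a ⊞ x) ≡ χ x * χ a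
        χ-⊞ x a = trans (homo a x) (ℤ.*-comm (χ a) (χ x))

        χ-⊟ : ∀ x a → χ (x ⊟ a) ≡ χ x * χ a
        χ-⊟ x a = trans (homo x (⊟ a)) (cong (χ x *_) (even a))

        ∑-X : ∀ u → ∑[ R ] (λ a → X (enc (inj₁ a · u))) + ∑[ T ] (λ b → X (enc (inj₂ b · u))) ≡ 0ℤ
        ∑-X u = trans (cong₂ _+_ (∑-congʳ R λ a → cong X′ (dec-enc (inj₁ a · u)))
                                 (∑-congʳ T λ b → cong X′ (dec-enc (inj₂ b · u)))) (∑-X′ u)
          where
          balance : ∀ c → c * ∑[ R ] χ + - (c * ∑[ T ] χ) ≡ 0ℤ
          balance c = trans (cong (λ z → c * z + - (c * ∑[ T ] χ)) χ-balanced) (ℤ.+-inverseʳ (c * ∑[ T ] χ))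
          ∑-X′ : ∀ u → ∑[ R ] (λ a → X′ (inj₁ a · u)) + ∑[ T ] (λ b → X′ (inj₂ b · u)) ≡ 0ℤ
          ∑-X′ (inj₁ x) = trans (cong₂ _+_ (∑-homo R x (_⊞ x) (χ-⊞ x))
            (trans (∑-neg T _) (cong -_ (∑-homo T x (_⊞ x) (χ-⊞ x))))) (balance (χ x))
          ∑-X′ (inj₂ x) = trans (cong₂ _+_
            (trans (∑-neg R _) (cong -_ (∑-homo R x (λ a → x ⊟ a) (χ-⊟ x)))) (∑-homo T x (λ a → x ⊟ a) (χ-⊟ x)))
            (trans (ℤ.+-comm (- (χ x * ∑[ R ] χ)) _) (trans (cong (λ z → χ x * z + - (χ x * ∑[ R ] χ)) (sym χ-balanced)) (ℤ.+-inverseʳ (χ x * ∑[ R ] χ))))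

        restrict : ∀ {Y} → Kernel dihedrant Y → Solution (λ x → Y (enc (inj₁ x))) (λ x → Y (enc (inj₂ x)))
        restrict {Y} Y∈ker = record
          { rotations   = λ x → trans (sym (∑-dihedrant-enc (inj₁ x) Y)) (Y∈ker (enc (inj₁ x)))
          ; reflections = λ x → trans (cong (_+ ∑[ T ] (λ b → Y (enc (inj₁ (x ⊟ b)))))
              (sym (∑-reflect R R-sym (λ y → Y (enc (inj₂ y))) x)))
              (trans (sym (∑-dihedrant-enc (inj₂ x) Y)) (Y∈ker (enc (inj₂ x))))
          }

        proportional : ∀ {Y} → Kernel dihedrant Y → ∃[ c ] (∀ i → Y i ≡ c * X i)
        proportional {Y} Y∈ker with solve-dihedrant _ _ (restrict Y∈ker)
        ... | c , g≡ , k≡ = c , λ i → trans (cong Y (sym (enc-dec i))) (on-enc (dec i))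
          where
          on-enc : ∀ u → Y (enc u) ≡ c * X′ u
          on-enc (inj₁ x) = g≡ x
          on-enc (inj₂ x) = trans (k≡ x) (ℤ.neg-distribʳ-* c (χ x))

      dihedrant-nut : Nutℤ dihedrant
      dihedrant-nut = record
        { 2≤n       = 2≤m+m
        ; vector    = X
        ; in-kernel = λ v → trans (∑-dihedrant v X) (∑-X (dec v))
        ; nonzero   = λ i → X′-nonzero (dec i)
        ; spans     = λ Y Y∈ker i j → let (c , Y≡cX) = proportional Y∈ker in begin
            Y i * X j ≡⟨ cong (_* X j) (Y≡cX i) ⟩
            c * X i * X j ≡⟨ swap c (X i) (X j) ⟩
            c * X j * X i ≡⟨ cong (_* X i) (Y≡cX j) ⟨
            Y j * X i ∎
        }
        where
        open ≡-Reasoning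
        swap : ∀ a b c → a * b * c ≡ a * c * b
        swap = solve-∀

      dihedrant-in-𝔑-Cay : 𝔑-Cay (count R ℕ.+ count T) (m ℕ.+ m)
      dihedrant-in-𝔑-Cay = dihedrant , dihedrant-regular
        , (m ℕ.+ m , dihedral , connection , idₚ , λ _ _ → refl)
        , Nutℤ⇒Nut dihedrant-nut

-- Symmetric subsets

count-⊕-≤ : ∀ x (W : Fin n → Bool) → count (x ⊕ W) ≤ suc (count W)
count-⊕-≤ x W with W x in x∈W
... | false = ℕ.≤-reflexive (count-⊕ x W x∈W)
... | true  = ℕ.≤-trans (ℕ.≤-reflexive (count-cong absorb)) (ℕ.n≤1+n _)
  where
  absorb : x ⊕ W ≗ W
  absorb i with x Fin.≟ i
  ... | yes refl = sym x∈W
  ... | no  _    = refl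

count-∅ : count {n} ∅ₛ ≡ 0
count-∅ {n} = ℤ.+-injective (trans (+count {n} ∅ₛ) (sum-0 {n} {λ _ → 0ℤ} λ _ → refl))

Disjoint : (V W : Fin n → Bool) → Set
Disjoint V W = ∀ {x} → V x ≡ true → W x ≡ false

find-new : ∀ (V W : Fin n → Bool) → Disjoint V W → count V ℕ.+ count W < n →
  ∃[ x ] V x ≡ false × W x ≡ false
find-new {n} V W disjoint small = let (x , x∉) = count≢0⇒∃ (not ∘ V∪W) some in x , ∨-false (not-true x∉)
  where
  V∪W : Fin n → Bool
  V∪W i = V i ∨ W i
  on-∨ : ∀ i → on (V∪W i) 1ℤ ≡ on (V i) 1ℤ + on (W i) 1ℤ
  on-∨ i with V i in i∈V
  ... | false = sym (ℤ.+-identityˡ _)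
  ... | true  rewrite disjoint i∈V = refl
  union : count V∪W ≡ count V ℕ.+ count W
  union = ℤ.+-injective (trans (+count V∪W) (trans (sum-cong-≗ on-∨)
    (trans (∑-distrib-+ (λ i → on (V i) 1ℤ) _) (sym (cong₂ _+_ (+count V) (+count W))))))
  some : 1 ≤ count (not ∘ V∪W)
  some = ℕ.+-cancelˡ-< (count V∪W) 0 _ (subst₂ _<_ (sym (trans (ℕ.+-identityʳ _) union)) (sym (count-not V∪W)) small)
  not-true : ∀ {b} → not b ≡ true → b ≡ false
  not-true {false} _ = refl
  ∨-false : ∀ {a b} → a ∨ b ≡ false → a ≡ false × b ≡ false
  ∨-false {false} {false} _ = refl , refl

module Symmetric (ν : Fin n → Fin n) (ν-involutive : ∀ x → ν (ν x) ≡ x) where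

  Invariant : (Fin n → Bool) → Set
  Invariant W = ∀ x → W (ν x) ≡ W x

  ∅-invariant : Invariant ∅ₛ
  ∅-invariant _ = refl

  ≡ᵇ-ν : ∀ x y → (x ≡ᵇ ν y) ≡ (ν x ≡ᵇ y)
  ≡ᵇ-ν x y with ν x Fin.≟ y
  ... | yes refl = trans (cong (x ≡ᵇ_) (ν-involutive x)) (≡ᵇ-refl x)
  ... | no  νx≢y = ≡ᵇ-≢ {x = x} {ν y} λ { refl → νx≢y (ν-involutive y) }

  ⊕-invariant : ∀ x W → ν x ≡ x → Invariant W → Invariant (x ⊕ W)
  ⊕-invariant x W νx≡x inv y = cong₂ _∨_ (trans (≡ᵇ-ν x y) (cong (_≡ᵇ y) νx≡x)) (inv y)

  ⊕⊕-invariant : ∀ x {x′} W → ν x ≡ x′ → Invariant W → Invariant (x ⊕ x′ ⊕ W)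
  ⊕⊕-invariant x W refl inv y = begin
    (x ≡ᵇ ν y) ∨ ((ν x ≡ᵇ ν y) ∨ W (ν y)) ≡⟨ cong₂ _∨_ (≡ᵇ-ν x y) (cong₂ _∨_ (trans (≡ᵇ-ν (ν x) y) (cong (_≡ᵇ y) (ν-involutive x))) (inv y)) ⟩
    (ν x ≡ᵇ y) ∨ ((x ≡ᵇ y) ∨ W y) ≡⟨ Bool.∨-assoc (ν x ≡ᵇ y) _ _ ⟨
    ((ν x ≡ᵇ y) ∨ (x ≡ᵇ y)) ∨ W y ≡⟨ cong (_∨ W y) (Bool.∨-comm (ν x ≡ᵇ y) _) ⟩
    ((x ≡ᵇ y) ∨ (ν x ≡ᵇ y)) ∨ W y ≡⟨ Bool.∨-assoc (x ≡ᵇ y) _ _ ⟩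
    (x ≡ᵇ y) ∨ ((ν x ≡ᵇ y) ∨ W y) ∎
    where open ≡-Reasoning

  record Selection (F : Fin n → Bool) (size : ℕ) : Set where
    field
      set       : Fin n → Bool
      invariant : Invariant set
      avoids    : Disjoint F set
      count≡    : count set ≡ size

  module _ {F : Fin n → Bool} (F-inv : Invariant F) (F-fixed : ∀ {x} → ν x ≡ x → F x ≡ true) where

    add-pair : ∀ {size} (S : Selection F size) x → F x ≡ false → Selection.set S x ≡ false →
      Selection F (2 ℕ.+ size)
    add-pair S x x∉F x∉W = record
      { set       = x ⊕ ν x ⊕ set
      ; invariant = ⊕⊕-invariant x set refl invariant
      ; avoids    = λ {y} y∈F → cong₂ _∨_ (≡ᵇ-≢ {x = x} {y} λ { refl → contradiction (trans (sym y∈F) x∉F) λ () })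
          (cong₂ _∨_ (≡ᵇ-≢ {x = ν x} {y} λ { refl → contradiction (trans (sym y∈F) (trans (F-inv x) x∉F)) λ () }) (avoids y∈F))
      ; count≡    = trans (count-⊕ x (ν x ⊕ set) (cong₂ _∨_ (≡ᵇ-≢ νx≢x) x∉W))
          (cong suc (trans (count-⊕ (ν x) set (trans (invariant x) x∉W)) (cong suc count≡)))
      }
      where
      open Selection S
      νx≢x : ν x ≢ x
      νx≢x fixed = contradiction (trans (sym (F-fixed fixed)) x∉F) λ ()

    -- All fixed points of `ν` lie in `F`, so every new element has a distinct partner; the partner
    -- is new too, as `F` and the set chosen so far are invariant.
    select : ∀ i → count F ℕ.+ i ℕ.* 2 ≤ n → Selection F (i ℕ.* 2)
    select zero    _    = record { set = ∅ₛ ; invariant = ∅-invariant ; avoids = λ _ → refl ; count≡ = count-∅ {n} }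
    select (suc i) room = extend (select i (ℕ.≤-trans (ℕ.+-monoʳ-≤ (count F) (ℕ.m≤n+m (i ℕ.* 2) 2)) room))
      where
      extend : Selection F (i ℕ.* 2) → Selection F (2 ℕ.+ i ℕ.* 2)
      extend S = let (x , x∉F , x∉W) = find-new F set avoids small in add-pair S x x∉F x∉W
        where
        open Selection S
        small : count F ℕ.+ count set < n
        small = ℕ.≤-trans (ℕ.≤-trans (ℕ.≤-reflexive (sym (ℕ.+-suc (count F) (count set))))
          (ℕ.+-monoʳ-≤ (count F) (ℕ.≤-trans (ℕ.≤-reflexive (cong suc count≡)) (ℕ.n≤1+n _)))) room

-- Periodic sequences

Sequence : Set
Sequence = ℕ → ℤ

Periodic : ℕ → Sequence → Set
Periodic l q = ∀ x → q (l ℕ.+ x) ≡ q x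

periodic-* : ∀ {l q} → Periodic l q → ∀ k x → q (k ℕ.* l ℕ.+ x) ≡ q x
periodic-* per zero    x = refl
periodic-* {l} {q} per (suc k) x =
  trans (cong q (ℕ.+-assoc l _ x)) (trans (per (k ℕ.* l ℕ.+ x)) (periodic-* {l} {q} per k x))

Bounded : ℕ → Sequence → Set
Bounded B q = ∀ x → ℤ.∣ q x ∣ ≤ B

bounded-prefix : ∀ (q : Sequence) n → ∃[ B ] (∀ {x} → x < n → ℤ.∣ q x ∣ ≤ B)
bounded-prefix q zero    = 0 , λ ()
bounded-prefix q (suc n) with bounded-prefix q n
... | B , ≤B = ℤ.∣ q n ∣ ℕ.+ B , λ x<1+n → [ (λ x<n → ℕ.≤-trans (≤B x<n) (ℕ.m≤n+m B _))
  , (λ { refl → ℕ.m≤m+n _ B }) ]′ (ℕ.m≤n⇒m<n∨m≡n (ℕ.≤-pred x<1+n))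

periodic-bounded : ∀ l .{{_ : ℕ.NonZero l}} {q} → Periodic l q → ∃[ B ] Bounded B q
periodic-bounded l {q} per with bounded-prefix q l
... | B , ≤B = B , λ x → subst (λ z → ℤ.∣ z ∣ ≤ B)
  (trans (sym (periodic-* {l} {q} per (x / l) (x % l)))
    (cong q (trans (ℕ.+-comm _ (x % l)) (sym (m≡m%n+[m/n]*n x l)))))
  (≤B (m%n<n x l))

-- Infinite descent as induction on a bound for the absolute values: halving a sequence lowers a
-- positive bound by at least one.
descent : ∀ (P : Sequence → Set) → (∀ {q} → P q → ∃[ q′ ] P q′ × (∀ x → q x ≡ pos 2 * q′ x)) →
  ∀ {B q} → Bounded B q → P q → ∀ x → q x ≡ 0ℤ
descent P half {zero}  ≤B Pq x = ℤ.∣i∣≡0⇒i≡0 (ℕ.n≤0⇒n≡0 (≤B x))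
descent P half {suc B} {q} ≤B Pq x with half Pq
... | q′ , Pq′ , q≡2q′ = trans (q≡2q′ x) (cong (pos 2 *_) (descent P half ≤B′ Pq′ x))
  where
  halved : ∀ {a b} → 2 ℕ.* a ≤ suc b → a ≤ b
  halved {zero}  _ = z≤n
  halved {suc a} {b} 2a≤ = ℕ.≤-trans (ℕ.m≤n+m (suc a) a)
    (ℕ.≤-trans (ℕ.≤-reflexive (cong (λ c → a ℕ.+ c) (sym (ℕ.+-identityʳ (suc a))))) (ℕ.≤-pred 2a≤))
  ≤B′ : Bounded B q′
  ≤B′ y = halved (subst (_≤ suc B) (trans (cong ℤ.∣_∣ (q≡2q′ y)) (ℤ.abs-* (pos 2) (q′ y))) (≤B y))

prefix-sum : ℕ → Sequence → ℤ
prefix-sum zero    q = 0ℤ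
prefix-sum (suc n) q = q n + prefix-sum n q

prefix-sum-cong : ∀ n {p q : Sequence} → (∀ x → p x ≡ q x) → prefix-sum n p ≡ prefix-sum n q
prefix-sum-cong zero    p≗q = refl
prefix-sum-cong (suc n) p≗q = cong₂ _+_ (p≗q n) (prefix-sum-cong n p≗q)

prefix-sum-shift : ∀ n q → prefix-sum n (q ∘ suc) + q 0 ≡ q n + prefix-sum n q
prefix-sum-shift zero    q = ℤ.+-comm 0ℤ (q 0)
prefix-sum-shift (suc n) q = trans (ℤ.+-assoc (q (suc n)) _ _) (cong (q (suc n) +_) (prefix-sum-shift n q))

prefix-sum-periodic : ∀ l {q} → Periodic l q → ∀ o → prefix-sum l (λ x → q (o ℕ.+ x)) ≡ prefix-sum l q
prefix-sum-periodic l {q} per zero    = refl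
prefix-sum-periodic l {q} per (suc o) = trans shift (prefix-sum-periodic l {q} per o)
  where
  open ≡-Reasoning
  q′ : Sequence
  q′ x = q (o ℕ.+ x)
  wrap : q′ l ≡ q′ 0
  wrap = trans (cong q (trans (ℕ.+-comm o l) (cong (l ℕ.+_) (sym (ℕ.+-identityʳ o))))) (per (o ℕ.+ 0))
  shift : prefix-sum l (λ x → q (suc o ℕ.+ x)) ≡ prefix-sum l q′
  shift = AbelianGroupProperties.∙-cancelʳ ℤ.+-0-abelianGroup (q′ 0) _ _ (begin
    prefix-sum l (λ x → q (suc o ℕ.+ x)) + q′ 0 ≡⟨ cong (_+ q′ 0) (prefix-sum-cong l λ x → cong q (sym (ℕ.+-suc o x))) ⟩
    prefix-sum l (q′ ∘ suc) + q′ 0 ≡⟨ prefix-sum-shift l q′ ⟩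
    q′ l + prefix-sum l q′ ≡⟨ cong (_+ prefix-sum l q′) wrap ⟩
    q′ 0 + prefix-sum l q′ ≡⟨ ℤ.+-comm (q′ 0) _ ⟩
    prefix-sum l q′ + q′ 0 ∎)

prefix-sum-* : ∀ n c q → prefix-sum n (λ x → c * q x) ≡ c * prefix-sum n q
prefix-sum-* zero    c q = sym (ℤ.*-zeroʳ c)
prefix-sum-* (suc n) c q = trans (cong (c * q n +_) (prefix-sum-* n c q)) (sym (ℤ.*-distribˡ-+ c (q n) _))

prefix-sum-sum : ∀ n {N} (f : Fin N → Sequence) →
  prefix-sum n (λ x → sum (λ i → f i x)) ≡ sum (λ i → prefix-sum n (f i))
prefix-sum-sum zero    f = sym (sum-0 {f = λ i → prefix-sum zero (f i)} λ _ → refl)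
prefix-sum-sum (suc n) f = trans (cong (sum (λ i → f i n) +_) (prefix-sum-sum n f))
  (sym (∑-distrib-+ (λ i → f i n) _))

-- Shift-invariant operators

module _ {N} (w : Fin N → ℤ) (o : Fin N → ℕ) where

  -- A polynomial in the shift S, with coefficients `w` and exponents `o`, applied to `q`. Negative
  -- exponents are represented modulo the period.
  convolve : Sequence → Sequence
  convolve q x = sum (λ i → w i * q (o i ℕ.+ x))

  convolve-cong : ∀ {p q} → (∀ x → p x ≡ q x) → ∀ x → convolve p x ≡ convolve q x
  convolve-cong p≗q x = sum-cong-≗ λ i → cong (w i *_) (p≗q (o i ℕ.+ x))

  convolve-+ : ∀ p q x → convolve (λ y → p y + q y) x ≡ convolve p x + convolve q x
  convolve-+ p q x = trans (sum-cong-≗ λ i → ℤ.*-distribˡ-+ (w i) _ _) (∑-distrib-+ (λ i → w i * p (o i ℕ.+ x)) _)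

  convolve-* : ∀ c q x → convolve (λ y → c * q y) x ≡ c * convolve q x
  convolve-* c q x = trans (sum-cong-≗ λ i → swap (w i) c (q (o i ℕ.+ x))) (sum-*ˡ c (λ i → w i * q (o i ℕ.+ x)))
    where
    swap : ∀ a b c → a * (b * c) ≡ b * (a * c)
    swap = solve-∀

  convolve-shift : ∀ q s x → convolve (λ y → q (s ℕ.+ y)) x ≡ convolve q (s ℕ.+ x)
  convolve-shift q s x = sum-cong-≗ λ i → cong (λ y → w i * q y) (swap s (o i) x)
    where
    swap : ∀ a b c → a ℕ.+ (b ℕ.+ c) ≡ b ℕ.+ (a ℕ.+ c)
    swap = ℕ-Solver.solve-∀

  convolve-periodic : ∀ {l q} → Periodic l q → Periodic l (convolve q)
  convolve-periodic {l} {q} per x = trans (sym (convolve-shift q l x)) (convolve-cong per x)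

  -- Summation over a full period is invariant under shifts, so the operator acts through its value
  -- at S = 1.
  convolve-total : ∀ {l q} → Periodic l q → prefix-sum l (convolve q) ≡ sum w * prefix-sum l q
  convolve-total {l} {q} per = begin
    prefix-sum l (convolve q)
      ≡⟨ prefix-sum-sum l (λ i x → w i * q (o i ℕ.+ x)) ⟩
    sum (λ i → prefix-sum l (λ x → w i * q (o i ℕ.+ x)))
      ≡⟨ sum-cong-≗ (λ i → trans (prefix-sum-* l (w i) _) (trans (cong (w i *_) (prefix-sum-periodic l {q} per (o i))) (ℤ.*-comm (w i) _))) ⟩
    sum (λ i → prefix-sum l q * w i)
      ≡⟨ sum-*ˡ (prefix-sum l q) w ⟩
    prefix-sum l q * sum w
      ≡⟨ ℤ.*-comm (prefix-sum l q) (sum w) ⟩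
    sum w * prefix-sum l q ∎
    where open ≡-Reasoning

-- Sequences of odd period

infix 4 _≈₂_
-- Congruence modulo 2 that keeps its quotient, since the descent needs the halved sequence as data.
record _≈₂_ (a b : ℤ) : Set where
  constructor congruent
  field
    quotient : ℤ
    equation : a ≡ b + pos 2 * quotient

≈₂-reflexive : ∀ {a b} → a ≡ b → a ≈₂ b
≈₂-reflexive refl = congruent 0ℤ $ sym (ℤ.+-identityʳ _)

≈₂-trans : ∀ {a b c} → a ≈₂ b → b ≈₂ c → a ≈₂ c
≈₂-trans {c = c} (congruent y refl) (congruent z refl) = congruent (z + y) $ regroup c z y
  where
  regroup : ∀ c z y → c + pos 2 * z + pos 2 * y ≡ c + pos 2 * (z + y)
  regroup = solve-∀

-- Stated for a general relation in order to serve equality and congruence modulo 2 alike.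
module _ {_~_ : ℤ → ℤ → Set} (reflexive : ∀ {a b} → a ≡ b → a ~ b)
  (transitive : ∀ {a b c} → a ~ b → b ~ c → a ~ c) where

  step-* : ∀ {a} {f : Sequence} → (∀ x → f (a ℕ.+ x) ~ f x) → ∀ (k x : ℕ) → f (k ℕ.* a ℕ.+ x) ~ f x
  step-* step zero    x = reflexive refl
  step-* {a} {f} step (suc k) x = transitive (reflexive (cong f (ℕ.+-assoc a (k ℕ.* a) x)))
    (transitive (step (k ℕ.* a ℕ.+ x)) (step-* {a} {f} step k x))

  step-1 : ∀ {f : Sequence} → (∀ x → f (suc x) ~ f x) → ∀ x → f x ~ f 0
  step-1 {f} step x = transitive
    (reflexive (cong f (sym (trans (ℕ.+-identityʳ (x ℕ.* 1)) (ℕ.*-identityʳ x))))) (step-* {1} {f} step x 0)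

  -- In the integers modulo an odd number, a is a multiple of 2 a.
  half-step : ∀ t {f : Sequence} → Periodic (1 ℕ.+ 2 ℕ.* t) f → ∀ a →
    (∀ x → f (2 ℕ.* a ℕ.+ x) ~ f x) → ∀ x → f (a ℕ.+ x) ~ f x
  half-step t {f} per a step x = transitive
    (reflexive (trans (sym (periodic-* {1 ℕ.+ 2 ℕ.* t} {f} per a (a ℕ.+ x))) (cong f (rearrange t a x))))
    (step-* {2 ℕ.* a} {f} step (suc t) x)
    where
    rearrange : ∀ t a x → a ℕ.* (1 ℕ.+ 2 ℕ.* t) ℕ.+ (a ℕ.+ x) ≡ (1 ℕ.+ t) ℕ.* (2 ℕ.* a) ℕ.+ x
    rearrange = ℕ-Solver.solve-∀

quadruple : Sequence → Sequence
quadruple q x = q x + q (2 ℕ.+ x) + (q (4 ℕ.+ x) + q (6 ℕ.+ x))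

-- `quadruple` is (1 + S²)(1 + S⁴). Modulo 2, therefore, r = (1 + S²) q is fixed by S⁴, hence by S²
-- on an odd cycle. This means that S⁴ fixes q, and halving the step twice more gives S.
≈₂-constant : ∀ t {q} → Periodic (1 ℕ.+ 2 ℕ.* t) q → (∀ x → quadruple q x ≈₂ 0ℤ) → ∀ x → q x ≈₂ q 0
≈₂-constant t {q} per even = step-1 {_≈₂_} ≈₂-reflexive ≈₂-trans {q}
  (halve₂ q per 1 (halve₂ q per 2 q-step-4))
  where
  halve₂ : ∀ f → Periodic (1 ℕ.+ 2 ℕ.* t) f → ∀ a → (∀ x → f (2 ℕ.* a ℕ.+ x) ≈₂ f x) → ∀ x → f (a ℕ.+ x) ≈₂ f x
  halve₂ f = half-step {_≈₂_} ≈₂-reflexive ≈₂-trans t {f}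
  r : Sequence
  r x = q x + q (2 ℕ.+ x)
  r-periodic : Periodic (1 ℕ.+ 2 ℕ.* t) r
  r-periodic x = cong₂ _+_ (per x) (trans (cong q (swap (1 ℕ.+ 2 ℕ.* t) x)) (per (2 ℕ.+ x)))
    where
    swap : ∀ l x → 2 ℕ.+ (l ℕ.+ x) ≡ l ℕ.+ (2 ℕ.+ x)
    swap = ℕ-Solver.solve-∀
  r-step-4 : ∀ x → r (4 ℕ.+ x) ≈₂ r x
  r-step-4 x with even x
  ... | congruent z eq = congruent (z - r x) $ solve-for (r x) (r (4 ℕ.+ x)) z eq
    where
    solve-for : ∀ a b z → a + b ≡ 0ℤ + pos 2 * z → b ≡ a + pos 2 * (z - a)
    solve-for a b z eq = trans (isolate a b) (trans (cong (_- a) eq) (collect a z))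
      where
      isolate : ∀ a b → b ≡ a + b - a
      isolate = solve-∀
      collect : ∀ a z → 0ℤ + pos 2 * z - a ≡ a + pos 2 * (z - a)
      collect = solve-∀
  q-step-4 : ∀ x → q (4 ℕ.+ x) ≈₂ q x
  q-step-4 x with halve₂ r r-periodic 2 r-step-4 x
  ... | congruent z eq = congruent z $ solve-for (q (2 ℕ.+ x)) (q (4 ℕ.+ x)) (q x) z eq
    where
    solve-for : ∀ a b c z → a + b ≡ c + a + pos 2 * z → b ≡ c + pos 2 * z
    solve-for a b c z eq = trans (isolate a b) (trans (cong (_- a) eq) (collect a c z))
      where
      isolate : ∀ a b → b ≡ a + b - a
      isolate = solve-∀
      collect : ∀ a c z → c + a + pos 2 * z - a ≡ c + pos 2 * z
      collect = solve-∀

prefix-sum-≈₂ : ∀ n q → (∀ x → q x ≈₂ q 0) → prefix-sum n q ≈₂ pos n * q 0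
prefix-sum-≈₂ zero    q q≈ = ≈₂-reflexive refl
prefix-sum-≈₂ (suc n) q q≈ with q≈ n | prefix-sum-≈₂ n q q≈
... | congruent y eq | congruent z eq′ = congruent (y + z) $ trans (cong₂ _+_ eq eq′) (trans (collect (q 0) (pos n) y z) refl)
  where
  collect : ∀ c n y z → (c + pos 2 * y) + (n * c + pos 2 * z) ≡ (1ℤ + n) * c + pos 2 * (y + z)
  collect = solve-∀

odd-multiple-even : ∀ t a {b c} → c ≡ 1ℤ + pos 2 * t → b ≈₂ c * a → b ≡ 0ℤ → a ≈₂ 0ℤ
odd-multiple-even t a {c = c} refl (congruent z eq) b≡0 = congruent (- (t * a + z)) (begin
  a ≡⟨ expand a t z ⟩
  0ℤ + pos 2 * (- (t * a + z)) + (c * a + pos 2 * z) ≡⟨ cong (0ℤ + pos 2 * (- (t * a + z)) +_) (trans (sym eq) b≡0) ⟩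
  0ℤ + pos 2 * (- (t * a + z)) + 0ℤ ≡⟨ ℤ.+-identityʳ _ ⟩
  0ℤ + pos 2 * (- (t * a + z)) ∎)
  where
  open ≡-Reasoning
  expand : ∀ a t z → a ≡ 0ℤ + pos 2 * (- (t * a + z)) + ((1ℤ + pos 2 * t) * a + pos 2 * z)
  expand = solve-∀

-- The sequence is constant modulo 2, and the nonzero total forces its sum over a period to be 0. An
-- odd number of terms of equal parity with even sum are all even, so the sequence can be halved.
vanishing : ∀ t {N} (w : Fin N → ℤ) (o : Fin N → ℕ) → sum w ≢ 0ℤ →
  let l = 1 ℕ.+ 2 ℕ.* t in
  (∀ {q} → Periodic l q → (∀ x → convolve w o q x ≡ 0ℤ) → ∀ x → quadruple q x ≈₂ 0ℤ) →
  ∀ {q} → Periodic l q → (∀ x → convolve w o q x ≡ 0ℤ) → ∀ x → q x ≡ 0ℤ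
vanishing t {N} w o total≢0 even {q} per eq =
  descent P half (proj₂ (periodic-bounded l {q} per)) (per , eq)
  where
  l = 1 ℕ.+ 2 ℕ.* t
  P : Sequence → Set
  P q = Periodic l q × (∀ x → convolve w o q x ≡ 0ℤ)
  half : ∀ {q} → P q → ∃[ q′ ] P q′ × (∀ x → q x ≡ pos 2 * q′ x)
  half {q} (per , eq) = q′ , (q′-periodic , q′-eq) , q≡2q′
    where
    constant : ∀ x → q x ≈₂ q 0
    constant = ≈₂-constant t {q} per (even {q} per eq)
    prefix-sum-0 : ∀ n → prefix-sum n (λ _ → 0ℤ) ≡ 0ℤ
    prefix-sum-0 zero    = refl
    prefix-sum-0 (suc n) = trans (ℤ.+-identityˡ _) (prefix-sum-0 n)
    period-sum : prefix-sum l q ≡ 0ℤ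
    period-sum = *-cancelʳ-≢0 total≢0 (begin
      prefix-sum l q * sum w ≡⟨ ℤ.*-comm (prefix-sum l q) (sum w) ⟩
      sum w * prefix-sum l q ≡⟨ convolve-total w o {l} {q} per ⟨
      prefix-sum l (convolve w o q) ≡⟨ prefix-sum-cong l eq ⟩
      prefix-sum l (λ _ → 0ℤ) ≡⟨ prefix-sum-0 l ⟩
      0ℤ ∎)
      where open ≡-Reasoning
    q0-even : q 0 ≈₂ 0ℤ
    q0-even = odd-multiple-even (pos t) (q 0) (cong (1ℤ +_) (ℤ.pos-* 2 t)) (prefix-sum-≈₂ l q constant) period-sum
    halves′ : ∀ x → q x ≈₂ 0ℤ
    halves′ x = ≈₂-trans (constant x) q0-even
    q′ : Sequence
    q′ x = _≈₂_.quotient (halves′ x)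
    q≡2q′ : ∀ x → q x ≡ pos 2 * q′ x
    q≡2q′ x = trans (_≈₂_.equation (halves′ x)) (ℤ.+-identityˡ _)
    q′-periodic : Periodic l q′
    q′-periodic x = ℤ.*-cancelˡ-≡ (pos 2) _ _ (trans (sym (q≡2q′ (l ℕ.+ x))) (trans (per x) (q≡2q′ x)))
    q′-eq : ∀ x → convolve w o q′ x ≡ 0ℤ
    q′-eq x = ℤ.*-cancelˡ-≡ (pos 2) _ 0ℤ (trans (sym (convolve-* w o (pos 2) q′ x))
      (trans (sym (convolve-cong w o q≡2q′ x)) (eq x)))

≈₂-+ : ∀ {a b c d} → a ≈₂ b → c ≈₂ d → a + c ≈₂ b + d
≈₂-+ {b = b} {d = d} (congruent y refl) (congruent z refl) = congruent (y + z) $ collect b d y z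
  where
  collect : ∀ b d y z → (b + pos 2 * y) + (d + pos 2 * z) ≡ (b + d) + pos 2 * (y + z)
  collect = solve-∀

≈₂-* : ∀ {a b c d} → a ≈₂ b → c ≈₂ d → a * c ≈₂ b * d
≈₂-* {b = b} {d = d} (congruent y refl) (congruent z refl) = congruent (b * z + d * y + pos 2 * (y * z)) $ collect b d y z
  where
  collect : ∀ b d y z → (b + pos 2 * y) * (d + pos 2 * z) ≡ b * d + pos 2 * (b * z + d * y + pos 2 * (y * z))
  collect = solve-∀

≈₂-sym : ∀ {a b} → a ≈₂ b → b ≈₂ a
≈₂-sym {b = b} (congruent z refl) = congruent (- z) $ collect b z
  where
  collect : ∀ b z → b ≡ b + pos 2 * z + pos 2 * - z
  collect = solve-∀

≈₂-sum : ∀ {f g : Fin n → ℤ} → (∀ i → f i ≈₂ g i) → sum f ≈₂ sum g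
≈₂-sum {zero}  f≈g = ≈₂-reflexive refl
≈₂-sum {suc n} f≈g = ≈₂-+ (f≈g zero) (≈₂-sum (f≈g ∘ suc))

1≉₂0 : 1ℤ ≈₂ 0ℤ → ⊥
1≉₂0 (congruent z eq) = contradiction (trans (cong ℤ.∣_∣ (trans eq (ℤ.+-identityˡ (pos 2 * z)))) (ℤ.abs-* (pos 2) z)) (odd≢even 0 ℤ.∣ z ∣)

alternating : Sequence
alternating zero    = 1ℤ
alternating (suc x) = - alternating x

alternating-+ : ∀ x y → alternating (x ℕ.+ y) ≡ alternating x * alternating y
alternating-+ zero    y = sym (ℤ.*-identityˡ _)
alternating-+ (suc x) y = trans (cong -_ (alternating-+ x y)) (ℤ.neg-distribˡ-* (alternating x) _)

alternating-square : ∀ x → alternating x * alternating x ≡ 1ℤ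
alternating-square zero    = refl
alternating-square (suc x) = trans (negate (alternating x)) (alternating-square x)
  where
  negate : ∀ a → - a * - a ≡ a * a
  negate = solve-∀

alternating-double : ∀ x → alternating (2 ℕ.* x) ≡ 1ℤ
alternating-double x = trans (cong (λ y → alternating (x ℕ.+ y)) (ℕ.+-identityʳ x))
  (trans (alternating-+ x x) (alternating-square x))

alternating-odd : ∀ x → alternating x ≈₂ 1ℤ
alternating-odd zero    = ≈₂-reflexive refl
alternating-odd (suc x) = ≈₂-trans (congruent (- alternating x) (flip-sign (alternating x))) (alternating-odd x)
  where
  flip-sign : ∀ a → - a ≡ a + pos 2 * - a
  flip-sign = solve-∀

alternating≢0 : ∀ x → alternating x ≢ 0ℤ
alternating≢0 x eq = 1≉₂0 (≈₂-sym (≈₂-trans (≈₂-reflexive (sym eq)) (alternating-odd x)))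

twist : Sequence → Sequence
twist q x = alternating x * q x

twist-twist : ∀ q x → alternating x * twist q x ≡ q x
twist-twist q x = trans (sym (ℤ.*-assoc (alternating x) _ (q x)))
  (trans (cong (_* q x) (alternating-square x)) (ℤ.*-identityˡ (q x)))

-- Conjugation by the twist replaces S by - S. The total of the new weights is thus the value of the
-- original polynomial at -1.
convolve-twist : ∀ {N} (w : Fin N → ℤ) (o : Fin N → ℕ) q x →
  convolve (λ i → w i * alternating (o i)) o (twist q) x ≡ alternating x * convolve w o q x
convolve-twist w o q x = trans (sum-cong-≗ λ i → begin
    w i * alternating (o i) * (alternating (o i ℕ.+ x) * q (o i ℕ.+ x))
      ≡⟨ cong (λ a → w i * alternating (o i) * (a * q (o i ℕ.+ x))) (alternating-+ (o i) x) ⟩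
    w i * alternating (o i) * (alternating (o i) * alternating x * q (o i ℕ.+ x))
      ≡⟨ regroup (w i) (alternating (o i)) (alternating x) (q (o i ℕ.+ x)) ⟩
    (alternating (o i) * alternating (o i)) * (alternating x * (w i * q (o i ℕ.+ x)))
      ≡⟨ cong (_* (alternating x * (w i * q (o i ℕ.+ x)))) (alternating-square (o i)) ⟩
    1ℤ * (alternating x * (w i * q (o i ℕ.+ x)))
      ≡⟨ ℤ.*-identityˡ _ ⟩
    alternating x * (w i * q (o i ℕ.+ x)) ∎)
  (sum-*ˡ (alternating x) (λ i → w i * q (o i ℕ.+ x)))
  where
  open ≡-Reasoning
  regroup : ∀ w a b q → w * a * (a * b * q) ≡ (a * a) * (b * (w * q))
  regroup = solve-∀

-- Recurrences with periodic solutions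

module _ {q : Sequence} {c : ℤ} (step : ∀ x → q (suc x) ≡ q x + c) where

  progression : ∀ x → q x ≡ q 0 + pos x * c
  progression zero    = sym (ℤ.+-identityʳ _)
  progression (suc x) = trans (step x) (trans (cong (_+ c) (progression x)) (collect (q 0) (pos x) c))
    where
    collect : ∀ a x c → a + x * c + c ≡ a + (1ℤ + x) * c
    collect = solve-∀

  -- Over one period the progression would drift by `l` times `c`.
  progression-constant : ∀ l .{{_ : ℕ.NonZero l}} → Periodic l q → c ≡ 0ℤ
  progression-constant (suc l) per = *-cancelʳ-≢0 {c = pos (suc l)} (λ ()) (trans (ℤ.*-comm c _)
    (AbelianGroupProperties.∙-cancelˡ ℤ.+-0-abelianGroup (q 0) _ _
      (trans (sym (progression (suc l))) (trans (cong q (sym (ℕ.+-identityʳ (suc l)))) (trans (per 0) (sym (ℤ.+-identityʳ _)))))))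

constant-from-step : ∀ {q : Sequence} → (∀ x → q (suc x) ≡ q x) → ∀ x → q x ≡ q 0
constant-from-step {q} step zero    = refl
constant-from-step {q} step (suc x) = trans (step x) (constant-from-step {q} step x)

-- The sum of the two recurrences says that g + k + u is constant, so g + k has
-- period l. Its difference then equals twice an integer combination of its own
-- shifts, hence vanishes.
module _ (l : ℕ) .{{_ : ℕ.NonZero l}} {N} (w : Fin N → ℤ) (o : Fin N → ℕ) (total≢0 : sum w ≢ 0ℤ)
  {g k : Sequence} (g-periodic : Periodic (l ℕ.+ l) g) (k-periodic : Periodic (l ℕ.+ l) k) where

  private
    p : Sequence
    p x = g x + k x

    folded : Sequence
    folded x = p x + p (l ℕ.+ x)

    u : Sequence
    u = convolve w o folded

  module _ (g-step : ∀ x → g (suc x) ≡ g x + u x) (k-step : ∀ x → k x ≡ k (suc x) + u (suc x)) where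
    private
      folded-periodic : Periodic l folded
      folded-periodic x = trans (cong (p (l ℕ.+ x) +_) (trans (cong p (sym (ℕ.+-assoc l l x)))
        (cong₂ _+_ (g-periodic x) (k-periodic x)))) (ℤ.+-comm (p (l ℕ.+ x)) (p x))

      u-periodic : Periodic l u
      u-periodic = convolve-periodic w o {l} {folded} folded-periodic

      p+u-constant : ∀ x → p x + u x ≡ p 0 + u 0
      p+u-constant = constant-from-step {λ x → p x + u x} λ x → begin
        g (suc x) + k (suc x) + u (suc x) ≡⟨ ℤ.+-assoc (g (suc x)) _ _ ⟩
        g (suc x) + (k (suc x) + u (suc x)) ≡⟨ cong₂ _+_ (g-step x) (sym (k-step x)) ⟩
        g x + u x + k x ≡⟨ swap (g x) (u x) (k x) ⟩
        g x + k x + u x ∎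
        where
        open ≡-Reasoning
        swap : ∀ a b c → a + b + c ≡ a + c + b
        swap = solve-∀

      p-periodic : Periodic l p
      p-periodic x = AbelianGroupProperties.∙-cancelʳ ℤ.+-0-abelianGroup (u x) _ _
        (trans (cong (p (l ℕ.+ x) +_) (sym (u-periodic x))) (trans (p+u-constant (l ℕ.+ x)) (sym (p+u-constant x))))

      Δ : Sequence
      Δ x = p (suc x) - p x

      folded-p : ∀ x → folded x ≡ pos 2 * p x
      folded-p x = trans (cong (p x +_) (p-periodic x)) (double (p x))
        where
        double : ∀ a → a + a ≡ pos 2 * a
        double = solve-∀

      u-p : ∀ x → u x ≡ pos 2 * convolve w o p x
      u-p x = trans (convolve-cong w o folded-p x) (convolve-* w o (pos 2) p x)

      -- By linearity, half of a solution of this equation is again a solution, and the equation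
      -- itself exhibits the half as an integer sequence.
      P : Sequence → Set
      P q = ∀ x → q x ≡ pos 2 * (- convolve w o q x)

      PΔ : P Δ
      PΔ x = begin
        p (suc x) - p x
          ≡⟨ cong₂ _-_ (solve-for (suc x)) (solve-for x) ⟩
        (p 0 + u 0 - pos 2 * cp (suc x)) - (p 0 + u 0 - pos 2 * cp x)
          ≡⟨ collect (p 0 + u 0) (cp (suc x)) (cp x) ⟩
        pos 2 * (- (cp (suc x) + ℤ.-1ℤ * cp x))
          ≡⟨ cong (λ z → pos 2 * (- z)) (sym difference) ⟩
        pos 2 * (- convolve w o Δ x) ∎
        where
        open ≡-Reasoning
        cp : Sequence
        cp = convolve w o p
        solve-for : ∀ x → p x ≡ p 0 + u 0 - pos 2 * cp x
        solve-for x = trans (isolate (p x) (u x)) (cong₂ _-_ (p+u-constant x) (u-p x))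
          where
          isolate : ∀ a b → a ≡ a + b - b
          isolate = solve-∀
        collect : ∀ c a b → (c - pos 2 * a) - (c - pos 2 * b) ≡ pos 2 * (- (a + ℤ.-1ℤ * b))
        collect = solve-∀
        difference : convolve w o Δ x ≡ cp (suc x) + ℤ.-1ℤ * cp x
        difference = trans (convolve-cong w o (λ y → cong (p (suc y) +_) (sym (ℤ.-1*i≡-i (p y)))) x)
          (trans (convolve-+ w o (p ∘ suc) (λ y → ℤ.-1ℤ * p y) x)
            (cong₂ _+_ (convolve-shift w o p 1 x) (convolve-* w o ℤ.-1ℤ p x)))

      Δ-periodic : Periodic l Δ
      Δ-periodic x = cong₂ _-_ (trans (cong p (sym (ℕ.+-suc l x))) (p-periodic (suc x))) (p-periodic x)

      half : ∀ {q} → P q → ∃[ q′ ] P q′ × (∀ x → q x ≡ pos 2 * q′ x)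
      half {q} Pq = q′ , (λ x → trans (cong -_ (trans (convolve-cong w o Pq x) (convolve-* w o (pos 2) q′ x)))
          (ℤ.neg-distribʳ-* (pos 2) (convolve w o q′ x))) , Pq
        where
        q′ : Sequence
        q′ x = - convolve w o q x

      p-constant : ∀ x → p x ≡ p 0
      p-constant = constant-from-step {p} λ x →
        ℤ.i-j≡0⇒i≡j _ _ (descent P half (proj₂ (periodic-bounded l {Δ} Δ-periodic)) PΔ x)

      u-constant : ∀ x → u x ≡ u 0
      u-constant x = AbelianGroupProperties.∙-cancelˡ ℤ.+-0-abelianGroup (p 0) _ _
        (trans (cong (_+ u x) (sym (p-constant x))) (p+u-constant x))

      -- `g` grows by the constant `u 0` at every step and yet is periodic.
      u0≡0 : u 0 ≡ 0ℤ
      u0≡0 = progression-constant (λ x → trans (g-step x) (cong (g x +_) (u-constant x))) (l ℕ.+ l)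
        {{ℕ.>-nonZero (ℕ.≤-trans (ℕ.>-nonZero⁻¹ l) (ℕ.m≤m+n l l))}} g-periodic

      -- For constant `p` the value `u 0` is 2 `p 0` times the total weight.
      p0≡0 : p 0 ≡ 0ℤ
      p0≡0 = *-cancelʳ-≢0 total≢0 (ℤ.*-cancelˡ-≡ (pos 2) _ 0ℤ (begin
        pos 2 * (p 0 * sum w) ≡⟨ cong (pos 2 *_) (sum-*ˡ (p 0) w) ⟨
        pos 2 * sum (λ i → p 0 * w i) ≡⟨ cong (pos 2 *_) (sum-cong-≗ λ i → trans (ℤ.*-comm (p 0) (w i)) (cong (w i *_) (sym (p-constant (o i ℕ.+ 0))))) ⟩
        pos 2 * convolve w o p 0 ≡⟨ u-p 0 ⟨
        u 0 ≡⟨ u0≡0 ⟩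
        pos 2 * 0ℤ ∎))
        where open ≡-Reasoning

    recurrence-constant : (∀ x → g x ≡ g 0) × (∀ x → k x ≡ - g 0)
    recurrence-constant = g-constant , λ x → trans (isolate (g x) (k x))
        (trans (cong₂ _-_ (trans (p-constant x) p0≡0) (g-constant x)) (ℤ.+-identityˡ _))
      where
      g-constant : ∀ x → g x ≡ g 0
      g-constant = constant-from-step {g} λ x →
        trans (g-step x) (trans (cong (g x +_) (trans (u-constant x) u0≡0)) (ℤ.+-identityʳ _))
      isolate : ∀ a b → b ≡ a + b - a
      isolate = solve-∀

-- Modulo 2 such an operator consists of its first four shifts, whatever set is encoded in the tail.
OddHead : ∀ {N} → (Fin (4 ℕ.+ N) → ℤ) → Set
OddHead {N} w = (∀ i → w (i ↑ˡ N) ≈₂ 1ℤ) × (∀ i → w (4 ↑ʳ i) ≈₂ 0ℤ)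

OddHead-twist : ∀ {N} {w : Fin (4 ℕ.+ N) → ℤ} {o : Fin (4 ℕ.+ N) → ℕ} → OddHead w → OddHead (λ i → w i * alternating (o i))
OddHead-twist {N} {w} {o} (odd , even) =
    (λ i → ≈₂-trans (≈₂-* (odd i) (alternating-odd (o (i ↑ˡ N)))) (≈₂-reflexive refl))
  , (λ i → ≈₂-trans (≈₂-* (even i) (alternating-odd (o (4 ↑ʳ i)))) (≈₂-reflexive refl))

head-sum : ∀ {N} → (Fin (4 ℕ.+ N) → ℕ) → Sequence → Sequence
head-sum o q x = q (o zero ℕ.+ x) + q (o (suc zero) ℕ.+ x)
  + (q (o (suc (suc zero)) ℕ.+ x) + q (o (suc (suc (suc zero))) ℕ.+ x))

-- Modulo 2, every sequence of period l annihilated by the four-term operator is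
-- annihilated by 1 + S² + S⁴ + S⁶, where S is the shift.
QuadrupleShape : ∀ {N} → ℕ → (Fin (4 ℕ.+ N) → ℕ) → Set
QuadrupleShape l o = ∀ {q} → Periodic l q → (∀ x → head-sum o q x ≈₂ 0ℤ) → ∀ x → quadruple q x ≈₂ 0ℤ

OddHead-convolve : ∀ {N} {w : Fin (4 ℕ.+ N) → ℤ} {o : Fin (4 ℕ.+ N) → ℕ} → OddHead w →
  ∀ q x → convolve w o q x ≈₂ head-sum o q x
OddHead-convolve {N} {w} {o} (odd , even) q x = ≈₂-trans
  (≈₂-+ (unit zero) (≈₂-+ (unit (suc zero)) (≈₂-+ (unit (suc (suc zero))) (≈₂-+ (unit (suc (suc (suc zero)))) rest))))
  (≈₂-reflexive (collect (q (o zero ℕ.+ x)) (q (o (suc zero) ℕ.+ x)) (q (o (suc (suc zero)) ℕ.+ x)) (q (o (suc (suc (suc zero))) ℕ.+ x))))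
  where
  unit : ∀ i → w (i ↑ˡ N) * q (o (i ↑ˡ N) ℕ.+ x) ≈₂ 1ℤ * q (o (i ↑ˡ N) ℕ.+ x)
  unit i = ≈₂-* (odd i) (≈₂-reflexive refl)
  rest : sum (λ i → w (4 ↑ʳ i) * q (o (4 ↑ʳ i) ℕ.+ x)) ≈₂ 0ℤ
  rest = ≈₂-trans (≈₂-sum λ i → ≈₂-* (even i) (≈₂-reflexive {q (o (4 ↑ʳ i) ℕ.+ x)} refl))
    (≈₂-reflexive (sum-0 {f = λ i → 0ℤ * q (o (4 ↑ʳ i) ℕ.+ x)} λ i → refl))
  collect : ∀ a b c d → 1ℤ * a + (1ℤ * b + (1ℤ * c + (1ℤ * d + 0ℤ))) ≡ a + b + (c + d)
  collect = solve-∀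

OddHead-vanishing : ∀ t {N} (w : Fin (4 ℕ.+ N) → ℤ) (o : Fin (4 ℕ.+ N) → ℕ) → OddHead w →
  QuadrupleShape (1 ℕ.+ 2 ℕ.* t) o → sum w ≢ 0ℤ →
  ∀ {q} → Periodic (1 ℕ.+ 2 ℕ.* t) q → (∀ x → convolve w o q x ≡ 0ℤ) → ∀ x → q x ≡ 0ℤ
OddHead-vanishing t w o oddHead shape total≢0 = vanishing t w o total≢0 λ {q} per eq →
  shape per λ x → ≈₂-trans (≈₂-sym (OddHead-convolve {w = w} {o} oddHead q x)) (≈₂-reflexive (eq x))

-- Sequences of period 2 l, for l odd, split into an l-periodic and an
-- l-antiperiodic part; twisting makes the latter l-periodic as well.
module _ (t : ℕ) {N} (w : Fin (4 ℕ.+ N) → ℤ) (o : Fin (4 ℕ.+ N) → ℕ) (oddHead : OddHead w)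
  (shape : QuadrupleShape (1 ℕ.+ 2 ℕ.* t) o)
  (twisted-total≢0 : sum (λ i → w i * alternating (o i)) ≢ 0ℤ) where

  private
    l = 1 ℕ.+ 2 ℕ.* t

  module _ {q} (per : Periodic (l ℕ.+ l) q) (eq : ∀ x → convolve w o q x ≡ 0ℤ) where
    private
      return : ∀ x → q (l ℕ.+ (l ℕ.+ x)) ≡ q x
      return x = trans (cong q (sym (ℕ.+-assoc l l x))) (per x)

    even-part odd-part : Sequence
    even-part x = q x + q (l ℕ.+ x)
    odd-part x = q x + ℤ.-1ℤ * q (l ℕ.+ x)

    even-part-periodic : Periodic l even-part
    even-part-periodic x = trans (cong (q (l ℕ.+ x) +_) (return x)) (ℤ.+-comm (q (l ℕ.+ x)) (q x))

    even-part-equation : ∀ x → convolve w o even-part x ≡ 0ℤ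
    even-part-equation x = trans (convolve-+ w o q (λ y → q (l ℕ.+ y)) x)
      (cong₂ _+_ (eq x) (trans (convolve-shift w o q l x) (eq (l ℕ.+ x))))

    odd-part-equation : ∀ x → convolve w o odd-part x ≡ 0ℤ
    odd-part-equation x = trans (convolve-+ w o q (λ y → ℤ.-1ℤ * q (l ℕ.+ y)) x)
      (cong₂ _+_ (eq x) (trans (convolve-* w o ℤ.-1ℤ (λ y → q (l ℕ.+ y)) x)
        (cong (ℤ.-1ℤ *_) (trans (convolve-shift w o q l x) (eq (l ℕ.+ x))))))

    odd-part-vanishes : ∀ x → q x ≡ q (l ℕ.+ x)
    odd-part-vanishes x = ℤ.i-j≡0⇒i≡j _ _ (trans (cong (q x +_) (sym (ℤ.-1*i≡-i (q (l ℕ.+ x)))))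
      (trans (sym (twist-twist odd-part x)) (trans (cong (alternating x *_) (twisted≡0 x)) (ℤ.*-zeroʳ (alternating x)))))
      where
      -- As `l` is odd, the alternating sign and `odd-part` both change sign under the shift by `l`.
      twisted-periodic : Periodic l (twist odd-part)
      twisted-periodic x = trans (cong₂ _*_
        (trans (alternating-+ l x) (cong (λ a → - a * alternating x) (alternating-double t)))
        (cong (λ z → q (l ℕ.+ x) + ℤ.-1ℤ * z) (return x)))
        (flip-both (alternating x) (q x) (q (l ℕ.+ x)))
        where
        flip-both : ∀ a b c → - 1ℤ * a * (c + ℤ.-1ℤ * b) ≡ a * (b + ℤ.-1ℤ * c)
        flip-both = solve-∀
      twisted≡0 : ∀ x → twist odd-part x ≡ 0ℤ
      twisted≡0 = OddHead-vanishing t (λ i → w i * alternating (o i)) o (OddHead-twist {w = w} {o} oddHead) shape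
        twisted-total≢0 {twist odd-part} twisted-periodic
        λ x → trans (convolve-twist w o odd-part x) (trans (cong (alternating x *_) (odd-part-equation x)) (ℤ.*-zeroʳ (alternating x)))

    private
      doubled : ∀ x → even-part x ≡ pos 2 * q x
      doubled x = trans (cong (q x +_) (sym (odd-part-vanishes x))) (double (q x))
        where
        double : ∀ a → a + a ≡ pos 2 * a
        double = solve-∀

    doubled-vanishing : sum w ≢ 0ℤ → ∀ x → q x ≡ 0ℤ
    doubled-vanishing total≢0 x = ℤ.*-cancelˡ-≡ (pos 2) _ 0ℤ (trans (sym (doubled x))
      (OddHead-vanishing t w o oddHead shape total≢0 {even-part} even-part-periodic even-part-equation x))

    doubled-constant : (∀ {f} → Periodic l f → (∀ x → convolve w o f x ≡ 0ℤ) → ∀ x → f x ≡ f 0) → ∀ x → q x ≡ q 0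
    doubled-constant constant x = ℤ.*-cancelˡ-≡ (pos 2) _ _ (trans (sym (doubled x))
      (trans (constant {even-part} even-part-periodic even-part-equation x) (doubled 0)))

second-difference-constant : ∀ l .{{_ : ℕ.NonZero l}} {f} → Periodic l f →
  (∀ x → f x + f (2 ℕ.+ x) ≡ f (1 ℕ.+ x) + f (1 ℕ.+ x)) → ∀ x → f x ≡ f 0
second-difference-constant l {f} per eq = constant-from-step {f} λ x →
  trans (step x) (trans (cong (f x +_) (progression-constant step l per)) (ℤ.+-identityʳ (f x)))
  where
  Δ-constant : ∀ x → f (1 ℕ.+ x) - f x ≡ f 1 - f 0
  Δ-constant = constant-from-step {λ x → f (1 ℕ.+ x) - f x} λ x → solve-for (f x) (f (1 ℕ.+ x)) (f (2 ℕ.+ x)) (eq x)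
    where
    solve-for : ∀ a b c → a + c ≡ b + b → c - b ≡ b - a
    solve-for a b c eq = trans (isolate a b c) (trans (cong (_- (a + b)) eq) (collect a b))
      where
      isolate : ∀ a b c → c - b ≡ a + c - (a + b)
      isolate = solve-∀
      collect : ∀ a b → b + b - (a + b) ≡ b - a
      collect = solve-∀
  step : ∀ x → f (suc x) ≡ f x + (f 1 - f 0)
  step x = trans (isolate (f x) (f (suc x))) (cong (f x +_) (Δ-constant x))
    where
    isolate : ∀ a b → b ≡ a + (b - a)
    isolate = solve-∀

-- The equation is (1 - S²)(1 - S⁴) f = 0, so r = (S² - 1) f is fixed by S⁴ and hence constant on an
-- odd cycle. The terms f (2 y) then form a periodic arithmetic progression, so its difference `c`
-- is 0.
quadruple-constant : ∀ t {f} → Periodic (1 ℕ.+ 2 ℕ.* t) f →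
  (∀ x → f (2 ℕ.+ x) + f (4 ℕ.+ x) ≡ f x + f (6 ℕ.+ x)) → ∀ x → f x ≡ f 0
quadruple-constant t {f} per eq = constant-from-step {f} (halve₁ f per 1 λ x →
    trans (step-2 x) (trans (cong (f x +_) c≡0) (ℤ.+-identityʳ (f x))))
  where
  l = 1 ℕ.+ 2 ℕ.* t
  halve₁ : ∀ f → Periodic l f → ∀ a → (∀ x → f (2 ℕ.* a ℕ.+ x) ≡ f x) → ∀ x → f (a ℕ.+ x) ≡ f x
  halve₁ f = half-step {_≡_} (λ eq → eq) trans t {f}
  r : Sequence
  r x = f (2 ℕ.+ x) - f x
  swap : ∀ a l x → a ℕ.+ (l ℕ.+ x) ≡ l ℕ.+ (a ℕ.+ x)
  swap = ℕ-Solver.solve-∀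
  r-periodic : Periodic l r
  r-periodic x = cong₂ _-_ (trans (cong f (swap 2 l x)) (per (2 ℕ.+ x))) (per x)
  r-step-4 : ∀ x → r (4 ℕ.+ x) ≡ r x
  r-step-4 x = solve-for (f x) (f (2 ℕ.+ x)) (f (4 ℕ.+ x)) (f (6 ℕ.+ x)) (eq x)
    where
    solve-for : ∀ a b c d → b + c ≡ a + d → d - c ≡ b - a
    solve-for a b c d eq = trans (isolate a c d) (trans (cong (_- (a + c)) (sym eq)) (collect a b c))
      where
      isolate : ∀ a c d → d - c ≡ a + d - (a + c)
      isolate = solve-∀
      collect : ∀ a b c → b + c - (a + c) ≡ b - a
      collect = solve-∀
  c : ℤ
  c = r 0
  r-constant : ∀ x → r x ≡ c
  r-constant = constant-from-step {r} (halve₁ r r-periodic 1 (halve₁ r r-periodic 2 r-step-4))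
  step-2 : ∀ x → f (2 ℕ.+ x) ≡ f x + c
  step-2 x = trans (isolate (f x) (f (2 ℕ.+ x))) (cong (f x +_) (r-constant x))
    where
    isolate : ∀ a b → b ≡ a + (b - a)
    isolate = solve-∀
  c≡0 : c ≡ 0ℤ
  c≡0 = progression-constant {λ y → f (2 ℕ.* y)}
    (λ y → trans (cong f (ℕ.*-suc 2 y)) (step-2 (2 ℕ.* y))) l
    (λ y → trans (cong f (rearrange l y)) (trans (per (l ℕ.+ 2 ℕ.* y)) (per (2 ℕ.* y))))
    where
    rearrange : ∀ l y → 2 ℕ.* (l ℕ.+ y) ≡ l ℕ.+ (l ℕ.+ 2 ℕ.* y)
    rearrange = ℕ-Solver.solve-∀

-- Dihedrants with symmetric reflection sets: R and T differ from a common set W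
-- in two elements each, and the kernel equations decouple into one for g + k and
-- one for g - k.
module SymmetricReflections (m : ℕ) .{{_ : ℕ.NonZero m}} (α β γ δ : ℕ) (W : Fin m → Bool) where
  open Cyclic m
  open Dihedral m

  R T : Fin m → Bool
  R = [ α ] ⊕ [ β ] ⊕ W
  T = [ γ ] ⊕ [ δ ] ⊕ W

  heads : Fin 4 → ℕ
  heads = α ∷ᶠ β ∷ᶠ γ ∷ᶠ δ ∷ᶠ λ ()

  offsets : Fin (4 ℕ.+ m) → ℕ
  offsets = α ∷ᶠ β ∷ᶠ γ ∷ᶠ δ ∷ᶠ toℕ

  -- Coefficients of R + T: the common set `W` counts twice. In R - T, described by
  -- `difference-weights`, it cancels.
  sum-weights : Fin (4 ℕ.+ m) → ℤ
  sum-weights = 1ℤ ∷ᶠ 1ℤ ∷ᶠ 1ℤ ∷ᶠ 1ℤ ∷ᶠ λ i → on (W i) (pos 2)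

  difference-weights : Fin 4 → ℤ
  difference-weights = 1ℤ ∷ᶠ 1ℤ ∷ᶠ ℤ.-1ℤ ∷ᶠ ℤ.-1ℤ ∷ᶠ λ ()

  sum-weights-odd : OddHead sum-weights
  sum-weights-odd = (λ { zero → r ; (suc zero) → r ; (suc (suc zero)) → r ; (suc (suc (suc zero))) → r })
    , λ i → even (W i)
    where
    r : 1ℤ ≈₂ 1ℤ
    r = ≈₂-reflexive refl
    even : ∀ b → on b (pos 2) ≈₂ 0ℤ
    even true  = congruent 1ℤ refl
    even false = ≈₂-reflexive refl

  difference-weights-odd : OddHead difference-weights
  difference-weights-odd = (λ { zero → r ; (suc zero) → r ; (suc (suc zero)) → r′ ; (suc (suc (suc zero))) → r′ })
    , λ ()
    where
    r : 1ℤ ≈₂ 1ℤ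
    r = ≈₂-reflexive refl
    r′ : ℤ.-1ℤ ≈₂ 1ℤ
    r′ = congruent ℤ.-1ℤ refl

  ∑-double : ∀ (f : Fin m → ℤ) → sum (λ i → on (W i) (pos 2) * f i) ≡ pos 2 * ∑[ W ] f
  ∑-double f = trans (sum-cong-≗ λ i → on-2 (W i) (f i)) (sum-*ˡ (pos 2) (λ i → on (W i) (f i)))
    where
    on-2 : ∀ b z → on b (pos 2) * z ≡ pos 2 * on b z
    on-2 true  z = refl
    on-2 false z = refl

  module _
    (β∉W : W [ β ] ≡ false) (α∉W : ([ β ] ⊕ W) [ α ] ≡ false)
    (δ∉W : W [ δ ] ≡ false) (γ∉W : ([ δ ] ⊕ W) [ γ ] ≡ false)
    (0∉R : R [ 0 ] ≡ false) (R-sym : ∀ a → R (⊟ a) ≡ R a) (T-sym : ∀ a → T (⊟ a) ≡ T a)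
    (sums-vanish : ∀ {p} → Periodic m p → (∀ x → convolve sum-weights offsets p x ≡ 0ℤ) → ∀ x → p x ≡ 0ℤ)
    (differences-constant : ∀ {q} → Periodic m q → (∀ x → convolve difference-weights heads q x ≡ 0ℤ) → ∀ x → q x ≡ q 0)
    (2≤m+m : 2 ≤ m ℕ.+ m) where

    private
      count-R : count R ≡ 2 ℕ.+ count W
      count-R = trans (count-⊕ [ α ] ([ β ] ⊕ W) α∉W) (cong suc (count-⊕ [ β ] W β∉W))

      count-T : count T ≡ 2 ℕ.+ count W
      count-T = trans (count-⊕ [ γ ] ([ δ ] ⊕ W) γ∉W) (cong suc (count-⊕ [ δ ] W δ∉W))

      ∑W : (Fin m → ℤ) → ℕ → ℤ
      ∑W f x = ∑[ W ] (λ a → f [ toℕ a ℕ.+ x ])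

      expand : ∀ y z (f : Fin m → ℤ) → W [ z ] ≡ false → ([ z ] ⊕ W) [ y ] ≡ false → ∀ x →
        ∑[ [ y ] ⊕ [ z ] ⊕ W ] (λ a → f (a ⊞ [ x ])) ≡ f [ y ℕ.+ x ] + (f [ z ℕ.+ x ] + ∑W f x)
      expand y z f z∉W y∉W x = trans (∑-⊕ [ y ] ([ z ] ⊕ W) _ y∉W) (cong₂ _+_ (cong f ([]-⊞ y x))
        (trans (∑-⊕ [ z ] W _ z∉W) (cong₂ _+_ (cong f ([]-⊞ z x)) (∑-congʳ W λ a → cong f (⊞-[] a x)))))

    module _ {g k : Fin m → ℤ} (solution : Solution R T 0∉R R-sym g k) where
      open Solution solution

      private
        p q : Fin m → ℤ
        p a = g a + k a
        q a = g a + ℤ.-1ℤ * k a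

        rotations′ : ∀ x → (g [ α ℕ.+ x ] + (g [ β ℕ.+ x ] + ∑W g x)) + (k [ γ ℕ.+ x ] + (k [ δ ℕ.+ x ] + ∑W k x)) ≡ 0ℤ
        rotations′ x = trans (sym (cong₂ _+_ (expand α β g β∉W α∉W x) (expand γ δ k δ∉W γ∉W x))) (rotations [ x ])

        reflections′ : ∀ x → (k [ α ℕ.+ x ] + (k [ β ℕ.+ x ] + ∑W k x)) + (g [ γ ℕ.+ x ] + (g [ δ ℕ.+ x ] + ∑W g x)) ≡ 0ℤ
        reflections′ x = trans (sym (cong₂ _+_ (expand α β k β∉W α∉W x)
          (trans (∑-reflect T T-sym g [ x ]) (expand γ δ g δ∉W γ∉W x)))) (reflections [ x ])

        p-equation : ∀ x → convolve sum-weights offsets (λ y → p [ y ]) x ≡ 0ℤ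
        p-equation x = begin
          convolve sum-weights offsets (λ y → p [ y ]) x
            ≡⟨ cong (λ z → 1ℤ * pα + (1ℤ * pβ + (1ℤ * pγ + (1ℤ * pδ + z)))) (trans (∑-double (λ i → p [ toℕ i ℕ.+ x ])) (cong (pos 2 *_) (∑-+ W _ _))) ⟩
          1ℤ * pα + (1ℤ * pβ + (1ℤ * pγ + (1ℤ * pδ + pos 2 * (∑W g x + ∑W k x))))
            ≡⟨ regroup (g [ α ℕ.+ x ]) (k [ α ℕ.+ x ]) (g [ β ℕ.+ x ]) (k [ β ℕ.+ x ]) (g [ γ ℕ.+ x ]) (k [ γ ℕ.+ x ]) (g [ δ ℕ.+ x ]) (k [ δ ℕ.+ x ]) (∑W g x) (∑W k x) ⟩
          ((g [ α ℕ.+ x ] + (g [ β ℕ.+ x ] + ∑W g x)) + (k [ γ ℕ.+ x ] + (k [ δ ℕ.+ x ] + ∑W k x)))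
            + ((k [ α ℕ.+ x ] + (k [ β ℕ.+ x ] + ∑W k x)) + (g [ γ ℕ.+ x ] + (g [ δ ℕ.+ x ] + ∑W g x)))
            ≡⟨ cong₂ _+_ (rotations′ x) (reflections′ x) ⟩
          0ℤ ∎
          where
          open ≡-Reasoning
          pα = p [ α ℕ.+ x ]
          pβ = p [ β ℕ.+ x ]
          pγ = p [ γ ℕ.+ x ]
          pδ = p [ δ ℕ.+ x ]
          regroup : ∀ a a′ b b′ c c′ d d′ s s′ →
            1ℤ * (a + a′) + (1ℤ * (b + b′) + (1ℤ * (c + c′) + (1ℤ * (d + d′) + pos 2 * (s + s′))))
            ≡ ((a + (b + s)) + (c′ + (d′ + s′))) + ((a′ + (b′ + s′)) + (c + (d + s)))
          regroup = solve-∀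

        q-equation : ∀ x → convolve difference-weights heads (λ y → q [ y ]) x ≡ 0ℤ
        q-equation x = trans
          (regroup (g [ α ℕ.+ x ]) (k [ α ℕ.+ x ]) (g [ β ℕ.+ x ]) (k [ β ℕ.+ x ]) (g [ γ ℕ.+ x ]) (k [ γ ℕ.+ x ]) (g [ δ ℕ.+ x ]) (k [ δ ℕ.+ x ]) (∑W g x) (∑W k x))
          (cong₂ _-_ (rotations′ x) (reflections′ x))
          where
          regroup : ∀ a a′ b b′ c c′ d d′ s s′ →
            1ℤ * (a + ℤ.-1ℤ * a′) + (1ℤ * (b + ℤ.-1ℤ * b′) + (ℤ.-1ℤ * (c + ℤ.-1ℤ * c′) + (ℤ.-1ℤ * (d + ℤ.-1ℤ * d′) + 0ℤ)))
            ≡ ((a + (b + s)) + (c′ + (d′ + s′))) - ((a′ + (b′ + s′)) + (c + (d + s)))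
          regroup = solve-∀

        p≡0 : ∀ x → g [ x ] + k [ x ] ≡ 0ℤ
        p≡0 = sums-vanish {λ y → p [ y ]} (λ x → cong p ([]-periodic x)) p-equation

        k≡-g : ∀ x → k [ x ] ≡ - g [ x ]
        k≡-g x = trans (isolate (g [ x ]) (k [ x ])) (trans (cong (_- g [ x ]) (p≡0 x)) (ℤ.+-identityˡ _))
          where
          isolate : ∀ a b → b ≡ a + b - a
          isolate = solve-∀

        q≡2g : ∀ x → q [ x ] ≡ pos 2 * g [ x ]
        q≡2g x = trans (cong (λ z → g [ x ] + ℤ.-1ℤ * z) (k≡-g x)) (collect (g [ x ]))
          where
          collect : ∀ a → a + ℤ.-1ℤ * - a ≡ pos 2 * a
          collect = solve-∀

        g-constant : ∀ x → g [ x ] ≡ g [ 0 ]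
        g-constant x = ℤ.*-cancelˡ-≡ (pos 2) _ _ (trans (sym (q≡2g x))
          (trans (differences-constant {λ y → q [ y ]} (λ x → cong q ([]-periodic x)) q-equation x) (q≡2g 0)))

      -- Since g + k vanishes, g - k is 2 g, and the constancy of the difference passes to `g`.
      solution-constant : ∃[ c ] (∀ a → g a ≡ c * 1ℤ) × (∀ a → k a ≡ - (c * 1ℤ))
      solution-constant = g [ 0 ] , g≡ , k≡
        where
        g≡ : ∀ a → g a ≡ g [ 0 ] * 1ℤ
        g≡ a = trans (cong g (sym ([toℕ] a))) (trans (g-constant (toℕ a)) (sym (ℤ.*-identityʳ _)))
        k≡ : ∀ a → k a ≡ - (g [ 0 ] * 1ℤ)
        k≡ a = trans (cong k (sym ([toℕ] a))) (trans (k≡-g (toℕ a)) (cong -_ (trans (cong g ([toℕ] a)) (g≡ a))))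

    in-𝔑-Cay : 𝔑-Cay ((2 ℕ.+ count W) ℕ.+ (2 ℕ.+ count W)) (m ℕ.+ m)
    in-𝔑-Cay = subst (λ d → 𝔑-Cay d (m ℕ.+ m)) (cong₂ ℕ._+_ count-R count-T)
      (dihedrant-in-𝔑-Cay R T 0∉R R-sym {λ _ → 1ℤ}
        (record { homo = λ _ _ → refl ; even = λ _ → refl ; nonzero = λ _ () })
        (trans (sym (+count R)) (trans (cong pos (trans count-R (sym count-T))) (+count T))) 2≤m+m
        λ g k → solution-constant)

-- Sets given by lists, and totals of weights

⟦_⟧ : List (Fin n) → Fin n → Bool
⟦ xs ⟧ = foldr _⊕_ ∅ₛ xs

∈-⊕ˡ : ∀ (x : Fin n) W → (x ⊕ W) x ≡ true
∈-⊕ˡ x W = cong (_∨ W x) (≡ᵇ-refl x)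

∈-⊕ʳ : ∀ (x : Fin n) W {y} → W y ≡ true → (x ⊕ W) y ≡ true
∈-⊕ʳ x W {y} y∈W = trans (cong ((x ≡ᵇ y) ∨_) y∈W) (Bool.∨-zeroʳ (x ≡ᵇ y))

∈-⟦⟧ : ∀ {x : Fin n} {xs} → x ∈ₗ xs → ⟦ xs ⟧ x ≡ true
∈-⟦⟧ {xs = x ∷ xs} (here refl)   = ∈-⊕ˡ x ⟦ xs ⟧
∈-⟦⟧ {xs = y ∷ xs} (there x∈xs) = ∈-⊕ʳ y ⟦ xs ⟧ (∈-⟦⟧ x∈xs)

count-⟦⟧ : ∀ (xs : List (Fin n)) → count ⟦ xs ⟧ ≤ length xs
count-⟦⟧ {n} [] = ℕ.≤-reflexive (count-∅ {n})
count-⟦⟧ (x ∷ xs) = ℕ.≤-trans (count-⊕-≤ x ⟦ xs ⟧) (s≤s (count-⟦⟧ xs))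

∉-⊕ : ∀ (x : Fin n) W {y} → (x ≡ᵇ y) ≡ false → W y ≡ false → (x ⊕ W) y ≡ false
∉-⊕ x W x≢y y∉W = cong₂ _∨_ x≢y y∉W

below : ∀ {x y} k → x ℕ.+ suc k ≡ y → x < y
below {x} k refl = ℕ.≤-trans (ℕ.≤-reflexive (ℕ.+-comm 1 x)) (ℕ.+-monoʳ-≤ x (s≤s z≤n))

wrap : ∀ {l q} → Periodic l q → ∀ k {a y} → a ≡ k ℕ.* l ℕ.+ y → q a ≡ q y
wrap {l} {q} per k {y = y} refl = periodic-* {l} {q} per k y

-- The total is 4 plus twice the size of `W`, hence positive.
weights-total : ∀ {m} .{{_ : ℕ.NonZero m}} α β γ δ (W : Fin m → Bool) →
  sum (SymmetricReflections.sum-weights m α β γ δ W) ≢ 0ℤ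
weights-total α β γ δ W eq = contradiction (trans (sym (cong (λ z → 1ℤ + (1ℤ + (1ℤ + (1ℤ + z))))
  (trans (∑-const W (pos 2)) (sym (ℤ.pos-* (count W) 2))))) eq) λ ()

-- All signs are odd, so the parity of the size decides. This keeps twisted totals from vanishing
-- although `W` is not known explicitly.
∑-alternating : ∀ (W : Fin m → Bool) → ∑[ W ] (λ i → alternating (toℕ i)) ≈₂ pos (count W)
∑-alternating W = ≈₂-trans (≈₂-sum λ i → on-≈₂ (W i) (alternating-odd (toℕ i))) (≈₂-reflexive (sym (+count W)))
  where
  on-≈₂ : ∀ b {x y} → x ≈₂ y → on b x ≈₂ on b y
  on-≈₂ true  x≈y = x≈y
  on-≈₂ false _   = ≈₂-reflexive refl

even-≈₂ : ∀ i → pos (i ℕ.* 2) ≈₂ 0ℤ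
even-≈₂ i = congruent (pos i) (trans (ℤ.pos-* i 2) (trans (ℤ.*-comm (pos i) (pos 2)) (sym (ℤ.+-identityˡ _))))

-- The heads ±3 and ±1 in the order 3, -3, 1, -1, shifted by 3.
record OneThree (l α β γ δ : ℕ) : Set where
  field
    plus-three  : ∀ {q} → Periodic l q → ∀ x → q (α ℕ.+ (3 ℕ.+ x)) ≡ q (6 ℕ.+ x)
    minus-three : ∀ {q} → Periodic l q → ∀ x → q (β ℕ.+ (3 ℕ.+ x)) ≡ q x
    plus-one    : ∀ {q} → Periodic l q → ∀ x → q (γ ℕ.+ (3 ℕ.+ x)) ≡ q (4 ℕ.+ x)
    minus-one   : ∀ {q} → Periodic l q → ∀ x → q (δ ℕ.+ (3 ℕ.+ x)) ≡ q (2 ℕ.+ x)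

OneThree-shape : ∀ {l N} {o : Fin (4 ℕ.+ N) → ℕ} →
  OneThree l (o zero) (o (suc zero)) (o (suc (suc zero))) (o (suc (suc (suc zero)))) → QuadrupleShape l o
OneThree-shape {l} {N} {o} ot {q} per even x = ≈₂-trans (≈₂-reflexive (begin
    q x + q (2 ℕ.+ x) + (q (4 ℕ.+ x) + q (6 ℕ.+ x)) ≡⟨ reorder (q x) (q (2 ℕ.+ x)) (q (4 ℕ.+ x)) (q (6 ℕ.+ x)) ⟩
    q (6 ℕ.+ x) + q x + (q (4 ℕ.+ x) + q (2 ℕ.+ x)) ≡⟨ cong₂ _+_ (cong₂ _+_ (plus-three {q} per x) (minus-three {q} per x)) (cong₂ _+_ (plus-one {q} per x) (minus-one {q} per x)) ⟨
    head-sum o q (3 ℕ.+ x) ∎)) (even (3 ℕ.+ x))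
  where
  open ≡-Reasoning
  open OneThree ot
  reorder : ∀ a b c d → a + b + (c + d) ≡ d + a + (c + b)
  reorder = solve-∀

module _ {m} .{{_ : ℕ.NonZero m}} (α β γ δ : ℕ) (W : Fin m → Bool) where
  open SymmetricReflections m α β γ δ W

  OneThree-constant : ∀ t → OneThree (1 ℕ.+ 2 ℕ.* t) α β γ δ → ∀ {q} → Periodic (1 ℕ.+ 2 ℕ.* t) q →
    (∀ x → convolve difference-weights heads q x ≡ 0ℤ) → ∀ x → q x ≡ q 0
  OneThree-constant t ot {q} per eq = quadruple-constant t per λ x → solve-for (q x) (q (2 ℕ.+ x)) (q (4 ℕ.+ x)) (q (6 ℕ.+ x))
    (trans (sym (cong₂ _+_ (cong (1ℤ *_) (plus-three {q} per x)) (cong₂ _+_ (cong (1ℤ *_) (minus-three {q} per x))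
      (cong₂ _+_ (cong (ℤ.-1ℤ *_) (plus-one {q} per x)) (cong (λ z → ℤ.-1ℤ * z + 0ℤ) (minus-one {q} per x)))))) (eq (3 ℕ.+ x)))
    where
    open OneThree ot
    solve-for : ∀ a b c d → 1ℤ * d + (1ℤ * a + (ℤ.-1ℤ * c + (ℤ.-1ℤ * b + 0ℤ))) ≡ 0ℤ → b + c ≡ a + d
    solve-for a b c d eq = trans (isolate a b c d) (trans (cong (λ z → a + d - z) eq) (ℤ.+-identityʳ (a + d)))
      where
      isolate : ∀ a b c d → b + c ≡ a + d - (1ℤ * d + (1ℤ * a + (ℤ.-1ℤ * c + (ℤ.-1ℤ * b + 0ℤ))))
      isolate = solve-∀

  twisted-total : sum (λ i → sum-weights i * alternating (offsets i)) ≡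
    alternating α + (alternating β + (alternating γ + (alternating δ + pos 2 * ∑[ W ] (λ i → alternating (toℕ i)))))
  twisted-total = cong₂ _+_ (ℤ.*-identityˡ (alternating α)) (cong₂ _+_ (ℤ.*-identityˡ (alternating β)) (cong₂ _+_ (ℤ.*-identityˡ (alternating γ))
    (cong₂ _+_ (ℤ.*-identityˡ (alternating δ)) (∑-double (λ i → alternating (toℕ i))))))

module CyclicSelection (M : ℕ) .{{_ : ℕ.NonZero M}} where
  open Cyclic M public
  open Symmetric ⊟_ ⊟-involutive public

  distinct : ∀ {x y} → x < M → y < M → x ≢ y → ([ x ] ≡ᵇ [ y ]) ≡ false
  distinct x<m y<m x≢y = ≡ᵇ-≢ λ eq → x≢y ([]-injective x<m y<m eq)

  -[0] : ⊟ [ 0 ] ≡ [ 0 ]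
  -[0] = trans (⊟-complement {0} {M} refl) [m]≡[0]

  self-inverse : ∀ l → M ≡ l ℕ.+ l → ∀ {x} → ⊟ x ≡ x → x ≡ [ 0 ] ⊎ x ≡ [ l ]
  self-inverse l M≡l+l {x} fixed with ⊟-fixed fixed
  ... | inj₁ x≡0   = inj₁ x≡0
  ... | inj₂ x+x≡M = inj₂ (trans (sym ([toℕ] x)) (cong [_]
    (ℕ.*-cancelˡ-≡ (toℕ x) l 2 (trans (double (toℕ x)) (trans x+x≡M (trans M≡l+l (sym (double l))))))))
    where
    double : ∀ k → 2 ℕ.* k ≡ k ℕ.+ k
    double = ℕ-Solver.solve-∀

  -- The points to avoid are the fixed points of negation and the special elements of R and T, or of
  -- the set of rotations modulo m/2.
  module Avoiding (points : List (Fin M)) (invariant-points : Invariant ⟦ points ⟧)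
    (fixed-points : ∀ {x} → ⊟ x ≡ x → x ∈ₗ points) (i : ℕ) (room : length points ℕ.+ i ℕ.* 2 ≤ M) where

    selection : Selection ⟦ points ⟧ (i ℕ.* 2)
    selection = select invariant-points (λ fixed → ∈-⟦⟧ (fixed-points fixed)) i
      (ℕ.≤-trans (ℕ.+-monoˡ-≤ (i ℕ.* 2) (count-⟦⟧ points)) room)

    open Selection selection public using (set; invariant; count≡)

    outside : ∀ x → x ∈ₗ points → set x ≡ false
    outside x x∈ = Selection.avoids selection (∈-⟦⟧ x∈)

-- Dihedral groups of order 2 m with m odd

module OddOrder (M : ℕ) .{{_ : ℕ.NonZero M}} (t i : ℕ) (odd : M ≡ 1 ℕ.+ 2 ℕ.* t) (room : 5 ℕ.+ i ℕ.* 2 ≤ M) where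
  open CyclicSelection M

  private
    5≤M : 5 ≤ M
    5≤M = ℕ.≤-trans (ℕ.m≤m+n 5 (i ℕ.* 2)) room

    β δ : ℕ
    β = M ℕ.∸ 3
    δ = M ℕ.∸ 1

    β+3 : β ℕ.+ 3 ≡ M
    β+3 = ℕ.m∸n+n≡m (ℕ.≤-trans (ℕ.m≤m+n 3 2) 5≤M)

    δ+1 : δ ℕ.+ 1 ≡ M
    δ+1 = ℕ.m∸n+n≡m (ℕ.≤-trans (ℕ.m≤m+n 1 4) 5≤M)

    -3≡β : ⊟ [ 3 ] ≡ [ β ]
    -3≡β = ⊟-complement (trans (ℕ.+-comm 3 β) β+3)

    -1≡δ : ⊟ [ 1 ] ≡ [ δ ]
    -1≡δ = ⊟-complement (trans (ℕ.+-comm 1 δ) δ+1)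

    -- R receives ±3 and T receives ±1. For `M` = 5 these five points already exhaust the group.
    points : List (Fin M)
    points = [ 0 ] ∷ [ 3 ] ∷ [ β ] ∷ [ 1 ] ∷ [ δ ] ∷ []

    fixed-points : ∀ {x} → ⊟ x ≡ x → x ∈ₗ points
    fixed-points {x} fixed with ⊟-fixed fixed
    ... | inj₁ x≡0   = here x≡0
    ... | inj₂ x+x≡M = contradiction (trans (sym odd) (trans (sym x+x≡M) (cong (toℕ x ℕ.+_) (sym (ℕ.+-identityʳ (toℕ x)))))) (odd≢even t (toℕ x))

    invariant-points : Invariant ⟦ points ⟧
    invariant-points = ⊕-invariant [ 0 ] _ -[0] (⊕⊕-invariant [ 3 ] _ -3≡β (⊕⊕-invariant [ 1 ] _ -1≡δ ∅-invariant))

    open Avoiding points invariant-points fixed-points i room renaming (set to W)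
    open SymmetricReflections M 3 β 1 δ W

    lt : ∀ {x} k → x ℕ.+ suc k ≡ M → x < M
    lt = below

    small : ∀ {x} → x < 5 → x < M
    small x<5 = ℕ.≤-trans x<5 5≤M

    β≢3 : β ≢ 3
    β≢3 eq = odd≢even t 3 (trans (sym odd) (trans (sym β+3) (cong (ℕ._+ 3) eq)))

    0≢β : β ≢ 0
    0≢β eq = ℕ.<⇒≢ (ℕ.≤-trans (ℕ.n≤1+n 4) 5≤M) (trans (sym (cong (ℕ._+ 3) eq)) β+3)

    δ≢1 : δ ≢ 1
    δ≢1 eq = ℕ.<⇒≢ (ℕ.≤-trans (ℕ.m≤m+n 3 2) 5≤M) (trans (sym (cong (ℕ._+ 1) eq)) δ+1)

    periodic : ∀ {q} → Periodic M q → Periodic (1 ℕ.+ 2 ℕ.* t) q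
    periodic {q} = subst (λ l → Periodic l q) odd

    one-three : OneThree (1 ℕ.+ 2 ℕ.* t) 3 β 1 δ
    one-three = record
      { plus-three  = λ _ _ → refl
      ; minus-three = λ {q} per x → wrap {q = q} per 1 (shift x (trans β+3 odd))
      ; plus-one    = λ _ _ → refl
      ; minus-one   = λ {q} per x → wrap {q = q} per 1 (shift′ x (trans δ+1 odd))
      }
      where
      shift : ∀ {l} x → β ℕ.+ 3 ≡ l → β ℕ.+ (3 ℕ.+ x) ≡ 1 ℕ.* l ℕ.+ x
      shift x refl = lemma β x
        where
        lemma : ∀ b x → b ℕ.+ (3 ℕ.+ x) ≡ 1 ℕ.* (b ℕ.+ 3) ℕ.+ x
        lemma = ℕ-Solver.solve-∀
      shift′ : ∀ {l} x → δ ℕ.+ 1 ≡ l → δ ℕ.+ (3 ℕ.+ x) ≡ 1 ℕ.* l ℕ.+ (2 ℕ.+ x)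
      shift′ x refl = lemma δ x
        where
        lemma : ∀ b x → b ℕ.+ (3 ℕ.+ x) ≡ 1 ℕ.* (b ℕ.+ 1) ℕ.+ (2 ℕ.+ x)
        lemma = ℕ-Solver.solve-∀

  odd-order : 𝔑-Cay ((2 ℕ.+ i ℕ.* 2) ℕ.+ (2 ℕ.+ i ℕ.* 2)) (M ℕ.+ M)
  odd-order = subst (λ c → 𝔑-Cay ((2 ℕ.+ c) ℕ.+ (2 ℕ.+ c)) (M ℕ.+ M)) count≡ (in-𝔑-Cay
    (outside [ β ] (there (there (here refl))))
    (∉-⊕ [ β ] W (distinct (lt 2 β+3) (small (ℕ.m≤m+n 4 1)) β≢3) (outside [ 3 ] (there (here refl))))
    (outside [ δ ] (there (there (there (there (here refl))))))
    (∉-⊕ [ δ ] W (distinct (lt 0 δ+1) (small (ℕ.m≤m+n 2 3)) δ≢1) (outside [ 1 ] (there (there (there (here refl))))))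
    (∉-⊕ [ 3 ] ([ β ] ⊕ W) (distinct (small (ℕ.m≤m+n 4 1)) (small (ℕ.m≤m+n 1 4)) λ ())
      (∉-⊕ [ β ] W (distinct (lt 2 β+3) (small (ℕ.m≤m+n 1 4)) 0≢β) (outside [ 0 ] (here refl))))
    (⊕⊕-invariant [ 3 ] W -3≡β invariant)
    (⊕⊕-invariant [ 1 ] W -1≡δ invariant)
    (λ {p} per eq → OddHead-vanishing t sum-weights offsets sum-weights-odd (OneThree-shape {o = offsets} one-three)
      (weights-total 3 β 1 δ W) {p} (periodic {p} per) eq)
    (λ {q} per eq → OneThree-constant 3 β 1 δ W t one-three {q} (periodic {q} per) eq)
    (ℕ.≤-trans (ℕ.m≤m+n 2 3) (ℕ.≤-trans 5≤M (ℕ.m≤m+n M M))))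

-- Dihedral groups of order 4 l with l odd

module OddHalf (t : ℕ) where
  l M : ℕ
  l = 1 ℕ.+ 2 ℕ.* t
  M = l ℕ.+ l

  open CyclicSelection M public

  alternating-l : alternating l ≡ ℤ.-1ℤ
  alternating-l = cong -_ (alternating-double t)

  -[l] : ⊟ [ l ] ≡ [ l ]
  -[l] = ⊟-complement {l} refl

  l<M : l < M
  l<M = ℕ.m<m+n l (s≤s z≤n)

  0<M : 0 < M
  0<M = s≤s z≤n

-- Here R adds ±1 to `W` and T adds 0 and `l`. On sequences of period `l` the two elements of T act
-- alike, so R - T is a second difference and the four heads of R + T reduce modulo 2 to S + S⁻¹.
module OddHalf₀ (t i : ℕ) (1≤t : 1 ≤ t) (room : 4 ℕ.+ i ℕ.* 2 ≤ (1 ℕ.+ 2 ℕ.* t) ℕ.+ (1 ℕ.+ 2 ℕ.* t)) where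
  open OddHalf t

  private
    β : ℕ
    β = l ℕ.+ 2 ℕ.* t

    β+1 : β ℕ.+ 1 ≡ M
    β+1 = lemma t
      where
      lemma : ∀ t → (1 ℕ.+ 2 ℕ.* t) ℕ.+ 2 ℕ.* t ℕ.+ 1 ≡ (1 ℕ.+ 2 ℕ.* t) ℕ.+ (1 ℕ.+ 2 ℕ.* t)
      lemma = ℕ-Solver.solve-∀

    -1≡β : ⊟ [ 1 ] ≡ [ β ]
    -1≡β = ⊟-complement {1} {β} (trans (ℕ.+-comm 1 β) β+1)

    points : List (Fin M)
    points = [ 0 ] ∷ [ l ] ∷ [ 1 ] ∷ [ β ] ∷ []

    fixed-points : ∀ {x} → ⊟ x ≡ x → x ∈ₗ points
    fixed-points fixed with self-inverse l refl fixed
    ... | inj₁ x≡0 = here x≡0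
    ... | inj₂ x≡l = there (here x≡l)

    invariant-points : Invariant ⟦ points ⟧
    invariant-points = ⊕-invariant [ 0 ] _ -[0] (⊕-invariant [ l ] _ -[l] (⊕⊕-invariant [ 1 ] _ -1≡β ∅-invariant))

    open Avoiding points invariant-points fixed-points i room renaming (set to W)
    open SymmetricReflections M 1 β 0 l W

    β<M : β < M
    β<M = below 0 β+1

    1<l : 1 < l
    1<l = s≤s (ℕ.≤-trans 1≤t (ℕ.m≤m+n t _))

    1<M : 1 < M
    1<M = ℕ.≤-trans 1<l (ℕ.m≤m+n l l)

    1<β : 1 < β
    1<β = ℕ.≤-trans 1<l (ℕ.m≤m+n l _)

    shape : ∀ {N} {o : Fin (4 ℕ.+ N) → ℕ} → o zero ≡ 1 → o (suc zero) ≡ β → o (suc (suc zero)) ≡ 0 →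
      o (suc (suc (suc zero))) ≡ l → QuadrupleShape l o
    shape {o = o} o₀ o₁ o₂ o₃ {q} per even x = ≈₂-+ (pair x) (pair (4 ℕ.+ x))
      where
      pair : ∀ x → q x + q (2 ℕ.+ x) ≈₂ 0ℤ
      pair x = ≈₂-trans (congruent (- q (1 ℕ.+ x)) (collect (q x) (q (1 ℕ.+ x)) (q (2 ℕ.+ x))))
        (≈₂-trans (≈₂-reflexive (sym heads-at-1)) (even (1 ℕ.+ x)))
        where
        collect : ∀ a b c → a + c ≡ c + a + (b + b) + pos 2 * - b
        collect = solve-∀
        around : ∀ b x → b ℕ.+ (1 ℕ.+ x) ≡ b ℕ.+ 1 ℕ.+ x
        around = ℕ-Solver.solve-∀
        heads-at-1 : head-sum o q (1 ℕ.+ x) ≡ q (2 ℕ.+ x) + q x + (q (1 ℕ.+ x) + q (1 ℕ.+ x))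
        heads-at-1 = cong₂ _+_
          (cong₂ _+_ (cong (λ k → q (k ℕ.+ (1 ℕ.+ x))) o₀) (trans (cong (λ k → q (k ℕ.+ (1 ℕ.+ x))) o₁)
            (trans (cong q (trans (around β x) (cong (ℕ._+ x) β+1))) (trans (cong q (ℕ.+-assoc l l x)) (trans (per (l ℕ.+ x)) (per x))))))
          (cong₂ _+_ (cong (λ k → q (k ℕ.+ (1 ℕ.+ x))) o₂) (trans (cong (λ k → q (k ℕ.+ (1 ℕ.+ x))) o₃) (per (1 ℕ.+ x))))

    alternating-β : alternating β ≡ ℤ.-1ℤ
    alternating-β = trans (alternating-+ l (2 ℕ.* t)) (cong₂ _*_ alternating-l (alternating-double t))

    S : ℤ
    S = ∑[ W ] (λ i → alternating (toℕ i))

    -- The heads contribute -1 - 1 + 1 - 1, so the twisted total is 2 `S` - 2; but `S` has the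
    -- parity of the size of `W`, which is even.
    S≢1 : S ≢ 1ℤ
    S≢1 S≡1 = 1≉₂0 (≈₂-trans (≈₂-reflexive (sym S≡1)) (≈₂-trans (∑-alternating W)
      (≈₂-trans (≈₂-reflexive (cong pos count≡)) (even-≈₂ i))))

    sum-twisted≢0 : sum (λ i → sum-weights i * alternating (offsets i)) ≢ 0ℤ
    sum-twisted≢0 eq = S≢1 (solve-for S (trans (sym (cong₂ (λ a b → ℤ.-1ℤ + (a + (1ℤ + (b + pos 2 * S)))) alternating-β alternating-l))
      (trans (sym (twisted-total 1 β 0 l W)) eq)))
      where
      solve-for : ∀ s → ℤ.-1ℤ + (ℤ.-1ℤ + (1ℤ + (ℤ.-1ℤ + pos 2 * s))) ≡ 0ℤ → s ≡ 1ℤ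
      solve-for s eq = ℤ.*-cancelˡ-≡ (pos 2) s 1ℤ (trans (isolate s) (cong (_+ pos 2) eq))
        where
        isolate : ∀ s → pos 2 * s ≡ ℤ.-1ℤ + (ℤ.-1ℤ + (1ℤ + (ℤ.-1ℤ + pos 2 * s))) + pos 2
        isolate = solve-∀

    difference-twisted≢0 : sum (λ i → difference-weights i * alternating (heads i)) ≢ 0ℤ
    difference-twisted≢0 eq = contradiction
      (trans (sym (cong₂ (λ a b → 1ℤ * ℤ.-1ℤ + (1ℤ * a + (ℤ.-1ℤ * 1ℤ + (ℤ.-1ℤ * b + 0ℤ)))) alternating-β alternating-l)) eq) λ ()

    constant : ∀ {f} → Periodic l f → (∀ x → convolve difference-weights heads f x ≡ 0ℤ) → ∀ x → f x ≡ f 0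
    constant {f} per eq = second-difference-constant l {f} per λ x → solve-for (f x) (f (1 ℕ.+ x)) (f (2 ℕ.+ x))
      (trans (sym (cong₂ (λ a b → 1ℤ * f (2 ℕ.+ x) + (1ℤ * a + (ℤ.-1ℤ * f (1 ℕ.+ x) + (ℤ.-1ℤ * b + 0ℤ)))) (minus-one x) (per (1 ℕ.+ x))))
        (eq (1 ℕ.+ x)))
      where
      around : ∀ b x → b ℕ.+ (1 ℕ.+ x) ≡ b ℕ.+ 1 ℕ.+ x
      around = ℕ-Solver.solve-∀
      minus-one : ∀ x → f (β ℕ.+ (1 ℕ.+ x)) ≡ f x
      minus-one x = trans (cong f (trans (around β x) (cong (ℕ._+ x) β+1))) (trans (cong f (ℕ.+-assoc l l x)) (trans (per (l ℕ.+ x)) (per x)))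
      solve-for : ∀ a b c → 1ℤ * c + (1ℤ * a + (ℤ.-1ℤ * b + (ℤ.-1ℤ * b + 0ℤ))) ≡ 0ℤ → a + c ≡ b + b
      solve-for a b c eq = trans (isolate a b c) (trans (cong (λ z → b + b + z) eq) (ℤ.+-identityʳ (b + b)))
        where
        isolate : ∀ a b c → a + c ≡ b + b + (1ℤ * c + (1ℤ * a + (ℤ.-1ℤ * b + (ℤ.-1ℤ * b + 0ℤ))))
        isolate = solve-∀

  odd-half₀ : 𝔑-Cay ((2 ℕ.+ i ℕ.* 2) ℕ.+ (2 ℕ.+ i ℕ.* 2)) (M ℕ.+ M)
  odd-half₀ = subst (λ c → 𝔑-Cay ((2 ℕ.+ c) ℕ.+ (2 ℕ.+ c)) (M ℕ.+ M)) count≡ (in-𝔑-Cay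
    (outside [ β ] (there (there (there (here refl)))))
    (∉-⊕ [ β ] W (distinct β<M 1<M (ℕ.<⇒≢ 1<β ∘ sym)) (outside [ 1 ] (there (there (here refl)))))
    (outside [ l ] (there (here refl)))
    (∉-⊕ [ l ] W (distinct l<M 0<M λ ()) (outside [ 0 ] (here refl)))
    (∉-⊕ [ 1 ] ([ β ] ⊕ W) (distinct 1<M 0<M λ ()) (∉-⊕ [ β ] W (distinct β<M 0<M λ ()) (outside [ 0 ] (here refl))))
    (⊕⊕-invariant [ 1 ] W -1≡β invariant)
    (⊕-invariant [ 0 ] ([ l ] ⊕ W) -[0] (⊕-invariant [ l ] W -[l] invariant))
    (λ {p} per eq → doubled-vanishing t sum-weights offsets sum-weights-odd (shape {o = offsets} refl refl refl refl) sum-twisted≢0 {p} per eq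
      (weights-total 1 β 0 l W))
    (λ {q} per eq → doubled-constant t difference-weights heads difference-weights-odd (shape {o = heads} refl refl refl refl) difference-twisted≢0 {q} per eq constant)
    (ℕ.≤-trans 1<M (ℕ.m≤m+n M M)))

-- R and T must have odd size, so `W` contains the involution `l`. Modulo `l` the heads are ±3 and
-- ±1, but ±3 is lifted to ±(l + 3), which is even: with odd heads throughout, the twisted total of
-- R - T would be 0. For l = 3 the element l + 3 would be the identity, hence l ≥ 5.
module OddHalf₂ (s i : ℕ) (room : 6 ℕ.+ i ℕ.* 2 ≤ (1 ℕ.+ 2 ℕ.* (2 ℕ.+ s)) ℕ.+ (1 ℕ.+ 2 ℕ.* (2 ℕ.+ s))) where
  private
    t : ℕ
    t = 2 ℕ.+ s
  open OddHalf t

  private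
    α β δ : ℕ
    α = l ℕ.+ 3
    β = 2 ℕ.* (1 ℕ.+ s)
    δ = l ℕ.+ 2 ℕ.* t

    β+3 : β ℕ.+ 3 ≡ l
    β+3 = lemma s
      where
      lemma : ∀ s → 2 ℕ.* (1 ℕ.+ s) ℕ.+ 3 ≡ 1 ℕ.+ 2 ℕ.* (2 ℕ.+ s)
      lemma = ℕ-Solver.solve-∀

    δ+1 : δ ℕ.+ 1 ≡ M
    δ+1 = lemma t
      where
      lemma : ∀ t → (1 ℕ.+ 2 ℕ.* t) ℕ.+ 2 ℕ.* t ℕ.+ 1 ≡ (1 ℕ.+ 2 ℕ.* t) ℕ.+ (1 ℕ.+ 2 ℕ.* t)
      lemma = ℕ-Solver.solve-∀

    α+β : α ℕ.+ β ≡ M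
    α+β = trans (ℕ.+-assoc l 3 β) (cong (l ℕ.+_) (trans (ℕ.+-comm 3 β) β+3))

    -α≡β : ⊟ [ α ] ≡ [ β ]
    -α≡β = ⊟-complement {α} {β} α+β

    -1≡δ : ⊟ [ 1 ] ≡ [ δ ]
    -1≡δ = ⊟-complement {1} {δ} (trans (ℕ.+-comm 1 δ) δ+1)

    points : List (Fin M)
    points = [ 0 ] ∷ [ l ] ∷ [ α ] ∷ [ β ] ∷ [ 1 ] ∷ [ δ ] ∷ []

    fixed-points : ∀ {x} → ⊟ x ≡ x → x ∈ₗ points
    fixed-points fixed with self-inverse l refl fixed
    ... | inj₁ x≡0 = here x≡0
    ... | inj₂ x≡l = there (here x≡l)

    invariant-points : Invariant ⟦ points ⟧
    invariant-points = ⊕-invariant [ 0 ] _ -[0] (⊕-invariant [ l ] _ -[l]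
      (⊕⊕-invariant [ α ] _ -α≡β (⊕⊕-invariant [ 1 ] _ -1≡δ ∅-invariant)))

    open Avoiding points invariant-points fixed-points i room

    W : Fin M → Bool
    W = [ l ] ⊕ set

    W-invariant : Invariant W
    W-invariant = ⊕-invariant [ l ] set -[l] invariant

    count-W : count W ≡ suc (i ℕ.* 2)
    count-W = trans (count-⊕ [ l ] set (outside [ l ] (there (here refl)))) (cong suc count≡)

    open SymmetricReflections M α β 1 δ W

    α<M : α < M
    α<M = below (1 ℕ.+ 2 ℕ.* s) (trans (cong (α ℕ.+_) (sym (ℕ.*-suc 2 s))) α+β)

    β<l : β < l
    β<l = below 2 β+3

    β<M : β < M
    β<M = ℕ.<-trans β<l l<M

    δ<M : δ < M
    δ<M = below 0 δ+1

    1<l : 1 < l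
    1<l = s≤s (s≤s z≤n)

    1<M : 1 < M
    1<M = ℕ.<-trans 1<l l<M

    l<α : l < α
    l<α = below 2 refl

    l<δ : l < δ
    l<δ = ℕ.m<m+n l (s≤s z≤n)

    ≢-sym-< : ∀ {x y} → x < y → y ≢ x
    ≢-sym-< x<y eq = ℕ.<⇒≢ x<y (sym eq)

    one-three : OneThree l α β 1 δ
    one-three = record
      { plus-three  = λ {q} per x → wrap {q = q} per 1 (shift₃ l x)
      ; minus-three = λ {q} per x → wrap {q = q} per 1 (trans (shift₋₃ β x) (cong (λ k → 1 ℕ.* k ℕ.+ x) β+3))
      ; plus-one    = λ _ _ → refl
      ; minus-one   = λ {q} per x → wrap {q = q} per 2 (trans (shift₋₁ δ x) (trans (cong (ℕ._+ (2 ℕ.+ x)) δ+1) (cong (ℕ._+ (2 ℕ.+ x)) (sym (cong (l ℕ.+_) (ℕ.+-identityʳ l))))))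
      }
      where
      shift₃ : ∀ l x → l ℕ.+ 3 ℕ.+ (3 ℕ.+ x) ≡ 1 ℕ.* l ℕ.+ (6 ℕ.+ x)
      shift₃ = ℕ-Solver.solve-∀
      shift₋₃ : ∀ b x → b ℕ.+ (3 ℕ.+ x) ≡ 1 ℕ.* (b ℕ.+ 3) ℕ.+ x
      shift₋₃ = ℕ-Solver.solve-∀
      shift₋₁ : ∀ b x → b ℕ.+ (3 ℕ.+ x) ≡ b ℕ.+ 1 ℕ.+ (2 ℕ.+ x)
      shift₋₁ = ℕ-Solver.solve-∀

    alternating-α : alternating α ≡ 1ℤ
    alternating-α = trans (alternating-+ l 3) (cong (_* ℤ.-1ℤ) alternating-l)

    alternating-β : alternating β ≡ 1ℤ
    alternating-β = alternating-double (1 ℕ.+ s)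

    alternating-δ : alternating δ ≡ ℤ.-1ℤ
    alternating-δ = trans (alternating-+ l (2 ℕ.* t)) (cong₂ _*_ alternating-l (alternating-double t))

    S : ℤ
    S = ∑[ W ] (λ i → alternating (toℕ i))

    -- The signs of the heads cancel, so the twisted total is 2 `S`, and the size of `W` is odd.
    S≢0 : S ≢ 0ℤ
    S≢0 S≡0 = 1≉₂0 (≈₂-trans (≈₂-sym (≈₂-+ (≈₂-reflexive {1ℤ} refl) (even-≈₂ i)))
      (≈₂-trans (≈₂-reflexive (cong pos (sym count-W))) (≈₂-trans (≈₂-sym (∑-alternating W)) (≈₂-reflexive S≡0))))

    sum-twisted≢0 : sum (λ i → sum-weights i * alternating (offsets i)) ≢ 0ℤ
    sum-twisted≢0 eq = S≢0 (solve-for alternating-α alternating-β alternating-δ (trans (sym (twisted-total α β 1 δ W)) eq))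
      where
      isolate : ∀ s → pos 2 * s ≡ 1ℤ + (1ℤ + (ℤ.-1ℤ + (ℤ.-1ℤ + pos 2 * s)))
      isolate = solve-∀
      solve-for : ∀ {a b d s} → a ≡ 1ℤ → b ≡ 1ℤ → d ≡ ℤ.-1ℤ → a + (b + (ℤ.-1ℤ + (d + pos 2 * s))) ≡ 0ℤ → s ≡ 0ℤ
      solve-for {s = s} refl refl refl eq = ℤ.*-cancelˡ-≡ (pos 2) s 0ℤ (trans (isolate s) eq)

    difference-twisted≢0 : sum (λ i → difference-weights i * alternating (heads i)) ≢ 0ℤ
    difference-twisted≢0 = four alternating-α alternating-β alternating-δ
      where
      four : ∀ {a b d} → a ≡ 1ℤ → b ≡ 1ℤ → d ≡ ℤ.-1ℤ → 1ℤ * a + (1ℤ * b + (ℤ.-1ℤ * ℤ.-1ℤ + (ℤ.-1ℤ * d + 0ℤ))) ≢ 0ℤ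
      four refl refl refl ()

  odd-half₂ : 𝔑-Cay ((3 ℕ.+ i ℕ.* 2) ℕ.+ (3 ℕ.+ i ℕ.* 2)) (M ℕ.+ M)
  odd-half₂ = subst (λ c → 𝔑-Cay ((2 ℕ.+ c) ℕ.+ (2 ℕ.+ c)) (M ℕ.+ M)) count-W (in-𝔑-Cay
    (∉-⊕ [ l ] set (distinct l<M β<M (≢-sym-< β<l)) (outside [ β ] (there (there (there (here refl))))))
    (∉-⊕ [ β ] W (distinct β<M α<M (ℕ.<⇒≢ (ℕ.<-trans β<l l<α)))
      (∉-⊕ [ l ] set (distinct l<M α<M (ℕ.<⇒≢ l<α)) (outside [ α ] (there (there (here refl))))))
    (∉-⊕ [ l ] set (distinct l<M δ<M (ℕ.<⇒≢ l<δ)) (outside [ δ ] (there (there (there (there (there (here refl))))))))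
    (∉-⊕ [ δ ] W (distinct δ<M 1<M (≢-sym-< (ℕ.<-trans 1<l l<δ)))
      (∉-⊕ [ l ] set (distinct l<M 1<M (≢-sym-< 1<l)) (outside [ 1 ] (there (there (there (there (here refl))))))))
    (∉-⊕ [ α ] ([ β ] ⊕ W) (distinct α<M 0<M λ ()) (∉-⊕ [ β ] W (distinct β<M 0<M λ ())
      (∉-⊕ [ l ] set (distinct l<M 0<M λ ()) (outside [ 0 ] (here refl)))))
    (⊕⊕-invariant [ α ] W -α≡β W-invariant)
    (⊕⊕-invariant [ 1 ] W -1≡δ W-invariant)
    (λ {p} per eq → doubled-vanishing t sum-weights offsets sum-weights-odd (OneThree-shape {o = offsets} one-three) sum-twisted≢0 {p} per eq
      (weights-total α β 1 δ W))
    (λ {q} per eq → doubled-constant t difference-weights heads difference-weights-odd (OneThree-shape {o = heads} one-three) difference-twisted≢0 {q} per eq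
      (λ {f} → OneThree-constant α β 1 δ W t one-three {f}))
    (ℕ.≤-trans 1<M (ℕ.m≤m+n M M)))

module _ (l : ℕ) .{{_ : ℕ.NonZero l}} (l-even : alternating l ≡ 1ℤ) {N} (w : Fin N → ℤ) (o : Fin N → ℕ)
  (total≢0 : sum (λ i → w i * alternating (o i)) ≢ 0ℤ)
  {g k : Sequence} (g-periodic : Periodic (l ℕ.+ l) g) (k-periodic : Periodic (l ℕ.+ l) k) where

  private
    folded v : Sequence
    folded x = (g x + k x) + (g (l ℕ.+ x) + k (l ℕ.+ x))
    v = convolve w o folded

    alternating-periodic : Periodic l alternating
    alternating-periodic x = trans (alternating-+ l x) (trans (cong (_* alternating x) l-even) (ℤ.*-identityˡ _))

    twist-periodic : ∀ {q} → Periodic (l ℕ.+ l) q → Periodic (l ℕ.+ l) (twist q)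
    twist-periodic per x = cong₂ _*_ (trans (cong alternating (ℕ.+-assoc l l x))
      (trans (alternating-periodic (l ℕ.+ x)) (alternating-periodic x))) (per x)

    twisted-v : ∀ x → convolve (λ i → w i * alternating (o i)) o
      (λ y → (twist g y + twist k y) + (twist g (l ℕ.+ y) + twist k (l ℕ.+ y))) x ≡ alternating x * v x
    twisted-v x = trans (convolve-cong (λ i → w i * alternating (o i)) o (λ y →
        trans (cong (λ a → (twist g y + twist k y) + (a * g (l ℕ.+ y) + a * k (l ℕ.+ y))) (alternating-periodic y))
          (factor (alternating y) (g y) (k y) (g (l ℕ.+ y)) (k (l ℕ.+ y)))) x)
      (convolve-twist w o folded x)
      where
      factor : ∀ a b c d e → (a * b + a * c) + (a * d + a * e) ≡ a * ((b + c) + (d + e))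
      factor = solve-∀

  -- The twist absorbs the sign changes and leads back to `recurrence-constant`; as `l` is even, it
  -- is compatible with folding.
  recurrence-alternating : (∀ x → g (suc x) ≡ - (g x + v x)) → (∀ x → k x ≡ - (k (suc x) + v (suc x))) →
    (∀ x → twist g x ≡ g 0) × (∀ x → twist k x ≡ - g 0)
  recurrence-alternating g-step k-step = (λ x → trans (proj₁ constant x) start) , λ x → trans (proj₂ constant x) (cong -_ start)
    where
    start : twist g 0 ≡ g 0
    start = ℤ.*-identityˡ (g 0)
    collect₁ : ∀ a b c → - a * - (b + c) ≡ a * b + a * c
    collect₁ = solve-∀
    collect₂ : ∀ a b c → a * - (b + c) ≡ - a * b + - a * c
    collect₂ = solve-∀
    constant = recurrence-constant l (λ i → w i * alternating (o i)) o total≢0 {twist g} {twist k}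
      (twist-periodic {g} g-periodic) (twist-periodic {k} k-periodic)
      (λ x → trans (cong (- alternating x *_) (g-step x)) (trans (collect₁ (alternating x) (g x) (v x))
        (cong (twist g x +_) (sym (twisted-v x)))))
      (λ x → trans (cong (alternating x *_) (k-step x)) (trans (collect₂ (alternating x) (k (suc x)) (v (suc x)))
        (cong (twist k (suc x) +_) (sym (twisted-v (suc x))))))

-- Dihedrants whose rotation set is a union of cosets of the subgroup of order 2

module PairedRotations (l : ℕ) .{{_ : ℕ.NonZero l}} (Y : Fin l → Bool)
  (Y-sym : ∀ a → Y (Cyclic.⊟_ l a) ≡ Y a) (0∉Y : Y (Cyclic.[_] l 0) ≡ false) where

  M : ℕ
  M = l ℕ.+ l

  instance
    M-nonZero : ℕ.NonZero M
    M-nonZero = ℕ.>-nonZero (ℕ.≤-trans (ℕ.>-nonZero⁻¹ l) (ℕ.m≤m+n l l))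

  private module L = Cyclic l
  open Cyclic M public
  open Dihedral M public

  l<M : l < M
  l<M = ℕ.m<m+n l (ℕ.>-nonZero⁻¹ l)

  R : Fin M → Bool
  R a = Y (L.[ toℕ a ])

  private
    L-periodic : ∀ x → L.[ x % M ] ≡ L.[ x ]
    L-periodic x = L.[]-cong (m∣n⇒o%n%m≡o%m l M x (divides 2 (cong (l ℕ.+_) (sym (ℕ.+-identityʳ l)))))

  R-[] : ∀ x → R [ x ] ≡ Y (L.[ x ])
  R-[] x = cong Y (trans (cong L.[_] (toℕ-[] x)) (L-periodic x))

  0∉R : R [ 0 ] ≡ false
  0∉R = trans (R-[] 0) 0∉Y

  R-sym : ∀ a → R (⊟ a) ≡ R a
  R-sym a = trans (R-[] (M ℕ.∸ toℕ a)) (trans (cong Y (inverseʳ-unique (L.[ toℕ a ]) (L.[ M ℕ.∸ toℕ a ])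
      (trans (L.[]-⊞ (toℕ a) (M ℕ.∸ toℕ a)) (trans (cong L.[_] (ℕ.m+[n∸m]≡n (ℕ.<⇒≤ (Fin.toℕ<n a)))) (trans (L.[]-periodic l) L.[m]≡[0])))))
    (Y-sym (L.[ toℕ a ])))
    where open AbelianGroupProperties L.abelianGroup using (inverseʳ-unique)

  weights : Fin l → ℤ
  weights i = on (Y i) 1ℤ

  sum-over-R : ∀ (f : ℕ → ℤ) → ∑[ R ] (λ a → f (toℕ a)) ≡ sum (λ i → weights i * (f (toℕ i) + f (l ℕ.+ toℕ i)))
  sum-over-R f = trans (sum-↑ l (λ a → on (R a) (f (toℕ a)))) (trans (cong₂ _+_
      (sum-cong-≗ λ i → cong₂ (λ b k → on b (f k)) (cong Y (trans (cong L.[_] (Fin.toℕ-↑ˡ i l)) (L.[toℕ] i))) (Fin.toℕ-↑ˡ i l))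
      (sum-cong-≗ λ i → cong₂ (λ b k → on b (f k))
        (cong Y (trans (cong L.[_] (Fin.toℕ-↑ʳ l i)) (trans (L.[]-periodic (toℕ i)) (L.[toℕ] i)))) (Fin.toℕ-↑ʳ l i)))
    (trans (sym (∑-distrib-+ (λ i → on (Y i) (f (toℕ i))) _))
      (sum-cong-≗ λ i → trans (sym (on-+ (Y i) _ _)) (on-* (Y i) _))))

  count-R : count R ≡ count Y ℕ.* 2
  count-R = ℤ.+-injective (trans (+count R) (trans (sum-over-R (λ _ → 1ℤ)) (trans (sum-cong-≗ λ i → sym (on-* (Y i) (pos 2)))
    (trans (∑-const Y (pos 2)) (sym (ℤ.pos-* (count Y) 2))))))

  weights-total≢0 : count Y ≢ 0 → sum weights ≢ 0ℤ
  weights-total≢0 Y≢∅ eq = Y≢∅ (ℤ.+-injective (trans (+count Y) eq))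

  -- `extra` is the functional T - R. Separating it from T leaves R applied to g + k in both kernel
  -- equations, so the same `u` occurs in both; it has period `l` because R consists of cosets.
  module Equations (T : Fin M → Bool) (extra : (Fin M → ℤ) → ℤ) (T-sum : ∀ f → ∑[ T ] f ≡ ∑[ R ] f + extra f)
    {g k : Fin M → ℤ} (solution : Solution R T 0∉R R-sym g k) where
    open Solution solution

    p folded : Sequence
    p x = g [ x ] + k [ x ]
    folded x = (k [ x ] + g [ x ]) + (k [ l ℕ.+ x ] + g [ l ℕ.+ x ])

    u : Sequence
    u = convolve weights toℕ folded

    u≡ : ∀ x → ∑[ R ] (λ a → g (a ⊞ [ x ])) + ∑[ R ] (λ a → k (a ⊞ [ x ])) ≡ u x
    u≡ x = begin
      ∑[ R ] (λ a → g (a ⊞ [ x ])) + ∑[ R ] (λ a → k (a ⊞ [ x ]))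
        ≡⟨ ∑-+ R (λ a → g (a ⊞ [ x ])) _ ⟨
      ∑[ R ] (λ a → g (a ⊞ [ x ]) + k (a ⊞ [ x ]))
        ≡⟨ ∑-congʳ R (λ a → cong (λ b → g b + k b) (⊞-[] a x)) ⟩
      ∑[ R ] (λ a → p (toℕ a ℕ.+ x))
        ≡⟨ sum-over-R (λ y → p (y ℕ.+ x)) ⟩
      sum (λ i → weights i * (p (toℕ i ℕ.+ x) + p (l ℕ.+ toℕ i ℕ.+ x)))
        ≡⟨ sum-cong-≗ (λ i → cong (weights i *_) (cong₂ _+_ (ℤ.+-comm (g [ toℕ i ℕ.+ x ]) _)
             (trans (cong p (ℕ.+-assoc l (toℕ i) x)) (ℤ.+-comm (g [ l ℕ.+ (toℕ i ℕ.+ x) ]) _)))) ⟩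
      u x ∎
      where open ≡-Reasoning

    k-equation : ∀ x → u x + extra (λ b → k (b ⊞ [ x ])) ≡ 0ℤ
    k-equation x = trans (cong (_+ extra (λ b → k (b ⊞ [ x ]))) (sym (u≡ x)))
      (trans (ℤ.+-assoc (∑[ R ] (λ a → g (a ⊞ [ x ]))) _ _)
        (trans (cong (∑[ R ] (λ a → g (a ⊞ [ x ])) +_) (sym (T-sum (λ b → k (b ⊞ [ x ]))))) (rotations [ x ])))

    g-equation : ∀ x → u x + extra (λ b → g ([ x ] ⊟ b)) ≡ 0ℤ
    g-equation x = trans (cong (_+ extra (λ b → g ([ x ] ⊟ b))) (trans (sym (u≡ x))
        (ℤ.+-comm (∑[ R ] (λ a → g (a ⊞ [ x ]))) _)))
      (trans (ℤ.+-assoc (∑[ R ] (λ a → k (a ⊞ [ x ]))) _ _)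
        (trans (cong (λ z → ∑[ R ] (λ a → k (a ⊞ [ x ])) + (z + extra (λ b → g ([ x ] ⊟ b)))) (sym (∑-reflect R R-sym g [ x ])))
          (trans (cong (∑[ R ] (λ a → k (a ⊞ [ x ])) +_) (sym (T-sum (λ b → g ([ x ] ⊟ b))))) (reflections [ x ]))))

    folded-periodic : Periodic l folded
    folded-periodic x = trans (cong (λ y → (k [ l ℕ.+ x ] + g [ l ℕ.+ x ]) + (k y + g y))
      (trans (cong [_] (sym (ℕ.+-assoc l l x))) ([]-periodic x))) (ℤ.+-comm (k [ l ℕ.+ x ] + g [ l ℕ.+ x ]) _)

    u-periodic : Periodic l u
    u-periodic = convolve-periodic weights toℕ {l} {folded} folded-periodic

    g-periodic : Periodic M (λ x → g [ x ])
    g-periodic x = cong g ([]-periodic x)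

    k-periodic : Periodic M (λ x → k [ x ])
    k-periodic x = cong k ([]-periodic x)

    shifted : ∀ c x → convolve (λ i → - weights i) (λ i → toℕ i ℕ.+ c) folded x ≡ - u (c ℕ.+ x)
    shifted c x = trans (sum-cong-≗ λ i → trans (sym (ℤ.neg-distribˡ-* (weights i) _))
        (trans (cong (λ y → - (weights i * folded y)) (ℕ.+-assoc (toℕ i) c x)) (sym (ℤ.-1*i≡-i _))))
      (trans (sum-*ˡ ℤ.-1ℤ (λ i → weights i * folded (toℕ i ℕ.+ (c ℕ.+ x)))) (ℤ.-1*i≡-i (u (c ℕ.+ x))))

    module _ {N} (w : Fin N → ℤ) (o : Fin N → ℕ) where
      private
        v : Sequence
        v = convolve w o folded

      -- `k` takes the role of the first sequence in `recurrence-constant`: the equations at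
      -- rotations move it forwards, whereas the differences x ⊟ b move `g` backwards.
      constant-solution : sum w ≢ 0ℤ → (∀ x → k [ suc x ] ≡ k [ x ] + v x) →
        (∀ x → g [ x ] ≡ g [ suc x ] + v (suc x)) →
        ∃[ c ] (∀ a → g a ≡ c * 1ℤ) × (∀ a → k a ≡ - (c * 1ℤ))
      constant-solution total≢0 k-step g-step = - k [ 0 ]
        , (λ a → trans (cong g (sym ([toℕ] a))) (trans (proj₂ constant (toℕ a)) (sym (ℤ.*-identityʳ _))))
        , (λ a → trans (cong k (sym ([toℕ] a))) (trans (proj₁ constant (toℕ a)) (double-neg (k [ 0 ]))))
        where
        constant = recurrence-constant l w o total≢0 k-periodic g-periodic k-step g-step
        double-neg : ∀ a → a ≡ - (- a * 1ℤ)
        double-neg = solve-∀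

      alternating-solution : alternating l ≡ 1ℤ → sum (λ i → w i * alternating (o i)) ≢ 0ℤ →
        (∀ x → k [ suc x ] ≡ - (k [ x ] + v x)) → (∀ x → g [ x ] ≡ - (g [ suc x ] + v (suc x))) →
        ∃[ c ] (∀ a → g a ≡ c * alternating (toℕ a)) × (∀ a → k a ≡ - (c * alternating (toℕ a)))
      alternating-solution l-even total≢0 k-step g-step = - k [ 0 ]
        , (λ a → trans (untwist g a) (trans (cong (alternating (toℕ a) *_) (proj₂ constant (toℕ a))) (ℤ.*-comm (alternating (toℕ a)) _)))
        , (λ a → trans (untwist k a) (trans (cong (alternating (toℕ a) *_) (proj₁ constant (toℕ a))) (collect (alternating (toℕ a)) (k [ 0 ]))))
        where
        constant = recurrence-alternating l l-even w o total≢0 k-periodic g-periodic k-step g-step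
        untwist : ∀ (f : Fin M → ℤ) a → f a ≡ alternating (toℕ a) * (alternating (toℕ a) * f [ toℕ a ])
        untwist f a = trans (cong f (sym ([toℕ] a))) (sym (twist-twist (λ x → f [ x ]) (toℕ a)))
        collect : ∀ a b → a * b ≡ - (- b * a)
        collect = solve-∀

  constant-sign : ∀ T → Sign R T 0∉R R-sym (λ _ → 1ℤ)
  constant-sign T = record { homo = λ _ _ → refl ; even = λ _ → refl ; nonzero = λ _ () }

  alternating-[] : ∀ x → alternating (toℕ [ x ]) ≡ alternating x
  alternating-[] x = trans (cong alternating (toℕ-[] x)) (begin
    alternating (x % M) ≡⟨ periodic-* {M} {alternating} per (x / M) (x % M) ⟨
    alternating (x / M ℕ.* M ℕ.+ x % M) ≡⟨ cong alternating (trans (ℕ.+-comm (x / M ℕ.* M) _) (sym (m≡m%n+[m/n]*n x M))) ⟩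
    alternating x ∎)
    where
    open ≡-Reasoning
    per : Periodic M alternating
    per y = trans (alternating-+ M y) (trans (cong (_* alternating y) (trans (alternating-+ l l) (alternating-square l))) (ℤ.*-identityˡ _))

  alternating-sign : ∀ T → Sign R T 0∉R R-sym (λ a → alternating (toℕ a))
  alternating-sign T = record
    { homo    = λ a b → trans (alternating-[] (toℕ a ℕ.+ toℕ b)) (alternating-+ (toℕ a) (toℕ b))
    ; even    = λ a → trans (alternating-[] (M ℕ.∸ toℕ a)) (negated (M ℕ.∸ toℕ a) (toℕ a) (ℕ.m∸n+n≡m (ℕ.<⇒≤ (Fin.toℕ<n a))))
    ; nonzero = λ a → alternating≢0 (toℕ a)
    }
    where
    negated : ∀ x y → x ℕ.+ y ≡ M → alternating x ≡ alternating y
    negated x y x+y≡M = begin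
      alternating x ≡⟨ ℤ.*-identityʳ _ ⟨
      alternating x * 1ℤ ≡⟨ cong (alternating x *_) (alternating-square y) ⟨
      alternating x * (alternating y * alternating y) ≡⟨ ℤ.*-assoc (alternating x) _ _ ⟨
      alternating x * alternating y * alternating y ≡⟨ cong (_* alternating y) (trans (sym (alternating-+ x y))
                                                               (trans (cong alternating x+y≡M) (trans (alternating-+ l l) (alternating-square l)))) ⟩
      1ℤ * alternating y ≡⟨ ℤ.*-identityˡ _ ⟩
      alternating y ∎
      where open ≡-Reasoning

odd⇒≢0 : ∀ {z} j → z ≈₂ pos (1 ℕ.+ j ℕ.* 2) → z ≢ 0ℤ
odd⇒≢0 j z≈ refl = 1≉₂0 (≈₂-trans (≈₂-sym (≈₂-+ (≈₂-reflexive {1ℤ} refl) (even-≈₂ j))) (≈₂-sym z≈))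

module PairedFamilies (h : ℕ) .{{_ : ℕ.NonZero h}} {l : ℕ} .{{_ : ℕ.NonZero l}} (l≡h+h : l ≡ h ℕ.+ h) (Y : Fin l → Bool)
  (Y-sym : ∀ a → Y (Cyclic.⊟_ l a) ≡ Y a) (0∉Y : Y (Cyclic.[_] l 0) ≡ false) where
  open PairedRotations l Y Y-sym 0∉Y
  private module L = Cyclic l

  private
    -- As `M` is 4 `h`, this is - `h` modulo `M`.
    c : ℕ
    c = l ℕ.+ h

    1≤l : 1 ≤ l
    1≤l = ℕ.>-nonZero⁻¹ l

    1≤h : 1 ≤ h
    1≤h = ℕ.>-nonZero⁻¹ h

    2≤M : 2 ≤ M
    2≤M = ℕ.≤-trans (s≤s 1≤l) l<M

    2≤M+M : 2 ≤ M ℕ.+ M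
    2≤M+M = ℕ.≤-trans 2≤M (ℕ.m≤m+n M M)

    h<l : h < l
    h<l = subst (h <_) (sym l≡h+h) (ℕ.m<m+n h 1≤h)

    1+h<M : suc h < M
    1+h<M = ℕ.≤-trans (s≤s h<l) l<M

    l-even : alternating l ≡ 1ℤ
    l-even = trans (cong alternating l≡h+h) (trans (alternating-+ h h) (alternating-square h))

    0≢1 : [ 0 ] ≢ [ 1 ]
    0≢1 eq = contradiction ([]-injective (ℕ.≤-trans (s≤s z≤n) 2≤M) 2≤M eq) λ ()

    h≢1+h : [ h ] ≢ [ suc h ]
    h≢1+h eq = ℕ.1+n≢n (sym ([]-injective (ℕ.<-trans h<l l<M) 1+h<M eq))

    ⊖-true : ∀ {x y : Fin M} {W} → x ≢ y → W y ≡ true → (W ⊖ x) y ≡ true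
    ⊖-true x≢y y∈W = cong₂ (λ a b → not a ∧ b) (≡ᵇ-≢ x≢y) y∈W

    ⊖-false : ∀ (x y : Fin M) {W} → W y ≡ false → (W ⊖ x) y ≡ false
    ⊖-false x y y∉W = trans (cong (not (x ≡ᵇ y) ∧_) y∉W) (Bool.∧-zeroʳ (not (x ≡ᵇ y)))

    [1+x]⊟[0] : ∀ x → [ suc x ] ⊟ [ 0 ] ≡ [ suc x ]
    [1+x]⊟[0] x = trans (cong (λ y → [ y ] ⊟ [ 0 ]) (sym (ℕ.+-identityʳ (suc x)))) ([]-⊟ (suc x) 0)

    [1+x]⊟[1] : ∀ x → [ suc x ] ⊟ [ 1 ] ≡ [ x ]
    [1+x]⊟[1] x = trans (cong (λ y → [ y ] ⊟ [ 1 ]) (sym (ℕ.+-comm x 1))) ([]-⊟ x 1)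

    [h+1+x]⊟[h] : ∀ x → [ suc h ℕ.+ x ] ⊟ [ h ] ≡ [ suc x ]
    [h+1+x]⊟[h] x = trans (cong (λ y → [ y ] ⊟ [ h ]) (trans (sym (ℕ.+-suc h x)) (ℕ.+-comm h (suc x)))) ([]-⊟ (suc x) h)

    [h+1+x]⊟[1+h] : ∀ x → [ suc h ℕ.+ x ] ⊟ [ suc h ] ≡ [ x ]
    [h+1+x]⊟[1+h] x = trans (cong (λ y → [ y ] ⊟ [ suc h ]) (ℕ.+-comm (suc h) x)) ([]-⊟ x (suc h))

    h+c : ∀ x → h ℕ.+ (c ℕ.+ x) ≡ M ℕ.+ x
    h+c x = trans (rearrange h l x) (cong (λ y → l ℕ.+ y ℕ.+ x) (sym l≡h+h))
      where
      rearrange : ∀ h l x → h ℕ.+ (l ℕ.+ h ℕ.+ x) ≡ l ℕ.+ (h ℕ.+ h) ℕ.+ x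
      rearrange = ℕ-Solver.solve-∀

    [h]⊞[c+x] : ∀ x → [ h ] ⊞ [ c ℕ.+ x ] ≡ [ x ]
    [h]⊞[c+x] x = trans ([]-⊞ h _) (trans (cong [_] (h+c x)) ([]-periodic x))

    [1+h]⊞[c+x] : ∀ x → [ suc h ] ⊞ [ c ℕ.+ x ] ≡ [ suc x ]
    [1+h]⊞[c+x] x = trans ([]-⊞ (suc h) _) (trans (cong [_] (trans (cong suc (h+c x)) (sym (ℕ.+-suc M x)))) ([]-periodic (suc x)))

    minus-weights : Fin l → ℤ
    minus-weights i = - weights i

    shifts : Fin l → ℕ
    shifts i = toℕ i ℕ.+ c

    minus-total≢0 : count Y ≢ 0 → sum minus-weights ≢ 0ℤ
    minus-total≢0 Y≢∅ eq = weights-total≢0 Y≢∅ (trans (sym (ℤ.neg-involutive _))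
      (cong -_ (trans (sym (ℤ.-1*i≡-i (sum weights))) (trans (sym (sum-*ˡ ℤ.-1ℤ weights))
        (trans (sum-cong-≗ λ i → ℤ.-1*i≡-i (weights i)) eq)))))

    twisted-total≢0 : ∀ j → count Y ≡ 1 ℕ.+ j ℕ.* 2 → sum (λ i → weights i * alternating (toℕ i)) ≢ 0ℤ
    twisted-total≢0 j odd = odd⇒≢0 j (≈₂-trans (≈₂-reflexive (sum-cong-≗ λ i → sym (on-* (Y i) _)))
      (≈₂-trans (∑-alternating Y) (≈₂-reflexive (cong pos odd))))

    minus-twisted-total≢0 : ∀ j → count Y ≡ 1 ℕ.+ j ℕ.* 2 → sum (λ i → minus-weights i * alternating (shifts i)) ≢ 0ℤ
    minus-twisted-total≢0 j odd eq = twisted-total≢0 j odd (*-cancelʳ-≢0 -σ≢0 (trans (ℤ.*-comm _ -σ) (trans (sym (sum-*ˡ -σ (λ i → weights i * alternating (toℕ i))))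
        (trans (sum-cong-≗ λ i → trans (regroup (weights i) (alternating (toℕ i)) (alternating c)) (cong (minus-weights i *_) (sym (alternating-+ (toℕ i) c)))) eq))))
      where
      -σ : ℤ
      -σ = - alternating c
      -σ≢0 : -σ ≢ 0ℤ
      -σ≢0 eq = alternating≢0 c (trans (sym (ℤ.neg-involutive _)) (cong -_ eq))
      regroup : ∀ w a b → - b * (w * a) ≡ - w * (a * b)
      regroup = solve-∀

    four : ∀ j → j ℕ.* 2 ℕ.+ j ℕ.* 2 ≡ j ℕ.* 4
    four = ℕ-Solver.solve-∀

    balance : ∀ {T χ e} → ∑[ T ] χ ≡ ∑[ R ] χ + e → e ≡ 0ℤ → ∑[ R ] χ ≡ ∑[ T ] χ
    balance eq refl = sym (trans eq (ℤ.+-identityʳ _))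

  replace-1-by-0 : Y (L.[ 1 ]) ≡ true → count Y ≢ 0 → 𝔑-Cay (count Y ℕ.* 4) (M ℕ.+ M)
  replace-1-by-0 1∈Y Y≢∅ = subst (λ d → 𝔑-Cay d (M ℕ.+ M))
    (trans (cong (count R ℕ.+_) count-T) (trans (cong₂ ℕ._+_ count-R count-R) (four (count Y))))
    (dihedrant-in-𝔑-Cay R T 0∉R R-sym (constant-sign T) (balance {T} {λ _ → 1ℤ} (T-sum _) refl) 2≤M+M solved)
    where
    1∈R : R [ 1 ] ≡ true
    1∈R = trans (R-[] 1) 1∈Y
    T : Fin M → Bool
    T = [ 0 ] ⊕ (R ⊖ [ 1 ])
    0∉ : (R ⊖ [ 1 ]) [ 0 ] ≡ false
    0∉ = ⊖-false [ 1 ] [ 0 ] {R} 0∉R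
    count-T : count T ≡ count R
    count-T = trans (count-⊕ [ 0 ] (R ⊖ [ 1 ]) 0∉) (count-⊖ [ 1 ] R 1∈R)
    T-sum : ∀ f → ∑[ T ] f ≡ ∑[ R ] f + (f [ 0 ] - f [ 1 ])
    T-sum f = trans (∑-⊕ [ 0 ] (R ⊖ [ 1 ]) f 0∉) (trans (collect (f [ 0 ]) (f [ 1 ]) _)
      (cong (_+ (f [ 0 ] - f [ 1 ])) (∑-⊖ [ 1 ] R f 1∈R)))
      where
      collect : ∀ a b s → a + s ≡ b + s + (a - b)
      collect = solve-∀
    solved : ∀ g k → Solution R T 0∉R R-sym g k → ∃[ c ] (∀ a → g a ≡ c * 1ℤ) × (∀ a → k a ≡ - (c * 1ℤ))
    solved g k solution = constant-solution weights toℕ (weights-total≢0 Y≢∅)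
      (λ x → solve-k (u x) (k [ x ]) (k [ suc x ]) (trans (cong₂ (λ a b → u x + (k a - k b)) (sym ([]-⊞ 0 x)) (sym ([]-⊞ 1 x))) (k-equation x)))
      (λ x → solve-g (u (suc x)) (g [ x ]) (g [ suc x ]) (trans (cong₂ (λ a b → u (suc x) + (g a - g b)) (sym ([1+x]⊟[0] x)) (sym ([1+x]⊟[1] x))) (g-equation (suc x))))
      where
      open Equations T (λ f → f [ 0 ] - f [ 1 ]) T-sum solution
      solve-k : ∀ u a b → u + (a - b) ≡ 0ℤ → b ≡ a + u
      solve-k u a b eq = trans (isolate u a b) (trans (cong (λ z → a + u - z) eq) (ℤ.+-identityʳ (a + u)))
        where
        isolate : ∀ u a b → b ≡ a + u - (u + (a - b))
        isolate = solve-∀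
      solve-g : ∀ u a b → u + (b - a) ≡ 0ℤ → a ≡ b + u
      solve-g u a b = solve-k u b a

  -- Compared with `replace-1-by-0`, `u` changes its sign and is shifted by - `h` in the equation
  -- for `k` and by `h` in that for `g`; these shifts agree since `u` has period 2 `h`. It covers
  -- sets `Y` with one element, which can only be `h`.
  replace-h-by-1+h : Y (L.[ h ]) ≡ true → Y (L.[ suc h ]) ≡ false → count Y ≢ 0 → 𝔑-Cay (count Y ℕ.* 4) (M ℕ.+ M)
  replace-h-by-1+h h∈Y 1+h∉Y Y≢∅ = subst (λ d → 𝔑-Cay d (M ℕ.+ M))
    (trans (cong (count R ℕ.+_) count-T) (trans (cong₂ ℕ._+_ count-R count-R) (four (count Y))))
    (dihedrant-in-𝔑-Cay R T 0∉R R-sym (constant-sign T) (balance {T} {λ _ → 1ℤ} (T-sum _) refl) 2≤M+M solved)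
    where
    h∈R : R [ h ] ≡ true
    h∈R = trans (R-[] h) h∈Y
    T : Fin M → Bool
    T = [ suc h ] ⊕ (R ⊖ [ h ])
    1+h∉ : (R ⊖ [ h ]) [ suc h ] ≡ false
    1+h∉ = ⊖-false [ h ] [ suc h ] {R} (trans (R-[] (suc h)) 1+h∉Y)
    count-T : count T ≡ count R
    count-T = trans (count-⊕ [ suc h ] (R ⊖ [ h ]) 1+h∉) (count-⊖ [ h ] R h∈R)
    T-sum : ∀ f → ∑[ T ] f ≡ ∑[ R ] f + (f [ suc h ] - f [ h ])
    T-sum f = trans (∑-⊕ [ suc h ] (R ⊖ [ h ]) f 1+h∉) (trans (collect (f [ suc h ]) (f [ h ]) _)
      (cong (_+ (f [ suc h ] - f [ h ])) (∑-⊖ [ h ] R f h∈R)))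
      where
      collect : ∀ a b s → a + s ≡ b + s + (a - b)
      collect = solve-∀
    solved : ∀ g k → Solution R T 0∉R R-sym g k → ∃[ c ] (∀ a → g a ≡ c * 1ℤ) × (∀ a → k a ≡ - (c * 1ℤ))
    solved g k solution = constant-solution minus-weights shifts (minus-total≢0 Y≢∅)
      (λ x → trans (solve-for (u (c ℕ.+ x)) (k [ x ]) (k [ suc x ])
          (trans (cong₂ (λ a b → u (c ℕ.+ x) + (k a - k b)) (sym ([1+h]⊞[c+x] x)) (sym ([h]⊞[c+x] x))) (k-equation (c ℕ.+ x))))
        (cong (k [ x ] +_) (sym (shifted c x))))
      (λ x → trans (solve-for (u (suc h ℕ.+ x)) (g [ suc x ]) (g [ x ])
          (trans (cong₂ (λ a b → u (suc h ℕ.+ x) + (g a - g b)) (sym ([h+1+x]⊟[1+h] x)) (sym ([h+1+x]⊟[h] x))) (g-equation (suc h ℕ.+ x))))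
        (cong (g [ suc x ] +_) (sym (trans (shifted c (suc x)) (cong -_ (u-shift x))))))
      where
      open Equations T (λ f → f [ suc h ] - f [ h ]) T-sum solution
      u-shift : ∀ x → u (c ℕ.+ suc x) ≡ u (suc h ℕ.+ x)
      u-shift x = trans (cong u (trans (ℕ.+-assoc l h (suc x)) (cong (l ℕ.+_) (ℕ.+-suc h x)))) (u-periodic (suc h ℕ.+ x))
      solve-for : ∀ u a b → u + (b - a) ≡ 0ℤ → b ≡ a + - u
      solve-for u a b eq = trans (isolate u a b) (trans (cong (λ z → a - u + z) eq) (ℤ.+-identityʳ (a - u)))
        where
        isolate : ∀ u a b → b ≡ a - u + (u + (b - a))
        isolate = solve-∀

  -- Two added elements turn the difference into a sum, so solutions alternate in sign. The odd size
  -- of `Y` makes the twisted total odd, hence nonzero.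
  add-0-and-1 : Y (L.[ 1 ]) ≡ false → ∀ j → count Y ≡ 1 ℕ.+ j ℕ.* 2 → 𝔑-Cay (count Y ℕ.* 4 ℕ.+ 2) (M ℕ.+ M)
  add-0-and-1 1∉Y j odd = subst (λ d → 𝔑-Cay d (M ℕ.+ M))
    (trans (cong (count R ℕ.+_) count-T) (trans (cong (λ r → r ℕ.+ (2 ℕ.+ r)) count-R) (four-plus-2 (count Y))))
    (dihedrant-in-𝔑-Cay R T 0∉R R-sym (alternating-sign T) (balance {T} {λ a → alternating (toℕ a)} (T-sum _) signs-cancel) 2≤M+M solved)
    where
    four-plus-2 : ∀ y → y ℕ.* 2 ℕ.+ (2 ℕ.+ y ℕ.* 2) ≡ y ℕ.* 4 ℕ.+ 2
    four-plus-2 = ℕ-Solver.solve-∀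
    1∉R : R [ 1 ] ≡ false
    1∉R = trans (R-[] 1) 1∉Y
    T : Fin M → Bool
    T = [ 0 ] ⊕ [ 1 ] ⊕ R
    0∉ : ([ 1 ] ⊕ R) [ 0 ] ≡ false
    0∉ = ∉-⊕ [ 1 ] R (≡ᵇ-≢ (0≢1 ∘ sym)) 0∉R
    count-T : count T ≡ 2 ℕ.+ count R
    count-T = trans (count-⊕ [ 0 ] ([ 1 ] ⊕ R) 0∉) (cong suc (count-⊕ [ 1 ] R 1∉R))
    T-sum : ∀ f → ∑[ T ] f ≡ ∑[ R ] f + (f [ 0 ] + f [ 1 ])
    T-sum f = trans (∑-⊕ [ 0 ] ([ 1 ] ⊕ R) f 0∉) (trans (cong (f [ 0 ] +_) (∑-⊕ [ 1 ] R f 1∉R)) (collect (f [ 0 ]) (f [ 1 ]) _))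
      where
      collect : ∀ a b s → a + (b + s) ≡ s + (a + b)
      collect = solve-∀
    signs-cancel : alternating (toℕ [ 0 ]) + alternating (toℕ [ 1 ]) ≡ 0ℤ
    signs-cancel = cong₂ _+_ (alternating-[] 0) (alternating-[] 1)
    solved : ∀ g k → Solution R T 0∉R R-sym g k →
      ∃[ c ] (∀ a → g a ≡ c * alternating (toℕ a)) × (∀ a → k a ≡ - (c * alternating (toℕ a)))
    solved g k solution = alternating-solution weights toℕ l-even (twisted-total≢0 j odd)
      (λ x → solve-for (u x) (k [ x ]) (k [ suc x ]) (trans (cong₂ (λ a b → u x + (k a + k b)) (sym ([]-⊞ 0 x)) (sym ([]-⊞ 1 x))) (k-equation x)))
      (λ x → solve-for (u (suc x)) (g [ suc x ]) (g [ x ]) (trans (cong₂ (λ a b → u (suc x) + (g a + g b)) (sym ([1+x]⊟[0] x)) (sym ([1+x]⊟[1] x))) (g-equation (suc x))))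
      where
      open Equations T (λ f → f [ 0 ] + f [ 1 ]) T-sum solution
      solve-for : ∀ u a b → u + (a + b) ≡ 0ℤ → b ≡ - (a + u)
      solve-for u a b eq = trans (isolate u a b) (trans (cong (λ z → - (a + u) + z) eq) (ℤ.+-identityʳ (- (a + u))))
        where
        isolate : ∀ u a b → b ≡ - (a + u) + (u + (a + b))
        isolate = solve-∀

  -- For `Y` of odd size, adding two elements yields the degrees 6 modulo 8; removing two yields the
  -- degrees 2 modulo 8.
  remove-h-and-1+h : Y (L.[ h ]) ≡ true → Y (L.[ suc h ]) ≡ true → ∀ j → count Y ≡ 1 ℕ.+ j ℕ.* 2 →
    ∃[ d ] d ℕ.+ 2 ≡ count Y ℕ.* 4 × 𝔑-Cay d (M ℕ.+ M)
  remove-h-and-1+h h∈Y 1+h∈Y j odd = count R ℕ.+ count T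
    , trans (ℕ.+-assoc (count R) (count T) 2) (trans (cong (count R ℕ.+_) (trans (ℕ.+-comm (count T) 2) count-T)) (trans (cong₂ ℕ._+_ count-R count-R) (four (count Y))))
    , dihedrant-in-𝔑-Cay R T 0∉R R-sym (alternating-sign T) (balance {T} {λ a → alternating (toℕ a)} (T-sum _) signs-cancel) 2≤M+M solved
    where
    h∈R : R [ h ] ≡ true
    h∈R = trans (R-[] h) h∈Y
    R⁻ T : Fin M → Bool
    R⁻ = R ⊖ [ h ]
    T = R⁻ ⊖ [ suc h ]
    1+h∈R⁻ : R⁻ [ suc h ] ≡ true
    1+h∈R⁻ = ⊖-true {[ h ]} {[ suc h ]} {R} h≢1+h (trans (R-[] (suc h)) 1+h∈Y)
    count-T : 2 ℕ.+ count T ≡ count R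
    count-T = trans (cong suc (count-⊖ [ suc h ] R⁻ 1+h∈R⁻)) (count-⊖ [ h ] R h∈R)
    T-sum : ∀ f → ∑[ T ] f ≡ ∑[ R ] f + (- f [ suc h ] - f [ h ])
    T-sum f = trans (collect (f [ h ]) (f [ suc h ]) _) (cong (_+ (- f [ suc h ] - f [ h ]))
      (trans (cong (f [ h ] +_) (∑-⊖ [ suc h ] R⁻ f 1+h∈R⁻)) (∑-⊖ [ h ] R f h∈R)))
      where
      collect : ∀ a b s → s ≡ a + (b + s) + (- b - a)
      collect = solve-∀
    signs-cancel : - alternating (toℕ [ suc h ]) - alternating (toℕ [ h ]) ≡ 0ℤ
    signs-cancel = trans (cong₂ (λ a b → - a - b) (alternating-[] (suc h)) (alternating-[] h)) (cancel (alternating h))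
      where
      cancel : ∀ a → - - a - a ≡ 0ℤ
      cancel = solve-∀
    solved : ∀ g k → Solution R T 0∉R R-sym g k →
      ∃[ c ] (∀ a → g a ≡ c * alternating (toℕ a)) × (∀ a → k a ≡ - (c * alternating (toℕ a)))
    solved g k solution = alternating-solution minus-weights shifts l-even (minus-twisted-total≢0 j odd)
      (λ x → trans (solve-for (u (c ℕ.+ x)) (k [ x ]) (k [ suc x ])
          (trans (cong₂ (λ a b → u (c ℕ.+ x) + (- k a - k b)) (sym ([1+h]⊞[c+x] x)) (sym ([h]⊞[c+x] x))) (k-equation (c ℕ.+ x))))
        (cong (λ z → - (k [ x ] + z)) (sym (shifted c x))))
      (λ x → trans (solve-for (u (suc h ℕ.+ x)) (g [ suc x ]) (g [ x ])
          (trans (cong₂ (λ a b → u (suc h ℕ.+ x) + (- g a - g b)) (sym ([h+1+x]⊟[1+h] x)) (sym ([h+1+x]⊟[h] x))) (g-equation (suc h ℕ.+ x))))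
        (cong (λ z → - (g [ suc x ] + z)) (sym (trans (shifted c (suc x)) (cong -_ (u-shift x))))))
      where
      open Equations T (λ f → - f [ suc h ] - f [ h ]) T-sum solution
      u-shift : ∀ x → u (c ℕ.+ suc x) ≡ u (suc h ℕ.+ x)
      u-shift x = trans (cong u (trans (ℕ.+-assoc l h (suc x)) (cong (l ℕ.+_) (ℕ.+-suc h x)))) (u-periodic (suc h ℕ.+ x))
      solve-for : ∀ u a b → u + (- b - a) ≡ 0ℤ → b ≡ - (a + - u)
      solve-for u a b eq = trans (isolate u a b) (trans (cong (λ z → - (a - u) - z) eq) (ℤ.+-identityʳ (- (a - u))))
        where
        isolate : ∀ u a b → b ≡ - (a - u) - (u + (- b - a))
        isolate = solve-∀

-- The certificate is B A = r I - s X Xᵀ. Applied to a kernel vector Y it gives r Y = s (X · Y) X,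
-- so Y is a multiple of X.
certified-nut : (G : Graph n) → 2 ≤ n → (X : Fin n → ℤ) (B : Fin n → Fin n → ℤ) (r s : ℤ) → r ≢ 0ℤ →
  (∀ i → ∑[ adj G i ] X ≡ 0ℤ) → (∀ i → X i ≢ 0ℤ) →
  (∀ i k → sum (λ j → B i j * on (adj G j k) 1ℤ) ≡ r * on (i ≡ᵇ k) 1ℤ - s * (X i * X k)) → Nutℤ G
certified-nut {n} G 2≤n X B r s r≢0 X∈ker X≢0 BA≡ = record
  { 2≤n = 2≤n ; vector = X ; in-kernel = X∈ker ; nonzero = X≢0
  ; spans = λ Y Y∈ker i j → *-cancelʳ-≢0 r≢0 (begin
      Y i * X j * r ≡⟨ regroup (Y i) (X j) r ⟩
      X j * (r * Y i) ≡⟨ cong (X j *_) (proportional Y Y∈ker i) ⟩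
      X j * (s * X i * dot Y) ≡⟨ swap (X i) (X j) s (dot Y) ⟩
      X i * (s * X j * dot Y) ≡⟨ cong (X i *_) (proportional Y Y∈ker j) ⟨
      X i * (r * Y j) ≡⟨ regroup (Y j) (X i) r ⟨
      Y j * X i * r ∎)
  }
  where
  open ≡-Reasoning
  regroup : ∀ a b r → a * b * r ≡ b * (r * a)
  regroup = solve-∀
  swap : ∀ a b s d → b * (s * a * d) ≡ a * (s * b * d)
  swap = solve-∀
  dot : (Fin n → ℤ) → ℤ
  dot Y = sum (λ k → X k * Y k)
  proportional : ∀ Y → Kernel G Y → ∀ i → r * Y i ≡ s * X i * dot Y
  proportional Y Y∈ker i = trans (isolate (r * Y i) (s * X i * dot Y)) (trans (cong (_+ s * X i * dot Y) (sym expanded)) (ℤ.+-identityˡ _))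
    where
    isolate : ∀ a b → a ≡ (a - b) + b
    isolate = solve-∀
    term : Fin n → ℤ
    term k = r * on (i ≡ᵇ k) (Y k) + (- (s * X i)) * (X k * Y k)
    pointwise : ∀ k → sum (λ j → B i j * on (adj G j k) (Y k)) ≡ term k
    pointwise k = begin
      sum (λ j → B i j * on (adj G j k) (Y k))
        ≡⟨ sum-cong-≗ (λ j → trans (cong (B i j *_) (on-* (adj G j k) (Y k))) (factor (B i j) (on (adj G j k) 1ℤ) (Y k))) ⟩
      sum (λ j → Y k * (B i j * on (adj G j k) 1ℤ))
        ≡⟨ sum-*ˡ (Y k) (λ j → B i j * on (adj G j k) 1ℤ) ⟩
      Y k * sum (λ j → B i j * on (adj G j k) 1ℤ)
        ≡⟨ cong (Y k *_) (BA≡ i k) ⟩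
      Y k * (r * on (i ≡ᵇ k) 1ℤ - s * (X i * X k))
        ≡⟨ collect (Y k) r (on (i ≡ᵇ k) 1ℤ) s (X i) (X k) ⟩
      r * (on (i ≡ᵇ k) 1ℤ * Y k) + (- (s * X i)) * (X k * Y k)
        ≡⟨ cong (λ z → r * z + (- (s * X i)) * (X k * Y k)) (on-* (i ≡ᵇ k) (Y k)) ⟨
      term k ∎
      where
      factor : ∀ a b c → a * (b * c) ≡ c * (a * b)
      factor = solve-∀
      collect : ∀ y r d s a b → y * (r * d - s * (a * b)) ≡ r * (d * y) + (- (s * a)) * (b * y)
      collect = solve-∀
    expanded : 0ℤ ≡ r * Y i - s * X i * dot Y
    expanded = begin
      0ℤ
        ≡⟨ sum-0 {f = λ j → B i j * ∑[ adj G j ] Y} (λ j → trans (cong (B i j *_) (Y∈ker j)) (ℤ.*-zeroʳ (B i j))) ⟨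
      sum (λ j → B i j * ∑[ adj G j ] Y)
        ≡⟨ sum-cong-≗ (λ j → sym (sum-*ˡ (B i j) (λ k → on (adj G j k) (Y k)))) ⟩
      sum (λ j → sum (λ k → B i j * on (adj G j k) (Y k)))
        ≡⟨ ∑-comm (λ j k → B i j * on (adj G j k) (Y k)) ⟩
      sum (λ k → sum (λ j → B i j * on (adj G j k) (Y k)))
        ≡⟨ sum-cong-≗ pointwise ⟩
      sum term
        ≡⟨ ∑-distrib-+ (λ k → r * on (i ≡ᵇ k) (Y k)) _ ⟩
      sum (λ k → r * on (i ≡ᵇ k) (Y k)) + sum (λ k → (- (s * X i)) * (X k * Y k))
        ≡⟨ cong₂ _+_ (trans (sum-*ˡ r (λ k → on (i ≡ᵇ k) (Y k))) (cong (r *_) (sum-≡ᵇ i Y))) (sum-*ˡ (- (s * X i)) (λ k → X k * Y k)) ⟩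
      r * Y i + (- (s * X i)) * dot Y
        ≡⟨ cong (r * Y i +_) (ℤ.neg-distribˡ-* (s * X i) (dot Y)) ⟨
      r * Y i - s * X i * dot Y ∎

module Order12 where
  open Dihedral 6
  open FiniteGroup dihedral using (_∙_; _⁻¹)

  R T : Fin 6 → Bool
  R = Vec.lookup (false Vec.∷ true Vec.∷ false Vec.∷ true Vec.∷ false Vec.∷ true Vec.∷ Vec.[])
  T = Vec.lookup (true Vec.∷ true Vec.∷ false Vec.∷ false Vec.∷ true Vec.∷ false Vec.∷ Vec.[])

  R-sym : ∀ a → R (Cyclic.⊟_ 6 a) ≡ R a
  R-sym = toWitness {a? = Fin.all? λ a → R (Cyclic.⊟_ 6 a) Bool.≟ R a} tt

  G : Graph 12
  G = dihedrant R T refl R-sym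

  X : Fin 12 → ℤ
  X i = sgn (6 ℕ.≤ᵇ toℕ i)

  -- The row at the identity of 144 times the Moore–Penrose inverse of the
  -- adjacency matrix; each row is a translate of it.
  β : Vec.Vec ℤ 12
  β = ℤ.- pos 7 Vec.∷ pos 11 Vec.∷ ℤ.- pos 7 Vec.∷ pos 11 Vec.∷ ℤ.- pos 7 Vec.∷ pos 11 Vec.∷
      pos 47 Vec.∷ pos 53 Vec.∷ ℤ.- pos 49 Vec.∷ ℤ.- pos 43 Vec.∷ ℤ.-1ℤ Vec.∷ pos 5 Vec.∷ Vec.[]

  order-12-degree-6 : 𝔑-Cay 6 12
  order-12-degree-6 = G , dihedrant-regular R T refl R-sym , (12 , dihedral , connection R T refl R-sym , idₚ , λ _ _ → refl)
    -- `X` has squared norm 12, so the projection along it is I - X Xᵀ / 12; scaling by 144 gives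
    -- the constants 144 and 12.
    , Nutℤ⇒Nut (certified-nut G (s≤s (s≤s z≤n)) X B (pos 144) (pos 12) (λ ())
        (toWitness {a? = Fin.all? λ i → ∑[ adj G i ] X ℤ.≟ 0ℤ} tt) (λ i → sgn≢0 (6 ℕ.≤ᵇ toℕ i))
        (toWitness {a? = Fin.all? λ i → Fin.all? λ k → sum (λ j → B i j * on (adj G j k) 1ℤ) ℤ.≟ (pos 144 * on (i ≡ᵇ k) 1ℤ - pos 12 * (X i * X k))} tt))
    where
    B : Fin 12 → Fin 12 → ℤ
    B i j = Vec.lookup β (j ∙ i ⁻¹)

-- Dihedral groups of order 4 l with l even

module EvenHalf (p : ℕ) where
  h l : ℕ
  h = suc p
  l = h ℕ.+ h

  open CyclicSelection l public

  -[h] : ⊟ [ h ] ≡ [ h ]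
  -[h] = ⊟-complement {h} refl

  h<l : h < l
  h<l = ℕ.m<m+n h (s≤s z≤n)

  0<l : 0 < l
  0<l = s≤s z≤n

  1<l : 1 < l
  1<l = s≤s (ℕ.≤-trans (s≤s z≤n) (ℕ.m≤n+m h p))

  degree-4 : 𝔑-Cay 4 ((l ℕ.+ l) ℕ.+ (l ℕ.+ l))
  degree-4 = subst (λ c → 𝔑-Cay (c ℕ.* 4) ((l ℕ.+ l) ℕ.+ (l ℕ.+ l))) count-Y
    (PairedFamilies.replace-h-by-1+h h {l} refl Y Y-sym (∉-⊕ [ h ] ∅ₛ (distinct h<l 0<l λ ()) refl)
      (∈-⊕ˡ [ h ] ∅ₛ) (∉-⊕ [ h ] ∅ₛ (≡ᵇ-≢ h≢1+h) refl) λ eq → contradiction (trans (sym count-Y) eq) λ ())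
    where
    Y : Fin l → Bool
    Y = [ h ] ⊕ ∅ₛ
    Y-sym : Invariant Y
    Y-sym = ⊕-invariant [ h ] ∅ₛ -[h] ∅-invariant
    count-Y : count Y ≡ 1
    count-Y = trans (count-⊕ [ h ] ∅ₛ refl) (cong suc (count-∅ {l}))
    h≢1+h : [ h ] ≢ [ suc h ]
    h≢1+h eq = contradiction ([]-injective 0<l 1<l
      (trans (sym ([]-⊟ 0 h)) (trans (cong (_⊟ [ h ]) eq) ([]-⊟ 1 h)))) λ ()

  module _ (1≤p : 1 ≤ p) (i : ℕ) (room : 4 ℕ.+ i ℕ.* 2 ≤ l) where
    private
      1<h : 1 < h
      1<h = s≤s 1≤p

    module NearZero where
      private
        e : ℕ
        e = p ℕ.+ h

        -1≡e : ⊟ [ 1 ] ≡ [ e ]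
        -1≡e = ⊟-complement {1} {e} refl

        e<l : e < l
        e<l = ℕ.≤-refl

        1<e : 1 < e
        1<e = ℕ.≤-trans 1<h (ℕ.m≤n+m h p)

        h<e : h < e
        h<e = ℕ.m<n+m h 1≤p

        points : List (Fin l)
        points = [ 0 ] ∷ [ h ] ∷ [ 1 ] ∷ [ e ] ∷ []

        fixed-points : ∀ {x} → ⊟ x ≡ x → x ∈ₗ points
        fixed-points fixed with self-inverse h refl fixed
        ... | inj₁ x≡0 = here x≡0
        ... | inj₂ x≡h = there (here x≡h)

        invariant-points : Invariant ⟦ points ⟧
        invariant-points = ⊕-invariant [ 0 ] _ -[0] (⊕-invariant [ h ] _ -[h] (⊕⊕-invariant [ 1 ] _ -1≡e ∅-invariant))

        open Avoiding points invariant-points fixed-points i room renaming (set to W)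

        -- `replace-1-by-0` requires 1 in the set, and adjoining the involution `h` changes the
        -- parity of its size. `add-0-and-1` requires a set of odd size without 1.
        Y₁ Y₂ Y₃ : Fin l → Bool
        Y₁ = [ 1 ] ⊕ [ e ] ⊕ W
        Y₂ = [ h ] ⊕ Y₁
        Y₃ = [ h ] ⊕ W

        Y₁-invariant : Invariant Y₁
        Y₁-invariant = ⊕⊕-invariant [ 1 ] W -1≡e invariant

        0∉Y₁ : Y₁ [ 0 ] ≡ false
        0∉Y₁ = ∉-⊕ [ 1 ] ([ e ] ⊕ W) (distinct 1<l 0<l λ ())
          (∉-⊕ [ e ] W (distinct e<l 0<l (ℕ.<⇒≢ (ℕ.≤-trans (s≤s z≤n) 1<e) ∘ sym)) (outside [ 0 ] (here refl)))

        h∉Y₁ : Y₁ [ h ] ≡ false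
        h∉Y₁ = ∉-⊕ [ 1 ] ([ e ] ⊕ W) (distinct 1<l h<l (ℕ.<⇒≢ 1<h))
          (∉-⊕ [ e ] W (distinct e<l h<l (ℕ.<⇒≢ h<e ∘ sym)) (outside [ h ] (there (here refl))))

        count-Y₁ : count Y₁ ≡ 2 ℕ.+ i ℕ.* 2
        count-Y₁ = trans (count-⊕ [ 1 ] ([ e ] ⊕ W)
            (∉-⊕ [ e ] W (distinct e<l 1<l (ℕ.<⇒≢ 1<e ∘ sym)) (outside [ 1 ] (there (there (here refl))))))
          (cong suc (trans (count-⊕ [ e ] W (outside [ e ] (there (there (there (here refl)))))) (cong suc count≡)))

        count-Y₂ : count Y₂ ≡ 3 ℕ.+ i ℕ.* 2
        count-Y₂ = trans (count-⊕ [ h ] Y₁ h∉Y₁) (cong suc count-Y₁)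

        count-Y₃ : count Y₃ ≡ 1 ℕ.+ i ℕ.* 2
        count-Y₃ = trans (count-⊕ [ h ] W (outside [ h ] (there (here refl)))) (cong suc count≡)

      even-quarter : 𝔑-Cay ((2 ℕ.+ i ℕ.* 2) ℕ.* 4) ((l ℕ.+ l) ℕ.+ (l ℕ.+ l))
      even-quarter = subst (λ c → 𝔑-Cay (c ℕ.* 4) ((l ℕ.+ l) ℕ.+ (l ℕ.+ l))) count-Y₁
        (PairedFamilies.replace-1-by-0 h {l} refl Y₁ Y₁-invariant 0∉Y₁ (∈-⊕ˡ [ 1 ] ([ e ] ⊕ W))
          λ eq → contradiction (trans (sym count-Y₁) eq) λ ())

      odd-quarter : 𝔑-Cay ((3 ℕ.+ i ℕ.* 2) ℕ.* 4) ((l ℕ.+ l) ℕ.+ (l ℕ.+ l))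
      odd-quarter = subst (λ c → 𝔑-Cay (c ℕ.* 4) ((l ℕ.+ l) ℕ.+ (l ℕ.+ l))) count-Y₂
        (PairedFamilies.replace-1-by-0 h {l} refl Y₂ (⊕-invariant [ h ] Y₁ -[h] Y₁-invariant)
          (∉-⊕ [ h ] Y₁ (distinct h<l 0<l λ ()) 0∉Y₁) (∈-⊕ʳ [ h ] Y₁ (∈-⊕ˡ [ 1 ] ([ e ] ⊕ W)))
          λ eq → contradiction (trans (sym count-Y₂) eq) λ ())

      degree-6-mod-8 : 𝔑-Cay ((1 ℕ.+ i ℕ.* 2) ℕ.* 4 ℕ.+ 2) ((l ℕ.+ l) ℕ.+ (l ℕ.+ l))
      degree-6-mod-8 = subst (λ c → 𝔑-Cay (c ℕ.* 4 ℕ.+ 2) ((l ℕ.+ l) ℕ.+ (l ℕ.+ l))) count-Y₃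
        (PairedFamilies.add-0-and-1 h {l} refl Y₃ (⊕-invariant [ h ] W -[h] invariant)
          (∉-⊕ [ h ] W (distinct h<l 0<l λ ()) (outside [ 0 ] (here refl)))
          (∉-⊕ [ h ] W (distinct h<l 1<l (ℕ.<⇒≢ 1<h ∘ sym)) (outside [ 1 ] (there (there (here refl)))))
          i count-Y₃)

    module NearHalf where
      private
        -[1+h]≡p : ⊟ [ suc h ] ≡ [ p ]
        -[1+h]≡p = ⊟-complement {suc h} {p} (sym (ℕ.+-suc h p))

        p<l : p < l
        p<l = ℕ.<-trans ℕ.≤-refl h<l

        1+h<l : suc h < l
        1+h<l = ℕ.≤-trans (ℕ.≤-reflexive (ℕ.+-comm 2 h)) (ℕ.+-monoʳ-≤ h 1<h)

        points : List (Fin l)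
        points = [ 0 ] ∷ [ h ] ∷ [ suc h ] ∷ [ p ] ∷ []

        fixed-points : ∀ {x} → ⊟ x ≡ x → x ∈ₗ points
        fixed-points fixed with self-inverse h refl fixed
        ... | inj₁ x≡0 = here x≡0
        ... | inj₂ x≡h = there (here x≡h)

        invariant-points : Invariant ⟦ points ⟧
        invariant-points = ⊕-invariant [ 0 ] _ -[0] (⊕-invariant [ h ] _ -[h] (⊕⊕-invariant [ suc h ] _ -[1+h]≡p ∅-invariant))

        open Avoiding points invariant-points fixed-points i room renaming (set to W)

        -- `h` and `h` + 1 are present for removal; symmetry brings in `p`, which is - (`h` + 1).
        Y′ Y : Fin l → Bool
        Y′ = [ suc h ] ⊕ [ p ] ⊕ W
        Y = [ h ] ⊕ Y′

        p≢0 : p ≢ 0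
        p≢0 eq = ℕ.<⇒≢ 1≤p (sym eq)

        0∉Y : Y [ 0 ] ≡ false
        0∉Y = ∉-⊕ [ h ] Y′ (distinct h<l 0<l λ ()) (∉-⊕ [ suc h ] ([ p ] ⊕ W) (distinct 1+h<l 0<l λ ())
          (∉-⊕ [ p ] W (distinct p<l 0<l p≢0) (outside [ 0 ] (here refl))))

        count-Y : count Y ≡ 3 ℕ.+ i ℕ.* 2
        count-Y = trans (count-⊕ [ h ] Y′ (∉-⊕ [ suc h ] ([ p ] ⊕ W) (distinct 1+h<l h<l ℕ.1+n≢n)
            (∉-⊕ [ p ] W (distinct p<l h<l (ℕ.1+n≢n ∘ sym)) (outside [ h ] (there (here refl))))))
          (cong suc (trans (count-⊕ [ suc h ] ([ p ] ⊕ W)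
              (∉-⊕ [ p ] W (distinct p<l 1+h<l (ℕ.<⇒≢ (ℕ.m<n+m p {2} (s≤s z≤n)))) (outside [ suc h ] (there (there (here refl))))))
            (cong suc (trans (count-⊕ [ p ] W (outside [ p ] (there (there (there (here refl)))))) (cong suc count≡)))))

      degree-2-mod-8 : ∃[ d ] d ℕ.+ 2 ≡ (3 ℕ.+ i ℕ.* 2) ℕ.* 4 × 𝔑-Cay d ((l ℕ.+ l) ℕ.+ (l ℕ.+ l))
      degree-2-mod-8 = subst (λ c → ∃[ d ] d ℕ.+ 2 ≡ c ℕ.* 4 × 𝔑-Cay d ((l ℕ.+ l) ℕ.+ (l ℕ.+ l))) count-Y
        (PairedFamilies.remove-h-and-1+h h {l} refl Y
          (⊕-invariant [ h ] Y′ -[h] (⊕⊕-invariant [ suc h ] W -[1+h]≡p invariant)) 0∉Y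
          (∈-⊕ˡ [ h ] Y′) (∈-⊕ʳ [ h ] Y′ (∈-⊕ˡ [ suc h ] ([ p ] ⊕ W))) (1 ℕ.+ i) count-Y)

-- All admissible pairs

fourfold : ℕ → ℕ
fourfold l = (l ℕ.+ l) ℕ.+ (l ℕ.+ l)

2*≡+ : ∀ k → 2 ℕ.* k ≡ k ℕ.+ k
2*≡+ = ℕ-Solver.solve-∀

-- The left side of the hypothesis is odd and the right side even, so the inequality is strict.
next-even : ∀ {i h} → 3 ℕ.+ 2 ℕ.* i ≤ h ℕ.+ h → 4 ℕ.+ i ℕ.* 2 ≤ h ℕ.+ h
next-even {i} {h} le = subst (λ k → 4 ℕ.+ k ≤ h ℕ.+ h) (ℕ.*-comm 2 i)
  (ℕ.≤∧≢⇒< le λ eq → odd≢even (1 ℕ.+ i) h (trans (lemma i) (trans eq (sym (2*≡+ h)))))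
  where
  lemma : ∀ i → 1 ℕ.+ 2 ℕ.* (1 ℕ.+ i) ≡ 3 ℕ.+ 2 ℕ.* i
  lemma = ℕ-Solver.solve-∀

predecessor : ∀ k h → 3 ℕ.+ k ≤ h ℕ.+ h → ∃[ p ] 1 ≤ p × h ≡ suc p
predecessor k (suc zero)    (s≤s (s≤s ()))
predecessor k (suc (suc p)) _ = suc p , s≤s z≤n , refl

-- The set of rotations modulo l = h + h has 1 + `i` elements. It is symmetric without 0, so the
-- parity of its size decides whether it contains `h`.
𝔑-Cay-8∣n : ∀ i h → 2 ℕ.+ i ≤ h ℕ.+ h →
  𝔑-Cay ((1 ℕ.+ i) ℕ.* 4) (fourfold (h ℕ.+ h))
𝔑-Cay-8∣n zero    (suc p) _ = EvenHalf.degree-4 p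
𝔑-Cay-8∣n (suc i) h room with predecessor i h room | halve i
... | p , 1≤p , refl | i′ , inj₁ refl = subst (λ k → 𝔑-Cay ((2 ℕ.+ k) ℕ.* 4) (fourfold (suc p ℕ.+ suc p))) (ℕ.*-comm i′ 2)
  (EvenHalf.NearZero.even-quarter p 1≤p i′ (next-even {i′} {suc p} room))
... | p , 1≤p , refl | i′ , inj₂ refl = subst (λ k → 𝔑-Cay ((3 ℕ.+ k) ℕ.* 4) (fourfold (suc p ℕ.+ suc p))) (ℕ.*-comm i′ 2)
  (EvenHalf.NearZero.odd-quarter p 1≤p i′ (subst (λ k → 4 ℕ.+ k ≤ suc p ℕ.+ suc p) (ℕ.*-comm 2 i′) room))

𝔑-Cay-4∣n : ∀ i l → 4 ℕ.+ i ℕ.* 2 ≤ l ℕ.+ l → 𝔑-Cay ((1 ℕ.+ i) ℕ.* 4) (fourfold l)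
𝔑-Cay-4∣n i l room with halve l
... | zero  , inj₂ refl = contradiction room λ { (s≤s (s≤s ())) }
... | suc t , inj₂ refl = subst (λ d → 𝔑-Cay d (fourfold l)) (lemma i) (OddHalf₀.odd-half₀ (suc t) i (s≤s z≤n) room)
  where
  lemma : ∀ i → (2 ℕ.+ i ℕ.* 2) ℕ.+ (2 ℕ.+ i ℕ.* 2) ≡ (1 ℕ.+ i) ℕ.* 4
  lemma = ℕ-Solver.solve-∀
... | h , inj₁ l≡2h = subst (λ l → 𝔑-Cay ((1 ℕ.+ i) ℕ.* 4) (fourfold l)) (sym l≡h+h)
  (𝔑-Cay-8∣n i h (ℕ.*-cancelʳ-≤ (2 ℕ.+ i) (h ℕ.+ h) 2 (subst (4 ℕ.+ i ℕ.* 2 ≤_) (trans (cong (λ l → l ℕ.+ l) l≡h+h) (double (h ℕ.+ h))) room)))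
  where
  l≡h+h : l ≡ h ℕ.+ h
  l≡h+h = trans l≡2h (2*≡+ h)
  double : ∀ k → k ℕ.+ k ≡ k ℕ.* 2
  double = ℕ-Solver.solve-∀

𝔑-Cay-2∣n : ∀ i m → 4 ℕ.+ i ℕ.* 2 ≤ m → 𝔑-Cay ((1 ℕ.+ i) ℕ.* 4) (m ℕ.+ m)
𝔑-Cay-2∣n i m room with halve m
... | l , inj₁ m≡2l = subst (λ m → 𝔑-Cay ((1 ℕ.+ i) ℕ.* 4) (m ℕ.+ m)) (sym m≡l+l)
  (𝔑-Cay-4∣n i l (subst (4 ℕ.+ i ℕ.* 2 ≤_) m≡l+l room))
  where
  m≡l+l : m ≡ l ℕ.+ l
  m≡l+l = trans m≡2l (2*≡+ l)
... | t , inj₂ m≡1+2t = subst (λ d → 𝔑-Cay d (m ℕ.+ m)) (lemma i)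
  (OddOrder.odd-order m {{ℕ.>-nonZero (ℕ.≤-trans (s≤s z≤n) room)}} t i m≡1+2t
    (ℕ.≤∧≢⇒< room λ eq → odd≢even t (2 ℕ.+ i) (trans (sym m≡1+2t) (trans (sym eq) (even i)))))
  where
  lemma : ∀ i → (2 ℕ.+ i ℕ.* 2) ℕ.+ (2 ℕ.+ i ℕ.* 2) ≡ (1 ℕ.+ i) ℕ.* 4
  lemma = ℕ-Solver.solve-∀
  even : ∀ i → 4 ℕ.+ i ℕ.* 2 ≡ 2 ℕ.* (2 ℕ.+ i)
  even = ℕ-Solver.solve-∀

𝔑-Cay-2mod4 : ∀ i l → 3 ℕ.+ i ≤ l → 𝔑-Cay (6 ℕ.+ i ℕ.* 4) (fourfold l)
𝔑-Cay-2mod4 i l room with halve l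
𝔑-Cay-2mod4 i       l room | 0 , inj₂ refl = contradiction room λ { (s≤s ()) }
-- For l = 3 the bound leaves only degree 6, and l = 3 is too small for `OddHalf₂`.
𝔑-Cay-2mod4 zero    l room | 1 , inj₂ refl = Order12.order-12-degree-6
𝔑-Cay-2mod4 (suc i) l room | 1 , inj₂ refl = contradiction room λ { (s≤s (s≤s (s≤s ()))) }
𝔑-Cay-2mod4 i l room | suc (suc s) , inj₂ refl = subst (λ d → 𝔑-Cay d (fourfold l)) (lemma i)
  (OddHalf₂.odd-half₂ s i (subst (ℕ._≤ l ℕ.+ l) (double i) (ℕ.+-mono-≤ room room)))
  where
  lemma : ∀ i → (3 ℕ.+ i ℕ.* 2) ℕ.+ (3 ℕ.+ i ℕ.* 2) ≡ 6 ℕ.+ i ℕ.* 4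
  lemma = ℕ-Solver.solve-∀
  double : ∀ i → 3 ℕ.+ i ℕ.+ (3 ℕ.+ i) ≡ 6 ℕ.+ i ℕ.* 2
  double = ℕ-Solver.solve-∀
𝔑-Cay-2mod4 i l room | h , inj₁ l≡2h = subst (λ l → 𝔑-Cay (6 ℕ.+ i ℕ.* 4) (fourfold l)) (sym l≡h+h)
  (even-case h i (subst (3 ℕ.+ i ≤_) l≡h+h room))
  where
  l≡h+h : l ≡ h ℕ.+ h
  l≡h+h = trans l≡2h (2*≡+ h)
  even-case : ∀ h i → 3 ℕ.+ i ≤ h ℕ.+ h →
    𝔑-Cay (6 ℕ.+ i ℕ.* 4) (fourfold (h ℕ.+ h))
  even-case h i room with predecessor i h room | halve i
  ... | p , 1≤p , refl | i′ , inj₁ refl = subst (λ d → 𝔑-Cay d (fourfold (suc p ℕ.+ suc p))) (lemma i′)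
    (EvenHalf.NearZero.degree-6-mod-8 p 1≤p i′ (next-even {i′} {suc p} room))
    where
    lemma : ∀ i → (1 ℕ.+ i ℕ.* 2) ℕ.* 4 ℕ.+ 2 ≡ 6 ℕ.+ 2 ℕ.* i ℕ.* 4
    lemma = ℕ-Solver.solve-∀
  ... | p , 1≤p , refl | i′ , inj₂ refl = conclude {fourfold (suc p ℕ.+ suc p)}
    (EvenHalf.NearHalf.degree-2-mod-8 p 1≤p i′ (subst (λ k → 4 ℕ.+ k ≤ suc p ℕ.+ suc p) (ℕ.*-comm 2 i′) room))
    where
    lemma : ∀ i → (3 ℕ.+ i ℕ.* 2) ℕ.* 4 ≡ 6 ℕ.+ (1 ℕ.+ 2 ℕ.* i) ℕ.* 4 ℕ.+ 2
    lemma = ℕ-Solver.solve-∀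
    conclude : ∀ {n} → ∃[ d ] d ℕ.+ 2 ≡ (3 ℕ.+ i′ ℕ.* 2) ℕ.* 4 × 𝔑-Cay d n → 𝔑-Cay (6 ℕ.+ (1 ℕ.+ 2 ℕ.* i′) ℕ.* 4) n
    conclude {n} (d , eq , G) = subst (λ d → 𝔑-Cay d n) (ℕ.+-cancelʳ-≡ 2 _ _ (trans eq (lemma i′))) G

Admissible⇒Cay : ∀ {d n} → Admissible d n → 𝔑-Cay d n
Admissible⇒Cay (inj₁ (divides zero refl , () , _))
Admissible⇒Cay (inj₁ (divides (suc i) refl , _ , divides m refl , room)) =
  subst (𝔑-Cay ((1 ℕ.+ i) ℕ.* 4)) (double m) (𝔑-Cay-2∣n i m (ℕ.*-cancelʳ-≤ (4 ℕ.+ i ℕ.* 2) m 2 (subst (ℕ._≤ m ℕ.* 2) (lemma i) room)))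
  where
  double : ∀ k → k ℕ.+ k ≡ k ℕ.* 2
  double = ℕ-Solver.solve-∀
  lemma : ∀ i → (1 ℕ.+ i) ℕ.* 4 ℕ.+ 4 ≡ (4 ℕ.+ i ℕ.* 2) ℕ.* 2
  lemma = ℕ-Solver.solve-∀
Admissible⇒Cay {d} (inj₂ (d%4≡2 , 6≤d , divides l refl , room)) =
  from-quotient (d / 4) (trans (m≡m%n+[m/n]*n d 4) (cong (ℕ._+ d / 4 ℕ.* 4) d%4≡2)) 6≤d room
  where
  quadruple-l : ∀ l → (l ℕ.+ l) ℕ.+ (l ℕ.+ l) ≡ l ℕ.* 4
  quadruple-l = ℕ-Solver.solve-∀
  lemma : ∀ i → 6 ℕ.+ i ℕ.* 4 ℕ.+ 6 ≡ (3 ℕ.+ i) ℕ.* 4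
  lemma = ℕ-Solver.solve-∀
  from-quotient : ∀ {d} e → d ≡ 2 ℕ.+ e ℕ.* 4 → 6 ≤ d → d ℕ.+ 6 ≤ l ℕ.* 4 → 𝔑-Cay d (l ℕ.* 4)
  from-quotient zero    refl (s≤s (s≤s ())) _
  from-quotient (suc i) refl _ room = subst (𝔑-Cay (6 ℕ.+ i ℕ.* 4)) (quadruple-l l)
    (𝔑-Cay-2mod4 i l (ℕ.*-cancelʳ-≤ (3 ℕ.+ i) l 4 (subst (ℕ._≤ l ℕ.* 4) (lemma i) room)))

Cay⇒Admissible : ∀ {d n} → 𝔑-Cay d n → Admissible d n
Cay⇒Admissible = VT⇒Admissible ∘ Cay⇒VT

Admissible⇒even : ∀ {d n} → Admissible d n → d % 2 ≡ 0
Admissible⇒even (inj₁ (4∣d , _)) = n∣m⇒m%n≡0 _ 2 (∣-trans (divides 2 refl) 4∣d)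
Admissible⇒even {d} (inj₂ (d%4≡2 , _)) = trans (sym (m∣n⇒o%n%m≡o%m 2 4 d (divides 2 refl))) (cong (_% 2) d%4≡2)

Admissible⇒4≤d : ∀ {d n} → Admissible d n → 4 ≤ d
Admissible⇒4≤d (inj₁ (_ , 4≤d , _)) = 4≤d
Admissible⇒4≤d (inj₂ (_ , 6≤d , _)) = ℕ.≤-trans (ℕ.m≤m+n 4 2) 6≤d

4∣d⇒d%4≢2 : ∀ {d} → 4 ∣ d → d % 4 ≢ 2
4∣d⇒d%4≢2 {d} 4∣d d%4≡2 = contradiction (trans (sym (n∣m⇒m%n≡0 d 4 4∣d)) d%4≡2) λ ()

mainTheorem1 : ∀ (d : ℕ) →
    (𝔑-VT d ≐ 𝔑-Cay d)
    × (d % 2 ≡ 1 ⊎ d < 4 → 𝔑-Cay d ≐ ∅)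
    × (4 ∣ d × 4 ≤ d → 𝔑-Cay d ≐ (λ n → 2 ∣ n × d ℕ.+ 4 ≤ n))
    × (d % 4 ≡ 2 × 6 ≤ d → 𝔑-Cay d ≐ (λ n → 4 ∣ n × d ℕ.+ 6 ≤ n))
mainTheorem1 d =
    ((λ G → Admissible⇒Cay (VT⇒Admissible G)) , Cay⇒VT)
  , (λ bad → (λ G → impossible bad (Cay⇒Admissible G)) , λ ())
  , (λ (4∣d , 4≤d) → (λ G → bounds₀ 4∣d (Cay⇒Admissible G))
      , λ (2∣n , room) → Admissible⇒Cay (inj₁ (4∣d , 4≤d , 2∣n , room)))
  , (λ (d%4≡2 , 6≤d) → (λ G → bounds₂ d%4≡2 (Cay⇒Admissible G))
      , λ (4∣n , room) → Admissible⇒Cay (inj₂ (d%4≡2 , 6≤d , 4∣n , room)))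
  where
  impossible : ∀ {n} → d % 2 ≡ 1 ⊎ d < 4 → Admissible d n → ⊥
  impossible (inj₁ odd)   adm = contradiction (trans (sym odd) (Admissible⇒even adm)) λ ()
  impossible (inj₂ d<4) adm = ℕ.<⇒≱ d<4 (Admissible⇒4≤d adm)
  bounds₀ : ∀ {n} → 4 ∣ d → Admissible d n → 2 ∣ n × d ℕ.+ 4 ≤ n
  bounds₀ 4∣d (inj₁ (_ , _ , bounds))    = bounds
  bounds₀ 4∣d (inj₂ (d%4≡2 , _)) = contradiction d%4≡2 (4∣d⇒d%4≢2 4∣d)
  bounds₂ : ∀ {n} → d % 4 ≡ 2 → Admissible d n → 4 ∣ n × d ℕ.+ 6 ≤ n
  bounds₂ d%4≡2 (inj₁ (4∣d , _))         = contradiction d%4≡2 (4∣d⇒d%4≢2 4∣d)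
  bounds₂ d%4≡2 (inj₂ (_ , _ , bounds)) = bounds
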